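{- Let $m \le n$ be positive integers with $m+n\ge 3$. Then $A(m,n) \leq m$.
   Context: For disjoint finite sets $\mathcal{P}, \mathcal{Q} \subset \mathbb{R}^2$, $A(\mathcal{P}, \mathcal{Q})$ denotes the number of distinct values in $(0,\pi)$ of angles whose central vertex lies in one of the two sets and whose two (distinct) endpoints both lie in the other set. $A(m,n)$ is the minimum of $A(\mathcal{P},\mathcal{Q})$ over all such pairs with $|\mathcal{P}|=m$, $|\mathcal{Q}|=n$ and $\mathcal{P}\cup\mathcal{Q}$ not all collinear. -}

module Defs where

open import Data.Fin.Base using (Fin)
import Data.Integer.Base as ℤ
open import Data.Nat.Base as ℕ using (ℕ; zero; suc; _⊔_; _!)
import Data.Nat.Properties as ℕ
open import Data.Product.Base using (Σ-syntax; ∃-syntax; _×_; _,_; proj₁; proj₂)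
open import Data.Rational.Base as ℚ using (ℚ; 0ℚ; 1ℚ; ∣_∣)
import Data.Rational.Properties as ℚ
open import Data.Rational.Solver using (module +-*-Solver)
open import Data.Sum.Base using (_⊎_)
open import Relation.Binary.PropositionalEquality
  using (_≡_; _≢_; refl; sym; trans; cong; cong₂; subst; module ≡-Reasoning)
open import Relation.Nullary.Negation using (¬_)

------------------------------------------------------------------------
-- Real numbers: Cauchy sequences of rationals with a modulus, taken up
-- to the setoid equality _≈_ below.

Cauchy : (ℕ → ℚ) → Set
Cauchy f = ∀ ε → 0ℚ ℚ.< ε →
  ∃[ N ] (∀ i j → N ℕ.≤ i → N ℕ.≤ j → ∣ f i ℚ.- f j ∣ ℚ.≤ ε)

record ℝ : Set where
  constructor mkℝ
  field
    seq    : ℕ → ℚ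
    cauchy : Cauchy seq

open ℝ public

private

  open +-*-Solver

  id-split : ∀ a b ε r → a ℚ.* (ε ℚ.* r) ℚ.+ b ℚ.* (ε ℚ.* r) ≡ ε ℚ.* ((a ℚ.+ b) ℚ.* r)
  id-split = solve 4 (λ a b ε r → a :* (ε :* r) :+ b :* (ε :* r) := ε :* ((a :+ b) :* r)) refl

  id-shift : ∀ a b → a ≡ (a ℚ.- b) ℚ.+ b
  id-shift = solve 2 (λ a b → a := (a :- b) :+ b) refl

  id-+ : ∀ a b c d → (a ℚ.+ b) ℚ.- (c ℚ.+ d) ≡ (a ℚ.- c) ℚ.+ (b ℚ.- d)
  id-+ = solve 4 (λ a b c d → (a :+ b) :- (c :+ d) := (a :- c) :+ (b :- d)) refl

  id-neg : ∀ a b → ℚ.- a ℚ.- ℚ.- b ≡ ℚ.- (a ℚ.- b)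
  id-neg = solve 2 (λ a b → (:- a) :- (:- b) := :- (a :- b)) refl

  id-* : ∀ a b c d → a ℚ.* b ℚ.- c ℚ.* d ≡ a ℚ.* (b ℚ.- d) ℚ.+ d ℚ.* (a ℚ.- c)
  id-* = solve 4 (λ a b c d → a :* b :- c :* d := a :* (b :- d) :+ d :* (a :- c)) refl

0<-* : ∀ p q → 0ℚ ℚ.< p → 0ℚ ℚ.< q → 0ℚ ℚ.< p ℚ.* q
0<-* p q 0<p 0<q =
  ℚ.positive⁻¹ (p ℚ.* q) {{ℚ.pos*pos⇒pos p {{ℚ.positive 0<p}} q {{ℚ.positive 0<q}}}}

split : ∀ ε a b → 0ℚ ℚ.< ε → 0ℚ ℚ.< a ℚ.+ b →
        ∃[ δ ] (0ℚ ℚ.< δ × a ℚ.* δ ℚ.+ b ℚ.* δ ≡ ε)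
split ε a b 0<ε 0<a+b = ε ℚ.* r , 0<-* ε r 0<ε 0<r , eq
  where
  instance
    pos : ℚ.Positive (a ℚ.+ b)
    pos = ℚ.positive 0<a+b
    nz : ℚ.NonZero (a ℚ.+ b)
    nz = ℚ.pos⇒nonZero (a ℚ.+ b)

  r : ℚ
  r = ℚ.1/ (a ℚ.+ b)

  0<r : 0ℚ ℚ.< r
  0<r = ℚ.positive⁻¹ r {{ℚ.1/pos⇒pos (a ℚ.+ b)}}

  open ≡-Reasoning

  eq : a ℚ.* (ε ℚ.* r) ℚ.+ b ℚ.* (ε ℚ.* r) ≡ ε
  eq = begin
    a ℚ.* (ε ℚ.* r) ℚ.+ b ℚ.* (ε ℚ.* r)
      ≡⟨ id-split a b ε r ⟩
    ε ℚ.* ((a ℚ.+ b) ℚ.* r)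
      ≡⟨ cong (ε ℚ.*_) (ℚ.*-inverseʳ (a ℚ.+ b)) ⟩
    ε ℚ.* 1ℚ
      ≡⟨ ℚ.*-identityʳ ε ⟩
    ε ∎

halve : ∀ ε → 0ℚ ℚ.< ε → ∃[ δ ] (0ℚ ℚ.< δ × δ ℚ.+ δ ≡ ε)
halve ε 0<ε =
  let δ , 0<δ , eq = split ε 1ℚ 1ℚ 0<ε (ℚ.positive⁻¹ (1ℚ ℚ.+ 1ℚ))
  in δ , 0<δ , trans (sym (cong₂ ℚ._+_ (ℚ.*-identityˡ δ) (ℚ.*-identityˡ δ))) eq

≤-mul : ∀ {p q r s} → 0ℚ ℚ.≤ r → 0ℚ ℚ.≤ q → p ℚ.≤ q → r ℚ.≤ s → p ℚ.* r ℚ.≤ q ℚ.* s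
≤-mul {p} {q} {r} {s} 0≤r 0≤q p≤q r≤s = ℚ.≤-trans
  (ℚ.*-monoʳ-≤-nonNeg r {{ℚ.nonNegative 0≤r}} p≤q)
  (ℚ.*-monoˡ-≤-nonNeg q {{ℚ.nonNegative 0≤q}} r≤s)

eventuallyBounded : ∀ f → Cauchy f →
  ∃[ B ] (0ℚ ℚ.< B × ∃[ N ] (∀ i → N ℕ.≤ i → ∣ f i ∣ ℚ.≤ B))
eventuallyBounded f cf with cf 1ℚ (ℚ.positive⁻¹ 1ℚ)
... | N , close = 1ℚ ℚ.+ ∣ f N ∣ , 0<B , N , bound
  where
  open ℚ.≤-Reasoning

  0<B : 0ℚ ℚ.< 1ℚ ℚ.+ ∣ f N ∣
  0<B = ℚ.+-mono-<-≤ (ℚ.positive⁻¹ 1ℚ) (ℚ.0≤∣p∣ (f N))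

  bound : ∀ i → N ℕ.≤ i → ∣ f i ∣ ℚ.≤ 1ℚ ℚ.+ ∣ f N ∣
  bound i N≤i = begin
    ∣ f i ∣
      ≡⟨ cong ∣_∣ (id-shift (f i) (f N)) ⟩
    ∣ (f i ℚ.- f N) ℚ.+ f N ∣
      ≤⟨ ℚ.∣p+q∣≤∣p∣+∣q∣ (f i ℚ.- f N) (f N) ⟩
    ∣ f i ℚ.- f N ∣ ℚ.+ ∣ f N ∣
      ≤⟨ ℚ.+-monoˡ-≤ ∣ f N ∣ (close i N N≤i ℕ.≤-refl) ⟩
    1ℚ ℚ.+ ∣ f N ∣ ∎

const-cauchy : ∀ q → Cauchy (λ _ → q)
const-cauchy q ε 0<ε = 0 , λ _ _ _ _ →
  subst (λ d → ∣ d ∣ ℚ.≤ ε) (sym (ℚ.+-inverseʳ q)) (ℚ.<⇒≤ 0<ε)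

+-cauchy : ∀ f g → Cauchy f → Cauchy g → Cauchy (λ i → f i ℚ.+ g i)
+-cauchy f g cf cg ε 0<ε =
  let δ , 0<δ , eq = halve ε 0<ε
      M , closeF = cf δ 0<δ
      N , closeG = cg δ 0<δ
      open ℚ.≤-Reasoning
  in M ⊔ N , λ i j M⊔N≤i M⊔N≤j → begin
    ∣ (f i ℚ.+ g i) ℚ.- (f j ℚ.+ g j) ∣
      ≡⟨ cong ∣_∣ (id-+ (f i) (g i) (f j) (g j)) ⟩
    ∣ (f i ℚ.- f j) ℚ.+ (g i ℚ.- g j) ∣
      ≤⟨ ℚ.∣p+q∣≤∣p∣+∣q∣ (f i ℚ.- f j) (g i ℚ.- g j) ⟩
    ∣ f i ℚ.- f j ∣ ℚ.+ ∣ g i ℚ.- g j ∣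
      ≤⟨ ℚ.+-mono-≤ (closeF i j (ℕ.m⊔n≤o⇒m≤o M N M⊔N≤i) (ℕ.m⊔n≤o⇒m≤o M N M⊔N≤j))
                    (closeG i j (ℕ.m⊔n≤o⇒n≤o M N M⊔N≤i) (ℕ.m⊔n≤o⇒n≤o M N M⊔N≤j)) ⟩
    δ ℚ.+ δ
      ≡⟨ eq ⟩
    ε ∎

neg-cauchy : ∀ f → Cauchy f → Cauchy (λ i → ℚ.- f i)
neg-cauchy f cf ε 0<ε =
  let N , close = cf ε 0<ε
      open ℚ.≤-Reasoning
  in N , λ i j N≤i N≤j → begin
    ∣ ℚ.- f i ℚ.- ℚ.- f j ∣
      ≡⟨ cong ∣_∣ (id-neg (f i) (f j)) ⟩
    ∣ ℚ.- (f i ℚ.- f j) ∣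
      ≡⟨ ℚ.∣-p∣≡∣p∣ (f i ℚ.- f j) ⟩
    ∣ f i ℚ.- f j ∣
      ≤⟨ close i j N≤i N≤j ⟩
    ε ∎

*-cauchy : ∀ f g → Cauchy f → Cauchy g → Cauchy (λ i → f i ℚ.* g i)
*-cauchy f g cf cg ε 0<ε =
  let A , 0<A , K , boundF = eventuallyBounded f cf
      B , 0<B , L , boundG = eventuallyBounded g cg
      δ , 0<δ , eq = split ε A B 0<ε (ℚ.+-mono-< 0<A 0<B)
      M , closeF = cf δ 0<δ
      N , closeG = cg δ 0<δ
      open ℚ.≤-Reasoning
      K⊔L≤ = λ {k} (p : (K ⊔ L) ⊔ (M ⊔ N) ℕ.≤ k) → ℕ.m⊔n≤o⇒m≤o (K ⊔ L) (M ⊔ N) p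
      M⊔N≤ = λ {k} (p : (K ⊔ L) ⊔ (M ⊔ N) ℕ.≤ k) → ℕ.m⊔n≤o⇒n≤o (K ⊔ L) (M ⊔ N) p
  in (K ⊔ L) ⊔ (M ⊔ N) , λ i j le-i le-j → begin
    ∣ f i ℚ.* g i ℚ.- f j ℚ.* g j ∣
      ≡⟨ cong ∣_∣ (id-* (f i) (g i) (f j) (g j)) ⟩
    ∣ f i ℚ.* (g i ℚ.- g j) ℚ.+ g j ℚ.* (f i ℚ.- f j) ∣
      ≤⟨ ℚ.∣p+q∣≤∣p∣+∣q∣ (f i ℚ.* (g i ℚ.- g j)) (g j ℚ.* (f i ℚ.- f j)) ⟩
    ∣ f i ℚ.* (g i ℚ.- g j) ∣ ℚ.+ ∣ g j ℚ.* (f i ℚ.- f j) ∣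
      ≡⟨ cong₂ ℚ._+_ (ℚ.∣p*q∣≡∣p∣*∣q∣ (f i) (g i ℚ.- g j)) (ℚ.∣p*q∣≡∣p∣*∣q∣ (g j) (f i ℚ.- f j)) ⟩
    ∣ f i ∣ ℚ.* ∣ g i ℚ.- g j ∣ ℚ.+ ∣ g j ∣ ℚ.* ∣ f i ℚ.- f j ∣
      ≤⟨ ℚ.+-mono-≤
           (≤-mul (ℚ.0≤∣p∣ (g i ℚ.- g j)) (ℚ.<⇒≤ 0<A)
             (boundF i (ℕ.m⊔n≤o⇒m≤o K L (K⊔L≤ le-i)))
             (closeG i j (ℕ.m⊔n≤o⇒n≤o M N (M⊔N≤ le-i)) (ℕ.m⊔n≤o⇒n≤o M N (M⊔N≤ le-j))))
           (≤-mul (ℚ.0≤∣p∣ (f i ℚ.- f j)) (ℚ.<⇒≤ 0<B)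
             (boundG j (ℕ.m⊔n≤o⇒n≤o K L (K⊔L≤ le-j)))
             (closeF i j (ℕ.m⊔n≤o⇒m≤o M N (M⊔N≤ le-i)) (ℕ.m⊔n≤o⇒m≤o M N (M⊔N≤ le-j)))) ⟩
    A ℚ.* δ ℚ.+ B ℚ.* δ
      ≡⟨ eq ⟩
    ε ∎

infix  8 -_
infixl 7 _*_
infixl 6 _+_ _-_
infix  4 _≈_ _<_ _≤_
infixr 8 _^_

fromℚ : ℚ → ℝ
fromℚ q = mkℝ (λ _ → q) (const-cauchy q)

0ℝ 1ℝ : ℝ
0ℝ = fromℚ 0ℚ
1ℝ = fromℚ 1ℚ

_+_ _*_ : ℝ → ℝ → ℝ
x + y = mkℝ (λ i → seq x i ℚ.+ seq y i) (+-cauchy (seq x) (seq y) (cauchy x) (cauchy y))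
x * y = mkℝ (λ i → seq x i ℚ.* seq y i) (*-cauchy (seq x) (seq y) (cauchy x) (cauchy y))

-_ : ℝ → ℝ
-_ x = mkℝ (λ i → ℚ.- seq x i) (neg-cauchy (seq x) (cauchy x))

_-_ : ℝ → ℝ → ℝ
x - y = x + (- y)

_^_ : ℝ → ℕ → ℝ
x ^ zero  = 1ℝ
x ^ suc k = x * x ^ k

_≈_ : ℝ → ℝ → Set
x ≈ y = ∀ ε → 0ℚ ℚ.< ε →
  ∃[ N ] (∀ i → N ℕ.≤ i → ∣ seq x i ℚ.- seq y i ∣ ℚ.≤ ε)

_<_ : ℝ → ℝ → Set
x < y = ∃[ ε ] (0ℚ ℚ.< ε × ∃[ N ] (∀ i → N ℕ.≤ i → seq x i ℚ.+ ε ℚ.≤ seq y i))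

_≤_ : ℝ → ℝ → Set
x ≤ y = ¬ (y < x)

------------------------------------------------------------------------
-- Cosine, sine and π.  The functions are given by their graphs:
-- Cos x c says that the cosine series at x has sum c.

partialSum : (ℕ → ℝ) → ℕ → ℝ
partialSum f zero    = 0ℝ
partialSum f (suc n) = partialSum f n + f n

HasSum : (ℕ → ℝ) → ℝ → Set
HasSum f s = ∀ ε → 0ℚ ℚ.< ε →
  ∃[ N ] (∀ n → N ℕ.≤ n →
    (s - fromℚ ε < partialSum f n) × (partialSum f n < s + fromℚ ε))

-- (-1)ᵏ / d!
signedInverseFactorial : (k d : ℕ) → ℚ
signedInverseFactorial k d = (ℤ.-1ℤ ℤ.^ k) ℚ./ (d !)
  where instance _ = d ℕ.!≢0

cosTerm sinTerm : ℝ → ℕ → ℝ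
cosTerm x k = fromℚ (signedInverseFactorial k (2 ℕ.* k)) * x ^ (2 ℕ.* k)
sinTerm x k = fromℚ (signedInverseFactorial k (suc (2 ℕ.* k))) * x ^ suc (2 ℕ.* k)

Cos Sin : ℝ → ℝ → Set
Cos x c = HasSum (cosTerm x) c
Sin x s = HasSum (sinTerm x) s

-- π is the least positive zero of sine, which determines it up to _≈_.
IsPi : ℝ → Set
IsPi π = 0ℝ < π × Sin π 0ℝ × (∀ x → 0ℝ < x → x < π → ¬ Sin x 0ℝ)

Point : Set
Point = ℝ × ℝ

_≈ₚ_ : Point → Point → Set
(a , b) ≈ₚ (c , d) = a ≈ c × b ≈ d

_-ₚ_ : Point → Point → Point
(a , b) -ₚ (c , d) = (a - c) , (b - d)

_·_ : Point → Point → ℝ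
(a , b) · (c , d) = a * c + b * d

IsNorm : Point → ℝ → Set
IsNorm u r = 0ℝ ≤ r × r * r ≈ u · u

-- θ ∈ [0,π] is the measure of the angle at the vertex v with endpoints a
-- and b, that is, arccos (u · w / (‖u‖ ‖w‖)) for u = a - v and w = b - v.
-- This is only meaningful when a and b differ from v, which disjointness
-- of the two point sets guarantees below.
IsAngle : ℝ → (a v b : Point) → ℝ → Set
IsAngle π a v b θ =
  0ℝ ≤ θ × θ ≤ π ×
  ∃[ r ] ∃[ s ] ∃[ c ]
    (IsNorm (a -ₚ v) r × IsNorm (b -ₚ v) s × Cos θ c ×
     (a -ₚ v) · (b -ₚ v) ≈ (r * s) * c)

OnLine : (a b c : ℝ) → Point → Set
OnLine a b c (x , y) = a * x + b * y ≈ c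

-- A pair (𝒫, 𝒬) with |𝒫| = m and |𝒬| = n, each set given by an injective
-- enumeration.
record Configuration (m n : ℕ) : Set where
  field
    P           : Fin m → Point
    Q           : Fin n → Point
    P-injective : ∀ i j → P i ≈ₚ P j → i ≡ j
    Q-injective : ∀ i j → Q i ≈ₚ Q j → i ≡ j
    disjoint    : ∀ i j → ¬ (P i ≈ₚ Q j)
    noncollinear : ¬ (∃[ a ] ∃[ b ] ∃[ c ]
      (¬ (a ≈ 0ℝ × b ≈ 0ℝ) × (∀ i → OnLine a b c (P i)) × (∀ j → OnLine a b c (Q j))))

-- Values in (0,π) of angles with vertex in the family V and two distinct
-- endpoints in the family E.
AngleFrom : ℝ → ∀ {m n} → (V : Fin m → Point) (E : Fin n → Point) → ℝ → Set
AngleFrom π V E θ =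
  0ℝ < θ × θ < π ×
  ∃[ v ] ∃[ i ] ∃[ j ] (i ≢ j × IsAngle π (E i) (V v) (E j) θ)

AngleValue : ℝ → ∀ {m n} → Configuration m n → ℝ → Set
AngleValue π C θ = AngleFrom π P Q θ ⊎ AngleFrom π Q P θ
  where open Configuration C

HasCardinality : (ℝ → Set) → ℕ → Set
HasCardinality S k = Σ[ f ∈ (Fin k → ℝ) ]
  ((∀ i → S (f i)) × (∀ i j → f i ≈ f j → i ≡ j) × (∀ x → S x → ∃[ i ] x ≈ f i))

-- A(𝒫, 𝒬) = k for some admissible pair with |𝒫| = m and |𝒬| = n.
AngleCount : ℝ → (m n : ℕ) → ℕ → Set
AngleCount π m n k = Σ[ C ∈ Configuration m n ] HasCardinality (AngleValue π C) k

IsMinimum : (ℕ → Set) → ℕ → Set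
IsMinimum S k = S k × (∀ l → S l → k ℕ.≤ l)

-- A(m, n) = k.  Neither A(𝒫, 𝒬) nor A(m, n) is computable as a function,
-- since equality and order on ℝ are undecidable.
IsA : ℝ → (m n : ℕ) → ℕ → Set
IsA π m n = IsMinimum (AngleCount π m n)

-- A(m, n) ≤ k: some admissible pair has at most k angle values, and hence
-- (classically) the minimum exists; and the minimum is at most k.
A≤ : ℝ → (m n : ℕ) → ℕ → Set
A≤ π m n k =
  (∃[ a ] (AngleCount π m n a × a ℕ.≤ k)) ×
  (∀ a → IsA π m n a → a ℕ.≤ k)

{-# OPTIONS --safe #-}
module Submission where

-- Put n - 1 points of 𝒬 at (1, 0), ..., (n - 1, 0), the last one q at (0, 1),
-- and the points p₁, ..., pₘ of 𝒫 on the nonpositive x-axis so that the ray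
-- from pₖ through q makes the angle kα with the positive x-axis, where
-- α = 1/(m + 1).  At pₖ the only angle is kα, at q the angles are the
-- differences of multiples of α, and at the other points of 𝒬 all angles
-- vanish: exactly the m values α, ..., mα occur.
--
-- On the analytic side, the addition formulas come from the Cauchy product of
-- truncated series.  They give cos u - cos v = 2 sin ((u + v)/2) sin ((v - u)/2),
-- so that cosine is injective on [0, π] because sine has no zero in (0, π).
-- That kα < π holds because sine is positive on (0, 1].

open import Algebra.Bundles using (CommutativeRing; RawRing)
import Algebra.Consequences.Setoid
import Algebra.Solver.Ring
open import Algebra.Solver.Ring.AlmostCommutativeRing
  using (fromCommutativeRing; _-Raw-AlmostCommutative⟶_)
open import Data.Empty using (⊥; ⊥-elim)
open import Data.Fin.Base using (Fin; zero; suc; toℕ; fromℕ<)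
import Data.Fin.Properties as Fin
import Data.Integer.Base as ℤ
import Data.Integer.Properties as ℤ
open import Data.Maybe.Base as Maybe using (Maybe)
open import Data.Nat.Base as ℕ using (ℕ; zero; suc; _⊔_; _!)
import Data.Nat.Coprimality as Coprime
import Data.Nat.Properties as ℕ
open import Data.Product.Base using (∃-syntax; _×_; _,_; proj₁; proj₂)
open import Data.Rational.Base as ℚ using (ℚ; 0ℚ; 1ℚ; ½; ∣_∣)
import Data.Rational.Properties as ℚ
import Data.Rational.Solver as ℚ
import Data.Rational.Unnormalised.Base as ℚᵘ
import Data.Rational.Unnormalised.Properties as ℚᵘ
open import Data.Sum.Base using (_⊎_; inj₁; inj₂; [_,_]′)
open import Function.Base using (_∘_; case_of_)
open import Level using (0ℓ)
open import Relation.Binary.Bundles using (Setoid)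
open import Relation.Binary.Definitions using (tri<; tri≈; tri>)
open import Relation.Binary.PropositionalEquality
  using (_≡_; _≢_; refl; sym; trans; cong; cong₂; subst; subst₂; module ≡-Reasoning)
import Relation.Binary.Reasoning.Setoid
open import Relation.Binary.Structures using (IsEquivalence)
open import Relation.Nullary.Decidable using (yes; no; dec⇒maybe; decidable-stable)
open import Relation.Nullary.Negation using (¬_)

-- Order and equality on ℝ are undecidable, so case distinctions are made on rational approximants
-- only, or under a negation. The angles kα are rational and below 1: elementary estimates of
-- truncated series then make their sines positive and their cosines nonnegative, and the positions
-- of the points do not involve π. `IsPi` supplies negative information, that sine has no zero in
-- (0, π). This suffices for cancellation, because equality on ℝ is itself the absence of apartness.
--
-- No square root is extracted. With pₖ at minus the cotangent of kα, its distance to q is the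
-- reciprocal of sin kα, and every other distance is a difference of abscissae.
--
-- The i-th approximant of cos x is the series cut after i terms, evaluated at the i-th approximant
-- of x. The truncated addition formulas therefore need an error that tends to 0 with the length,
-- uniformly for bounded arguments. Majorising qᵏ / k! by a multiple of 4⁻ᵏ leaves 2⁻ⁿ for the part
-- of the Cauchy product beyond the triangle.

module RationalSeries where

  open import Data.Rational.Base
  open import Data.Rational.Properties
  open ℚ.+-*-Solver

  -- Rational inequalities

  0≤+ : ∀ {p q} → 0ℚ ≤ p → 0ℚ ≤ q → 0ℚ ≤ p + q
  0≤+ = +-mono-≤

  0≤* : ∀ {p q} → 0ℚ ≤ p → 0ℚ ≤ q → 0ℚ ≤ p * q
  0≤* {p} {q} 0≤p 0≤q =
    nonNegative⁻¹ (p * q) {{nonNeg*nonNeg⇒nonNeg p {{nonNegative 0≤p}} q {{nonNegative 0≤q}}}}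

  0<* : ∀ {p q} → 0ℚ < p → 0ℚ < q → 0ℚ < p * q
  0<* {p} {q} 0<p 0<q = positive⁻¹ (p * q) {{pos*pos⇒pos p {{positive 0<p}} q {{positive 0<q}}}}

  *-monoˡ : ∀ {p q r} → 0ℚ ≤ r → p ≤ q → r * p ≤ r * q
  *-monoˡ {r = r} 0≤r = *-monoˡ-≤-nonNeg r {{nonNegative 0≤r}}

  *-monoʳ : ∀ {p q r} → 0ℚ ≤ r → p ≤ q → p * r ≤ q * r
  *-monoʳ {r = r} 0≤r = *-monoʳ-≤-nonNeg r {{nonNegative 0≤r}}

  *-mono : ∀ {p q r s} → 0ℚ ≤ r → 0ℚ ≤ q → p ≤ q → r ≤ s → p * r ≤ q * s
  *-mono 0≤r 0≤q p≤q r≤s = ≤-trans (*-monoʳ 0≤r p≤q) (*-monoˡ 0≤q r≤s)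

  ≤-by : ∀ {p q} d → 0ℚ ≤ d → p + d ≡ q → p ≤ q
  ≤-by {p} d 0≤d eq = subst₂ _≤_ (+-identityʳ p) eq (+-monoʳ-≤ p 0≤d)

  0≤q-p : ∀ {p q} → p ≤ q → 0ℚ ≤ q - p
  0≤q-p {p} {q} p≤q = subst (_≤ q - p) (+-inverseʳ p) (+-monoˡ-≤ (- p) p≤q)

  0<q-p : ∀ {p q} → p < q → 0ℚ < q - p
  0<q-p {p} {q} p<q = subst (_< q - p) (+-inverseʳ p) (+-monoˡ-< (- p) p<q)

  p≤∣p∣ : ∀ p → p ≤ ∣ p ∣
  p≤∣p∣ p with ≤-total 0ℚ p
  ... | inj₁ 0≤p = ≤-reflexive (sym (0≤p⇒∣p∣≡p 0≤p))
  ... | inj₂ p≤0 = ≤-trans p≤0 (0≤∣p∣ p)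

  -p≤∣p∣ : ∀ p → - p ≤ ∣ p ∣
  -p≤∣p∣ p = subst (- p ≤_) (∣-p∣≡∣p∣ p) (p≤∣p∣ (- p))

  ∣p∣≤ : ∀ {p q} → p ≤ q → - p ≤ q → ∣ p ∣ ≤ q
  ∣p∣≤ {p} p≤q -p≤q with ∣p∣≡p∨∣p∣≡-p p
  ... | inj₁ eq = subst (_≤ _) (sym eq) p≤q
  ... | inj₂ eq = subst (_≤ _) (sym eq) -p≤q

  ∣p-q∣≡∣q-p∣ : ∀ p q → ∣ p - q ∣ ≡ ∣ q - p ∣
  ∣p-q∣≡∣q-p∣ p q = trans (sym (∣-p∣≡∣p∣ (p - q)))
    (cong ∣_∣ (solve 2 (λ p q → :- (p :- q) := q :- p) refl p q))

  ∣p*q∣≤ : ∀ {p q r s} → ∣ p ∣ ≤ r → ∣ q ∣ ≤ s → ∣ p * q ∣ ≤ r * s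
  ∣p*q∣≤ {p} {q} p≤r q≤s = subst (_≤ _) (sym (∣p*q∣≡∣p∣*∣q∣ p q))
    (*-mono (0≤∣p∣ q) (≤-trans (0≤∣p∣ p) p≤r) p≤r q≤s)

  ∣p+q∣≤ : ∀ {p q r s} → ∣ p ∣ ≤ r → ∣ q ∣ ≤ s → ∣ p + q ∣ ≤ r + s
  ∣p+q∣≤ {p} {q} p≤r q≤s = ≤-trans (∣p+q∣≤∣p∣+∣q∣ p q) (+-mono-≤ p≤r q≤s)

  -- Natural numbers, reciprocals and powers of one half as rationals

  nat : ℕ → ℚ
  nat zero    = 0ℚ
  nat (suc n) = 1ℚ + nat n

  0≤1 : 0ℚ ≤ 1ℚ
  0≤1 = nonNegative⁻¹ 1ℚ

  0≤½ : 0ℚ ≤ ½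
  0≤½ = nonNegative⁻¹ ½

  0≤nat : ∀ n → 0ℚ ≤ nat n
  0≤nat zero    = ≤-refl
  0≤nat (suc n) = 0≤+ 0≤1 (0≤nat n)

  0<nat : ∀ n → 0ℚ < nat (suc n)
  0<nat n = +-mono-<-≤ (positive⁻¹ 1ℚ) (0≤nat n)

  nat-+ : ∀ m n → nat (m ℕ.+ n) ≡ nat m + nat n
  nat-+ zero    n = sym (+-identityˡ (nat n))
  nat-+ (suc m) n = trans (cong (1ℚ +_) (nat-+ m n)) (sym (+-assoc 1ℚ (nat m) (nat n)))

  nat-mono : ∀ {m n} → m ℕ.≤ n → nat m ≤ nat n
  nat-mono {n = n} ℕ.z≤n = 0≤nat n
  nat-mono (ℕ.s≤s m≤n) = +-monoʳ-≤ 1ℚ (nat-mono m≤n)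

  nat-positive : ∀ n → Positive (nat (suc n))
  nat-positive n = positive (0<nat n)

  nat-nonZero : ∀ n → NonZero (nat (suc n))
  nat-nonZero n = pos⇒nonZero (nat (suc n)) {{nat-positive n}}

  recip : ℕ → ℚ
  recip n = (1/ nat (suc n)) {{nat-nonZero n}}

  nat*recip : ∀ n → nat (suc n) * recip n ≡ 1ℚ
  nat*recip n = *-inverseʳ (nat (suc n)) {{nat-nonZero n}}

  0<recip : ∀ n → 0ℚ < recip n
  0<recip n = positive⁻¹ (recip n) {{1/pos⇒pos (nat (suc n)) {{nat-positive n}}}}

  0≤recip : ∀ n → 0ℚ ≤ recip n
  0≤recip n = <⇒≤ (0<recip n)

  recip≤½ : ∀ n → recip (suc n) ≤ ½
  recip≤½ n = *-cancelˡ-≤-pos (nat (suc (suc n))) {{nat-positive (suc n)}}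
    (≤-trans (≤-reflexive (nat*recip (suc n)))
      (≤-by (½ * nat n) (0≤* 0≤½ (0≤nat n))
        (solve 1 (λ n → con 1ℚ :+ con ½ :* n := (con 1ℚ :+ (con 1ℚ :+ n)) :* con ½) refl (nat n))))

  -- Links the unary `nat`, suited to induction and to the ring solver, with the normal form in
  -- which numerators can be compared.
  nat≡mkℚ : ∀ n → nat n ≡ mkℚ (ℤ.+ n) 0 (Coprime.sym (Coprime.1-coprimeTo n))
  nat≡mkℚ zero    = refl
  nat≡mkℚ (suc n) = trans (cong (1ℚ +_) (nat≡mkℚ n))
    (trans (cong (_/ 1) (cong (λ k → (ℤ.+ 1) ℤ.+ k) (ℤ.*-identityʳ (ℤ.+ n))))
           (normalize-coprime (Coprime.sym (Coprime.1-coprimeTo (suc n)))))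

  -- The absolute value of the numerator serves as the bound, since the denominator is at least 1.
  archimedean : ∀ p → ∃[ n ] p ≤ nat n
  archimedean p@(mkℚ i d c) = ℤ.∣ i ∣ , subst (p ≤_) (sym (nat≡mkℚ ℤ.∣ i ∣))
    (*≤* (ℤ.≤-trans (ℤ.≤-reflexive (ℤ.*-identityʳ i))
      (ℤ.≤-trans (i≤∣i∣ i) (ℤ.≤-trans (ℤ.≤-reflexive (sym (ℤ.*-identityʳ (ℤ.+ ℤ.∣ i ∣))))
        (ℤ.*-monoˡ-≤-nonNeg (ℤ.+ ℤ.∣ i ∣) (ℤ.+≤+ (ℕ.s≤s ℕ.z≤n)))))))
    where
    i≤∣i∣ : ∀ i → i ℤ.≤ ℤ.+ ℤ.∣ i ∣
    i≤∣i∣ (ℤ.+ n)     = ℤ.≤-refl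
    i≤∣i∣ ℤ.-[1+ n ] = ℤ.-≤+

  -- Clears the factorial denominators of `signedInverseFactorial`. The detour through unnormalised
  -- fractions avoids the gcd taken by `_/_`.
  /-*-nat : ∀ i n → i / suc n * nat (suc n) ≡ i / 1
  /-*-nat i n = toℚᵘ-injective (begin
    toℚᵘ (i / suc n * nat (suc n))           ≈⟨ toℚᵘ-homo-* (i / suc n) (nat (suc n)) ⟩
    toℚᵘ (i / suc n) ℚᵘ.* toℚᵘ (nat (suc n))
      ≈⟨ ℚᵘ.*-cong (toℚᵘ-fromℚᵘ (ℚᵘ.mkℚᵘ i n)) (ℚᵘ.≃-reflexive (cong toℚᵘ (nat≡mkℚ (suc n)))) ⟩
    ℚᵘ.mkℚᵘ i n ℚᵘ.* ℚᵘ.mkℚᵘ (ℤ.+ suc n) 0  ≈⟨ ℚᵘ.*≡* (trans (ℤ.*-identityʳ _)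
        (cong (λ k → i ℤ.* (ℤ.+ suc k)) (sym (ℕ.*-identityʳ n)))) ⟩
    ℚᵘ.mkℚᵘ i 0                              ≈⟨ toℚᵘ-fromℚᵘ (ℚᵘ.mkℚᵘ i 0) ⟨
    toℚᵘ (i / 1)                             ∎)
    where
    open ℚᵘ.≃-Reasoning

  half : ℕ → ℚ
  half zero    = 1ℚ
  half (suc n) = ½ * half n

  0≤half : ∀ n → 0ℚ ≤ half n
  0≤half zero    = 0≤1
  0≤half (suc n) = 0≤* 0≤½ (0≤half n)

  half≤1 : ∀ n → half n ≤ 1ℚ
  half≤1 zero    = ≤-refl
  half≤1 (suc n) = ≤-trans (*-monoˡ 0≤½ (half≤1 n)) (≤-by ½ 0≤½ refl)

  half*half≤half : ∀ n → half n * half n ≤ half n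
  half*half≤half n = ≤-trans (*-monoˡ (0≤half n) (half≤1 n)) (≤-reflexive (*-identityʳ (half n)))

  nat*half≤1 : ∀ n → nat (suc n) * half n ≤ 1ℚ
  nat*half≤1 zero    = ≤-refl
  nat*half≤1 (suc n) = ≤-trans
    (≤-by (½ * nat n * half n) (0≤* (0≤* 0≤½ (0≤nat n)) (0≤half n))
      (solve 2 (λ x h → (con 1ℚ :+ (con 1ℚ :+ x)) :* (con ½ :* h) :+ con ½ :* x :* h
                     := (con 1ℚ :+ x) :* h) refl (nat n) (half n)))
    (nat*half≤1 n)

  -- For i ≥ N ≥ K/ε the left side is at most ε (i + 1) 2⁻ⁱ, and (i + 1) 2⁻ⁱ ≤ 1.
  K*half-small : ∀ K ε → 0ℚ < ε → ∃[ N ] (∀ i → N ℕ.≤ i → K * half i ≤ ε)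
  K*half-small K ε 0<ε =
    let N , K/ε≤N = archimedean (K * (1/ ε)) in N , λ i N≤i →
    let open ≤-Reasoning in begin
    K * half i
      ≡⟨ cong (_* half i) (trans (sym (*-identityʳ K)) (cong (K *_) (sym (*-inverseˡ ε)))) ⟩
    K * (1/ ε * ε) * half i
      ≡⟨ cong (_* half i) (sym (*-assoc K (1/ ε) ε)) ⟩
    K * 1/ ε * ε * half i
      ≤⟨ *-monoʳ (0≤half i) (*-monoʳ (<⇒≤ 0<ε) (≤-trans K/ε≤N (nat-mono (ℕ.m≤n⇒m≤1+n N≤i)))) ⟩
    nat (suc i) * ε * half i
      ≡⟨ solve 3 (λ n e h → n :* e :* h := e :* (n :* h)) refl (nat (suc i)) ε (half i) ⟩
    ε * (nat (suc i) * half i)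
      ≤⟨ *-monoˡ (<⇒≤ 0<ε) (nat*half≤1 i) ⟩
    ε * 1ℚ
      ≡⟨ *-identityʳ ε ⟩
    ε ∎
    where
    instance
      nonZero-ε : NonZero ε
      nonZero-ε = >-nonZero 0<ε

  -- Finite sums and the Cauchy product

  sum : (ℕ → ℚ) → ℕ → ℚ
  sum f zero    = 0ℚ
  sum f (suc n) = sum f n + f n

  sum-cong : ∀ {f g} → (∀ k → f k ≡ g k) → ∀ n → sum f n ≡ sum g n
  sum-cong eq zero    = refl
  sum-cong eq (suc n) = cong₂ _+_ (sum-cong eq n) (eq n)

  sum-+ : ∀ f g n → sum (λ k → f k + g k) n ≡ sum f n + sum g n
  sum-+ f g zero    = refl
  sum-+ f g (suc n) = trans (cong (_+ (f n + g n)) (sum-+ f g n))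
    (solve 4 (λ a b c d → a :+ b :+ (c :+ d) := a :+ c :+ (b :+ d)) refl (sum f n) (sum g n) (f n) (g n))

  sum-* : ∀ p f n → sum (λ k → p * f k) n ≡ p * sum f n
  sum-* p f zero    = sym (*-zeroʳ p)
  sum-* p f (suc n) = trans (cong (_+ p * f n) (sum-* p f n)) (sym (*-distribˡ-+ p (sum f n) (f n)))

  sum-neg : ∀ f n → sum (λ k → - f k) n ≡ - sum f n
  sum-neg f zero    = refl
  sum-neg f (suc n) = trans (cong (_+ - f n) (sum-neg f n)) (sym (neg-distrib-+ (sum f n) (f n)))

  sum-shift : ∀ f n → sum f (suc n) ≡ f 0 + sum (f ∘ suc) n
  sum-shift f zero    = trans (+-identityˡ (f 0)) (sym (+-identityʳ (f 0)))
  sum-shift f (suc n) = trans (cong (_+ f (suc n)) (sum-shift f n)) (+-assoc (f 0) _ _)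

  ∣sum∣≤ : ∀ {f g} → (∀ k → ∣ f k ∣ ≤ g k) → ∀ n → ∣ sum f n ∣ ≤ sum g n
  ∣sum∣≤ f≤g zero    = ≤-refl
  ∣sum∣≤ f≤g (suc n) = ∣p+q∣≤ (∣sum∣≤ f≤g n) (f≤g n)

  -- The subtracted term carries the induction: the new summand contributes at most K 2⁻ᵐ, which is
  -- exactly the drop of 2K 2⁻ᵐ to 2K 2⁻⁽ᵐ⁺¹⁾.
  ∣sum-tail∣≤ : ∀ f K → (∀ k → ∣ f k ∣ ≤ K * half k) → ∀ n p →
    ∣ sum f (p ℕ.+ n) - sum f n ∣ ≤ K * (half n + half n) - K * (half (p ℕ.+ n) + half (p ℕ.+ n))
  ∣sum-tail∣≤ f K f≤ n zero = ≤-reflexive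
    (trans (cong ∣_∣ (+-inverseʳ (sum f n))) (sym (+-inverseʳ (K * (half n + half n)))))
  ∣sum-tail∣≤ f K f≤ n (suc p) = let open ≤-Reasoning in begin
    ∣ sum f m + f m - sum f n ∣
      ≡⟨ cong ∣_∣ (solve 3 (λ a b c → a :+ b :- c := a :- c :+ b) refl (sum f m) (f m) (sum f n)) ⟩
    ∣ sum f m - sum f n + f m ∣
      ≤⟨ ∣p+q∣≤ (∣sum-tail∣≤ f K f≤ n p) (f≤ m) ⟩
    K * (half n + half n) - K * (half m + half m) + K * half m
      ≡⟨ solve 3 (λ K x y → K :* (x :+ x) :- K :* (y :+ y) :+ K :* y
                         := K :* (x :+ x) :- K :* (con ½ :* y :+ con ½ :* y)) refl K (half n) (half m) ⟩
    K * (half n + half n) - K * (half (suc m) + half (suc m)) ∎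
    where m = p ℕ.+ n

  0≤-majorant : ∀ (f : ℕ → ℚ) K → (∀ k → ∣ f k ∣ ≤ K * half k) → 0ℚ ≤ K
  0≤-majorant f K f≤ = ≤-trans (0≤∣p∣ (f 0)) (subst (∣ f 0 ∣ ≤_) (*-identityʳ K) (f≤ 0))

  ∣sum-diff∣≤ : ∀ f K → (∀ k → ∣ f k ∣ ≤ K * half k) → ∀ n m → n ℕ.≤ m →
    ∣ sum f m - sum f n ∣ ≤ (K + K) * half n
  ∣sum-diff∣≤ f K f≤ n m n≤m =
    subst (λ l → ∣ sum f l - sum f n ∣ ≤ (K + K) * half n) (ℕ.m∸n+n≡m n≤m)
      (≤-trans (∣sum-tail∣≤ f K f≤ n (m ℕ.∸ n))
        (≤-by (K * (h + h)) (0≤* {K} {h + h} (0≤-majorant f K f≤) (0≤+ (0≤half l) (0≤half l)))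
          (solve 3 (λ K x y → K :* (x :+ x) :- K :* (y :+ y) :+ K :* (y :+ y) := (K :+ K) :* x)
            refl K (half n) h)))
    where
    l = m ℕ.∸ n ℕ.+ n
    h = half l

  ∣sum∣≤2K : ∀ f K → (∀ k → ∣ f k ∣ ≤ K * half k) → ∀ n → ∣ sum f n ∣ ≤ K + K
  ∣sum∣≤2K f K f≤ n = subst₂ (λ x y → ∣ x ∣ ≤ y) (+-identityʳ (sum f n)) (*-identityʳ (K + K))
    (∣sum-diff∣≤ f K f≤ 0 n ℕ.z≤n)

  -- The antidiagonal sum ∑ F j l over j + l = n.
  diag : (ℕ → ℕ → ℚ) → ℕ → ℚ
  diag F zero    = F 0 0
  diag F (suc n) = F 0 (suc n) + diag (F ∘ suc) n

  diag-cong : ∀ {F G} → (∀ j l → F j l ≡ G j l) → ∀ n → diag F n ≡ diag G n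
  diag-cong eq zero    = eq 0 0
  diag-cong eq (suc n) = cong₂ _+_ (eq 0 (suc n)) (diag-cong (λ j → eq (suc j)) n)

  diag-+ : ∀ F G n → diag (λ j l → F j l + G j l) n ≡ diag F n + diag G n
  diag-+ F G zero    = refl
  diag-+ F G (suc n) = trans (cong (F 0 (suc n) + G 0 (suc n) +_) (diag-+ (F ∘ suc) (G ∘ suc) n))
    (solve 4 (λ a b c d → a :+ b :+ (c :+ d) := a :+ c :+ (b :+ d)) refl (F 0 (suc n)) (G 0 (suc n)) (diag (F ∘ suc) n) (diag (G ∘ suc) n))

  -- On an antidiagonal j + l is constant. This serves both the weight j + l in `binomial` and the
  -- coefficients `c (j + l)` and `s (j + l)` in the addition formulas.
  diag-weight : ∀ (w : ℕ → ℚ) F n → diag (λ j l → w (j ℕ.+ l) * F j l) n ≡ w n * diag F n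
  diag-weight w F zero    = refl
  diag-weight w F (suc n) = trans (cong (w (suc n) * F 0 (suc n) +_) (diag-weight (w ∘ suc) (F ∘ suc) n))
    (sym (*-distribˡ-+ (w (suc n)) (F 0 (suc n)) (diag (F ∘ suc) n)))

  diag-* : ∀ p F n → diag (λ j l → p * F j l) n ≡ p * diag F n
  diag-* p = diag-weight (λ _ → p)

  -- Splits off the opposite end from the one in the definition of `diag`, so that l can be shifted
  -- instead of j.
  diag-last : ∀ F n → diag F (suc n) ≡ diag (λ j l → F j (suc l)) n + F (suc n) 0
  diag-last F zero    = refl
  diag-last F (suc n) = trans (cong (F 0 (suc (suc n)) +_) (diag-last (F ∘ suc) n))
    (sym (+-assoc (F 0 (suc (suc n))) _ _))

  -- What the square ∑ f j g l over j, l < n has beyond the triangle j + l < n.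
  excess : (f g : ℕ → ℚ) → ℕ → ℚ
  excess f g zero    = 0ℚ
  excess f g (suc n) = excess (f ∘ suc) g n + sum (f ∘ suc) n * g n

  -- Induction with f shifted: the row j = 0 completes the antidiagonals of the shifted product,
  -- while the rest of the new column l = n joins the excess.
  square : ∀ f g n → sum f n * sum g n ≡ sum (diag (λ j l → f j * g l)) n + excess f g n
  square f g zero    = refl
  square f g (suc n) = begin
    sum f (suc n) * sum g (suc n)
      ≡⟨ cong (_* sum g (suc n)) (sum-shift f n) ⟩
    (f 0 + sum f′ n) * (sum g n + g n)
      ≡⟨ solve 4 (λ a b c d → (a :+ b) :* (c :+ d) := a :* (c :+ d) :+ b :* c :+ b :* d) refl (f 0) (sum f′ n) (sum g n) (g n) ⟩
    f 0 * sum g (suc n) + sum f′ n * sum g n + sum f′ n * g n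
      ≡⟨ cong₂ (λ x y → x + y + sum f′ n * g n) (trans (sym (sum-* (f 0) g (suc n))) (sum-shift (λ l → f 0 * g l) n)) (square f′ g n) ⟩
    f 0 * g 0 + sum (λ l → f 0 * g (suc l)) n + (sum (diag H) n + excess f′ g n) + sum f′ n * g n
      ≡⟨ solve 5 (λ a b c d e → a :+ b :+ (c :+ d) :+ e := a :+ (b :+ c) :+ (d :+ e)) refl (f 0 * g 0) _ (sum (diag H) n) (excess f′ g n) _ ⟩
    f 0 * g 0 + (sum (λ l → f 0 * g (suc l)) n + sum (diag H) n) + excess f g (suc n)
      ≡⟨ cong (λ x → f 0 * g 0 + x + excess f g (suc n)) (sym (sum-+ _ (diag H) n)) ⟩
    f 0 * g 0 + sum (λ m → f 0 * g (suc m) + diag H m) n + excess f g (suc n)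
      ≡⟨ cong (_+ excess f g (suc n)) (sym (sum-shift (diag (λ j l → f j * g l)) n)) ⟩
    sum (diag (λ j l → f j * g l)) (suc n) + excess f g (suc n) ∎
    where
    open ≡-Reasoning
    f′ = f ∘ suc
    H = λ j l → f′ j * g l

  -- Shifting f divides K by 4, so the induction hypothesis contributes K L 2⁻ⁿ. The new column
  -- contributes at most another K L 2⁻ⁿ, and together they are 4 K L 2⁻⁽ⁿ⁺¹⁾. Decay of f like 2⁻ᵏ
  -- would only halve K and leave no room for the column.
  ∣excess∣≤ : ∀ f g K L → (∀ k → ∣ f k ∣ ≤ K * (half k * half k)) → (∀ k → ∣ g k ∣ ≤ L * (half k * half k)) →
    0ℚ ≤ K → 0ℚ ≤ L → ∀ n → ∣ excess f g n ∣ ≤ (K * L) * (nat 4 * half n)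
  ∣excess∣≤ f g K L f≤ g≤ 0≤K 0≤L zero = 0≤* (0≤* 0≤K 0≤L) (0≤* (0≤nat 4) 0≤1)
  ∣excess∣≤ f g K L f≤ g≤ 0≤K 0≤L (suc n) = let open ≤-Reasoning in begin
    ∣ excess (f ∘ suc) g n + sum (f ∘ suc) n * g n ∣
      ≤⟨ ∣p+q∣≤ (∣excess∣≤ (f ∘ suc) g (¼ * K) L f′≤ g≤ (0≤* 0≤¼ 0≤K) 0≤L n) (∣p*q∣≤ (∣sum∣≤2K (f ∘ suc) (½ * K) f′≤½K n) g≤L) ⟩
    (¼ * K * L) * (nat 4 * half n) + (½ * K + ½ * K) * (L * half n)
      ≡⟨ solve 3 (λ K L h → con ¼ :* K :* L :* (con (nat 4) :* h) :+ (con ½ :* K :+ con ½ :* K) :* (L :* h)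
                         := K :* L :* (con (nat 4) :* (con ½ :* h))) refl K L (half n) ⟩
    (K * L) * (nat 4 * half (suc n)) ∎
    where
    ¼ = ½ * ½
    0≤¼ = 0≤* 0≤½ 0≤½
    f′≤ : ∀ k → ∣ f (suc k) ∣ ≤ ¼ * K * (half k * half k)
    f′≤ k = ≤-trans (f≤ (suc k)) (≤-reflexive
      (solve 2 (λ K h → K :* (con ½ :* h :* (con ½ :* h)) := con ¼ :* K :* (h :* h)) refl K (half k)))
    -- The factor ¼ is weakened to ½ so that the two contributions add up exactly to the claimed
    -- bound.
    f′≤½K : ∀ k → ∣ f (suc k) ∣ ≤ ½ * K * half k
    f′≤½K k = ≤-trans (f′≤ k) (*-mono (0≤* (0≤half k) (0≤half k)) (0≤* 0≤½ 0≤K)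
      (≤-by {¼ * K} (¼ * K) (0≤* 0≤¼ 0≤K) (solve 1 (λ K → con ¼ :* K :+ con ¼ :* K := con ½ :* K) refl K))
      (half*half≤half k))
    g≤L : ∣ g n ∣ ≤ L * half n
    g≤L = ≤-trans (g≤ n) (*-monoˡ 0≤L (half*half≤half n))

  -- The ratio test with ratio ¼. Each initial term that violates it is handled by shifting: the
  -- constant of the shifted sequence is multiplied by 4, and the first term is added.
  majorant : ∀ N (f : ℕ → ℚ) → (∀ k → 0ℚ ≤ f k) → (∀ k → N ℕ.≤ k → f (suc k) ≤ ½ * ½ * f k) →
    ∃[ K ] (0ℚ ≤ K × (∀ k → f k ≤ K * (half k * half k)))
  majorant zero f 0≤f ratio = f 0 , 0≤f 0 , bound
    where
    bound : ∀ k → f k ≤ f 0 * (half k * half k)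
    bound zero    = ≤-reflexive (sym (*-identityʳ (f 0)))
    bound (suc k) = ≤-trans (ratio k ℕ.z≤n) (≤-trans (*-monoˡ (0≤* 0≤½ 0≤½) (bound k)) (≤-reflexive
      (solve 2 (λ K h → con ½ :* con ½ :* (K :* (h :* h)) := K :* (con ½ :* h :* (con ½ :* h))) refl (f 0) (half k))))
  majorant (suc N) f 0≤f ratio with majorant N (f ∘ suc) (0≤f ∘ suc) (λ k N≤k → ratio (suc k) (ℕ.s≤s N≤k))
  ... | K , 0≤K , bound = f 0 + nat 4 * K , 0≤+ (0≤f 0) 0≤4K , bound′
    where
    0≤4K = 0≤* (0≤nat 4) 0≤K
    bound′ : ∀ k → f k ≤ (f 0 + nat 4 * K) * (half k * half k)
    bound′ zero = ≤-by (nat 4 * K) 0≤4K (sym (*-identityʳ (f 0 + nat 4 * K)))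
    bound′ (suc k) = ≤-trans (bound k) (≤-by (f 0 * (half (suc k) * half (suc k)))
      (0≤* (0≤f 0) (0≤* {half (suc k)} {half (suc k)} (0≤half (suc k)) (0≤half (suc k))))
      (solve 3 (λ a K h → K :* (h :* h) :+ a :* (con ½ :* h :* (con ½ :* h))
                       := (a :+ con (nat 4) :* K) :* (con ½ :* h :* (con ½ :* h))) refl (f 0) K (half k)))

  -- The truncated series of sine and cosine

  -- qᵏ / k!
  T : ℕ → ℚ → ℚ
  T zero    q = 1ℚ
  T (suc k) q = q * T k q * recip k

  nat*T : ∀ k q → nat (suc k) * T (suc k) q ≡ q * T k q
  nat*T k q = begin
    nat (suc k) * (q * T k q * recip k)   ≡⟨ solve 3 (λ n t r → n :* (t :* r) := n :* r :* t) refl (nat (suc k)) (q * T k q) (recip k) ⟩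
    nat (suc k) * recip k * (q * T k q)   ≡⟨ cong (_* (q * T k q)) (nat*recip k) ⟩
    1ℚ * (q * T k q)                      ≡⟨ *-identityˡ (q * T k q) ⟩
    q * T k q                             ∎
    where open ≡-Reasoning

  0≤T : ∀ k {q} → 0ℚ ≤ q → 0ℚ ≤ T k q
  0≤T zero    0≤q = 0≤1
  0≤T (suc k) 0≤q = 0≤* (0≤* 0≤q (0≤T k 0≤q)) (0≤recip k)

  ∣T∣≤ : ∀ k {q B} → ∣ q ∣ ≤ B → ∣ T k q ∣ ≤ T k B
  ∣T∣≤ zero    q≤B = ≤-refl
  ∣T∣≤ (suc k) q≤B = ∣p*q∣≤ (∣p*q∣≤ q≤B (∣T∣≤ k q≤B)) (≤-reflexive (0≤p⇒∣p∣≡p (0≤recip k)))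

  -- Consecutive terms have ratio B/(k + 1), which is at most ¼ once k ≥ 4B.
  T-majorant : ∀ B → 0ℚ ≤ B → ∃[ K ] (0ℚ ≤ K × (∀ k → T k B ≤ K * (half k * half k)))
  T-majorant B 0≤B =
    let N , 4B≤N = archimedean (nat 4 * B) in
    majorant N (λ k → T k B) (λ k → 0≤T k 0≤B) λ k N≤k →
      *-cancelˡ-≤-pos (nat (suc k)) {{nat-positive k}} (let open ≤-Reasoning in begin
        nat (suc k) * T (suc k) B
          ≡⟨ nat*T k B ⟩
        B * T k B
          ≡⟨ solve 2 (λ b t → b :* t := con (nat 4) :* b :* (con ½ :* con ½ :* t)) refl B (T k B) ⟩
        nat 4 * B * (½ * ½ * T k B)
          ≤⟨ *-monoʳ (0≤* {½ * ½} (0≤* 0≤½ 0≤½) (0≤T k 0≤B)) (≤-trans 4B≤N (nat-mono (ℕ.m≤n⇒m≤1+n N≤k))) ⟩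
        nat (suc k) * (½ * ½ * T k B) ∎)

  -- The derivative of `T (suc k)` is `T k`, whence the Lipschitz constant. In the induction, B
  -- Bᵏ/k! is (k + 1) times the next term, so the two parts add up to k + 2 copies of it and cancel
  -- the division by k + 2.
  ∣T-T∣≤ : ∀ k {a b B} → ∣ a ∣ ≤ B → ∣ b ∣ ≤ B → ∣ T (suc k) a - T (suc k) b ∣ ≤ ∣ a - b ∣ * T k B
  ∣T-T∣≤ zero {a} {b} a≤B b≤B = ≤-reflexive (trans
    (cong ∣_∣ (solve 2 (λ a b → a :* con 1ℚ :* con (recip 0) :- b :* con 1ℚ :* con (recip 0) := a :- b) refl a b))
    (sym (*-identityʳ ∣ a - b ∣)))
  ∣T-T∣≤ (suc k) {a} {b} {B} a≤B b≤B = let open ≤-Reasoning in begin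
    ∣ a * T (suc k) a * r - b * T (suc k) b * r ∣
      ≡⟨ cong ∣_∣ (solve 5 (λ a b s t r → a :* s :* r :- b :* t :* r
                                       := ((a :- b) :* s :+ b :* (s :- t)) :* r)
           refl a b (T (suc k) a) (T (suc k) b) r) ⟩
    ∣ ((a - b) * T (suc k) a + b * (T (suc k) a - T (suc k) b)) * r ∣
      ≤⟨ ∣p*q∣≤ (∣p+q∣≤ (∣p*q∣≤ (≤-refl {∣ a - b ∣}) (∣T∣≤ (suc k) a≤B)) (∣p*q∣≤ b≤B (∣T-T∣≤ k a≤B b≤B)))
                (≤-reflexive (0≤p⇒∣p∣≡p (0≤recip (suc k)))) ⟩
    (d * T (suc k) B + B * (d * T k B)) * r
      ≡⟨ cong (λ x → x * r) (solve 4 (λ d t B s → d :* t :+ B :* (d :* s) := d :* (t :+ B :* s)) refl d (T (suc k) B) B (T k B)) ⟩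
    d * (T (suc k) B + B * T k B) * r
      ≡⟨ cong (λ x → d * (T (suc k) B + x) * r) (sym (nat*T k B)) ⟩
    d * (T (suc k) B + nat (suc k) * T (suc k) B) * r
      ≡⟨ solve 4 (λ d t n r → d :* (t :+ n :* t) :* r := d :* t :* ((con 1ℚ :+ n) :* r)) refl d (T (suc k) B) (nat (suc k)) r ⟩
    d * T (suc k) B * (nat (suc (suc k)) * r)
      ≡⟨ cong (d * T (suc k) B *_) (nat*recip (suc k)) ⟩
    d * T (suc k) B * 1ℚ
      ≡⟨ *-identityʳ (d * T (suc k) B) ⟩
    d * T (suc k) B ∎
    where
    r = recip (suc k)
    d = ∣ a - b ∣

  -- Every further factor q/(k + 2) is at most ½. One factor q is kept, so that the tail in
  -- `sin-small` can be compared with the leading term q.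
  T≤q*half : ∀ k {q} → 0ℚ ≤ q → q ≤ 1ℚ → T (suc k) q ≤ q * half k
  T≤q*half zero {q} 0≤q q≤1 = ≤-reflexive (solve 1 (λ q → q :* con 1ℚ :* con (recip 0) := q :* con 1ℚ) refl q)
  T≤q*half (suc k) {q} 0≤q q≤1 = let open ≤-Reasoning in begin
    q * T (suc k) q * recip (suc k)
      ≤⟨ *-mono (0≤recip (suc k)) (0≤* {1ℚ} 0≤1 0≤qh) (*-mono (0≤T (suc k) 0≤q) 0≤1 q≤1 (T≤q*half k 0≤q q≤1)) (recip≤½ k) ⟩
    1ℚ * (q * half k) * ½
      ≡⟨ solve 2 (λ q h → con 1ℚ :* (q :* h) :* con ½ := q :* (con ½ :* h)) refl q (half k) ⟩
    q * half (suc k) ∎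
    where
    0≤qh = 0≤* {q} {half k} 0≤q (0≤half k)

  -- Weighting the antidiagonal sum by j + l and treating the two parts by
  -- shifting j and l respectively gives the recurrence of the right side.
  binomial : ∀ n a b → diag (λ j l → T j a * T l b) n ≡ T n (a + b)
  binomial zero    a b = refl
  binomial (suc n) a b = begin
    h
      ≡⟨ sym (*-identityʳ h) ⟩
    h * 1ℚ
      ≡⟨ cong (h *_) (sym (nat*recip n)) ⟩
    h * (nat (suc n) * recip n)
      ≡⟨ solve 3 (λ h n r → h :* (n :* r) := n :* h :* r) refl h (nat (suc n)) (recip n) ⟩
    nat (suc n) * h * recip n
      ≡⟨ cong (_* recip n) (sym (diag-weight nat F (suc n))) ⟩
    diag (λ j l → nat (j ℕ.+ l) * F j l) (suc n) * recip n
      ≡⟨ cong (_* recip n) (trans (diag-cong (λ j l → trans (cong (_* F j l) (nat-+ j l))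
           (*-distribʳ-+ (F j l) (nat j) (nat l))) (suc n)) (diag-+ J L (suc n))) ⟩
    (diag J (suc n) + diag L (suc n)) * recip n
      ≡⟨ cong₂ (λ x y → (x + y) * recip n) J-sum L-sum ⟩
    (a * diag F n + b * diag F n) * recip n
      ≡⟨ cong (_* recip n) (sym (*-distribʳ-+ (diag F n) a b)) ⟩
    (a + b) * diag F n * recip n
      ≡⟨ cong (λ x → (a + b) * x * recip n) (binomial n a b) ⟩
    (a + b) * T n (a + b) * recip n ∎
    where
    open ≡-Reasoning
    F J L : ℕ → ℕ → ℚ
    F j l = T j a * T l b
    J j l = nat j * F j l
    L j l = nat l * F j l
    h = diag F (suc n)
    J-sum : diag J (suc n) ≡ a * diag F n
    J-sum = begin
      0ℚ * F 0 (suc n) + diag (J ∘ suc) n  ≡⟨ cong (_+ diag (J ∘ suc) n) (*-zeroˡ (F 0 (suc n))) ⟩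
      0ℚ + diag (J ∘ suc) n                ≡⟨ +-identityˡ (diag (J ∘ suc) n) ⟩
      diag (J ∘ suc) n
        ≡⟨ diag-cong (λ j l → trans (sym (*-assoc (nat (suc j)) (T (suc j) a) (T l b)))
             (trans (cong (_* T l b) (nat*T j a)) (*-assoc a (T j a) (T l b)))) n ⟩
      diag (λ j l → a * F j l) n           ≡⟨ diag-* a F n ⟩
      a * diag F n                         ∎
    L-sum : diag L (suc n) ≡ b * diag F n
    L-sum = begin
      diag L (suc n)                               ≡⟨ diag-last L n ⟩
      diag (λ j l → L j (suc l)) n + 0ℚ * F (suc n) 0
        ≡⟨ cong (diag (λ j l → L j (suc l)) n +_) (*-zeroˡ (F (suc n) 0)) ⟩
      diag (λ j l → L j (suc l)) n + 0ℚ            ≡⟨ +-identityʳ _ ⟩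
      diag (λ j l → L j (suc l)) n
        ≡⟨ diag-cong (λ j l → trans
             (solve 3 (λ n s t → n :* (s :* t) := s :* (n :* t)) refl (nat (suc l)) (T j a) (T (suc l) b))
             (trans (cong (T j a *_) (nat*T l b))
               (solve 3 (λ s b t → s :* (b :* t) := b :* (s :* t)) refl (T j a) b (T l b)))) n ⟩
      diag (λ j l → b * F j l) n                   ≡⟨ diag-* b F n ⟩
      b * diag F n                                 ∎

  -- iᵏ = c k + i s k
  c s : ℕ → ℚ
  c zero    = 1ℚ
  c (suc k) = - s k
  s zero    = 0ℚ
  s (suc k) = c k

  ∣c∣≤1 : ∀ k → ∣ c k ∣ ≤ 1ℚ
  ∣s∣≤1 : ∀ k → ∣ s k ∣ ≤ 1ℚ
  ∣c∣≤1 zero    = ≤-refl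
  ∣c∣≤1 (suc k) = ≤-trans (≤-reflexive (∣-p∣≡∣p∣ (s k))) (∣s∣≤1 k)
  ∣s∣≤1 zero    = 0≤1
  ∣s∣≤1 (suc k) = ∣c∣≤1 k

  -- Real and imaginary parts of iʲ⁺ˡ = iʲ iˡ.
  c-+ : ∀ j l → c (j ℕ.+ l) ≡ c j * c l - s j * s l
  s-+ : ∀ j l → s (j ℕ.+ l) ≡ s j * c l + c j * s l
  c-+ zero    l = solve 2 (λ x y → x := con 1ℚ :* x :- con 0ℚ :* y) refl (c l) (s l)
  c-+ (suc j) l = trans (cong -_ (s-+ j l))
    (solve 4 (λ cj sj cl sl → :- (sj :* cl :+ cj :* sl) := (:- sj) :* cl :- cj :* sl) refl (c j) (s j) (c l) (s l))
  s-+ zero    l = solve 2 (λ x y → y := con 0ℚ :* x :+ con 1ℚ :* y) refl (c l) (s l)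
  s-+ (suc j) l = trans (c-+ j l)
    (solve 4 (λ cj sj cl sl → cj :* cl :- sj :* sl := cj :* cl :+ (:- sj) :* sl) refl (c j) (s j) (c l) (s l))

  -- Only even powers carry a nonzero `c` and only odd ones a nonzero `s`. The mutual induction
  -- replaces a case distinction on parity.
  c*T-neg : ∀ k q → c k * T k (- q) ≡ c k * T k q
  s*T-neg : ∀ k q → s k * T k (- q) ≡ - (s k * T k q)
  c*T-neg zero    q = refl
  c*T-neg (suc k) q = begin
    - s k * (- q * T k (- q) * recip k)
      ≡⟨ solve 4 (λ s q t r → (:- s) :* ((:- q) :* t :* r) := s :* t :* (q :* r)) refl (s k) q (T k (- q)) (recip k) ⟩
    s k * T k (- q) * (q * recip k)
      ≡⟨ cong (_* (q * recip k)) (s*T-neg k q) ⟩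
    - (s k * T k q) * (q * recip k)
      ≡⟨ solve 4 (λ s q t r → (:- (s :* t)) :* (q :* r) := (:- s) :* (q :* t :* r)) refl (s k) q (T k q) (recip k) ⟩
    - s k * (q * T k q * recip k) ∎
    where open ≡-Reasoning
  s*T-neg zero    q = refl
  s*T-neg (suc k) q = begin
    c k * (- q * T k (- q) * recip k)
      ≡⟨ solve 4 (λ s q t r → s :* ((:- q) :* t :* r) := s :* t :* (:- (q :* r))) refl (c k) q (T k (- q)) (recip k) ⟩
    c k * T k (- q) * - (q * recip k)
      ≡⟨ cong (_* - (q * recip k)) (c*T-neg k q) ⟩
    c k * T k q * - (q * recip k)
      ≡⟨ solve 4 (λ s q t r → s :* t :* (:- (q :* r)) := :- (s :* (q :* t :* r))) refl (c k) q (T k q) (recip k) ⟩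
    - (c k * (q * T k q * recip k)) ∎
    where open ≡-Reasoning

  -- The weights `c` and `s` give cosine and sine with their vanishing terms kept, so that both are
  -- indexed by the exponent and can be multiplied along common antidiagonals.
  wsum : (ℕ → ℚ) → ℚ → ℕ → ℚ
  wsum w q = sum (λ k → w k * T k q)

  Bounded : (ℕ → ℚ) → Set
  Bounded w = ∀ k → ∣ w k ∣ ≤ 1ℚ

  ∣w*p∣≤ : ∀ {w} → Bounded w → ∀ k {p q} → ∣ p ∣ ≤ q → ∣ w k * p ∣ ≤ q
  ∣w*p∣≤ w≤1 k {p} {q} p≤q = ≤-trans (∣p*q∣≤ (w≤1 k) p≤q) (≤-reflexive (*-identityˡ q))

  -- Estimates for the truncated series, uniform for arguments in [-B, B]

  module _ (B K : ℚ) (T≤ : ∀ k → T k B ≤ K * (half k * half k)) (0≤K : 0ℚ ≤ K) where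

    ∣wT∣≤ : ∀ {w} → Bounded w → ∀ {q} → ∣ q ∣ ≤ B → ∀ k → ∣ w k * T k q ∣ ≤ K * (half k * half k)
    ∣wT∣≤ {w} w≤1 q≤B k = ∣w*p∣≤ {w} w≤1 k (≤-trans (∣T∣≤ k q≤B) (T≤ k))

    ∣wT∣≤half : ∀ {w} → Bounded w → ∀ {q} → ∣ q ∣ ≤ B → ∀ k → ∣ w k * T k q ∣ ≤ K * half k
    ∣wT∣≤half {w} w≤1 q≤B k = ≤-trans (∣wT∣≤ {w} w≤1 q≤B k) (*-monoˡ 0≤K (half*half≤half k))

    ∣wsum-diff∣≤ : ∀ {w} → Bounded w → ∀ {q} → ∣ q ∣ ≤ B → ∀ N {m n} → N ℕ.≤ m → N ℕ.≤ n →
      ∣ wsum w q m - wsum w q n ∣ ≤ (K + K + (K + K)) * half N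
    ∣wsum-diff∣≤ {w} w≤1 {q} q≤B N {m} {n} N≤m N≤n = let open ≤-Reasoning in begin
      ∣ W m - W n ∣
        ≡⟨ cong ∣_∣ (solve 3 (λ x y z → x :- y := (x :- z) :+ (z :- y)) refl (W m) (W n) (W N)) ⟩
      ∣ (W m - W N) + (W N - W n) ∣
        ≤⟨ ∣p+q∣≤ (tail m N≤m) (≤-trans (≤-reflexive (∣p-q∣≡∣q-p∣ (W N) (W n))) (tail n N≤n)) ⟩
      (K + K) * half N + (K + K) * half N
        ≡⟨ sym (*-distribʳ-+ (half N) (K + K) (K + K)) ⟩
      (K + K + (K + K)) * half N ∎
      where
      W = wsum w q
      tail : ∀ m → N ℕ.≤ m → ∣ W m - W N ∣ ≤ (K + K) * half N
      tail m = ∣sum-diff∣≤ (λ k → w k * T k q) K (∣wT∣≤half {w} w≤1 q≤B) N m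

    -- The constant terms cancel and the Lipschitz constants of the others sum to at most 2K. The
    -- bound does not depend on the number of terms, as is needed when length and argument vary
    -- together.
    ∣wsum-lip∣≤ : ∀ {w} → Bounded w → ∀ {a b} → ∣ a ∣ ≤ B → ∣ b ∣ ≤ B → ∀ n →
      ∣ wsum w a n - wsum w b n ∣ ≤ ∣ a - b ∣ * (K + K)
    ∣wsum-lip∣≤ {w} w≤1 {a} {b} a≤B b≤B zero = 0≤* (0≤∣p∣ (a - b)) (0≤+ 0≤K 0≤K)
    ∣wsum-lip∣≤ {w} w≤1 {a} {b} a≤B b≤B (suc n) = let open ≤-Reasoning in begin
      ∣ wsum w a (suc n) - wsum w b (suc n) ∣
        ≡⟨ cong ∣_∣ (cong₂ _-_ (sum-shift f n) (sum-shift g n)) ⟩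
      ∣ (f 0 + sum (f ∘ suc) n) - (f 0 + sum (g ∘ suc) n) ∣
        ≡⟨ cong ∣_∣ (solve 3 (λ x y z → (x :+ y) :- (x :+ z) := y :+ (:- z)) refl (f 0) (sum (f ∘ suc) n) (sum (g ∘ suc) n)) ⟩
      ∣ sum (f ∘ suc) n + - sum (g ∘ suc) n ∣
        ≡⟨ cong (λ x → ∣ sum (f ∘ suc) n + x ∣) (sym (sum-neg (g ∘ suc) n)) ⟩
      ∣ sum (f ∘ suc) n + sum (λ k → - g (suc k)) n ∣
        ≡⟨ cong ∣_∣ (sym (sum-+ (f ∘ suc) (λ k → - g (suc k)) n)) ⟩
      ∣ sum (λ k → f (suc k) + - g (suc k)) n ∣
        ≤⟨ ∣sum∣≤ bound n ⟩
      sum (λ k → ∣ a - b ∣ * T k B) n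
        ≡⟨ sum-* ∣ a - b ∣ (λ k → T k B) n ⟩
      ∣ a - b ∣ * sum (λ k → T k B) n
        ≤⟨ *-monoˡ (0≤∣p∣ (a - b)) (≤-trans (p≤∣p∣ (sum (λ k → T k B) n))
             (∣sum∣≤2K (λ k → T k B) K T≤half n)) ⟩
      ∣ a - b ∣ * (K + K) ∎
      where
      f g : ℕ → ℚ
      f k = w k * T k a
      g k = w k * T k b
      bound : ∀ k → ∣ f (suc k) + - g (suc k) ∣ ≤ ∣ a - b ∣ * T k B
      bound k = subst (λ x → ∣ x ∣ ≤ ∣ a - b ∣ * T k B)
        (solve 3 (λ w x y → w :* (x :- y) := w :* x :+ (:- (w :* y))) refl (w (suc k)) (T (suc k) a) (T (suc k) b))
        (∣w*p∣≤ {w} w≤1 (suc k) {T (suc k) a - T (suc k) b} {∣ a - b ∣ * T k B} (∣T-T∣≤ k a≤B b≤B))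
      T≤half : ∀ k → ∣ T k B ∣ ≤ K * half k
      T≤half k = ≤-trans (≤-reflexive (0≤p⇒∣p∣≡p (0≤T k (≤-trans (0≤∣p∣ a) a≤B))))
        (≤-trans (T≤ k) (*-monoˡ 0≤K (half*half≤half k)))

    addition-error : ℚ
    addition-error = (K * K) * nat 4 + (K * K) * nat 4

    -- The triangular parts of the two products combine exactly, by `c-+` and `binomial`, to the
    -- truncated series at a + b. Only the two excesses remain.
    ∣cos-+∣≤ : ∀ a b → ∣ a ∣ ≤ B → ∣ b ∣ ≤ B → ∀ n →
      ∣ (wsum c a n * wsum c b n - wsum s a n * wsum s b n) - wsum c (a + b) n ∣ ≤ addition-error * half n
    ∣cos-+∣≤ a b a≤B b≤B n = let open ≤-Reasoning in begin
      ∣ (wsum c a n * wsum c b n - wsum s a n * wsum s b n) - wsum c (a + b) n ∣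
        ≡⟨ cong (λ x → ∣ x - wsum c (a + b) n ∣) (cong₂ _-_ (square ca cb n) (square sa sb n)) ⟩
      ∣ ((sum CC n + ec) - (sum SS n + es)) - wsum c (a + b) n ∣
        ≡⟨ cong ∣_∣ (solve 5 (λ C ec S es W → ((C :+ ec) :- (S :+ es)) :- W := ((C :+ (:- S)) :- W) :+ (ec :+ (:- es))) refl (sum CC n) ec (sum SS n) es (wsum c (a + b) n)) ⟩
      ∣ ((sum CC n + - sum SS n) - wsum c (a + b) n) + (ec + - es) ∣
        ≡⟨ cong (λ x → ∣ (x - wsum c (a + b) n) + (ec + - es) ∣)
             (trans (cong (sum CC n +_) (sym (sum-neg SS n))) (trans (sym (sum-+ CC (λ m → - SS m) n)) (sum-cong triangle n))) ⟩
      ∣ (wsum c (a + b) n - wsum c (a + b) n) + (ec + - es) ∣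
        ≡⟨ cong ∣_∣ (solve 2 (λ x y → (x :- x) :+ y := y) refl (wsum c (a + b) n) (ec + - es)) ⟩
      ∣ ec + - es ∣
        ≤⟨ ∣p+q∣≤ {ec} { - es} (∣excess∣≤ ca cb K K (∣wT∣≤ {c} ∣c∣≤1 a≤B) (∣wT∣≤ {c} ∣c∣≤1 b≤B) 0≤K 0≤K n)
                 (≤-trans (≤-reflexive (∣-p∣≡∣p∣ es)) (∣excess∣≤ sa sb K K (∣wT∣≤ {s} ∣s∣≤1 a≤B) (∣wT∣≤ {s} ∣s∣≤1 b≤B) 0≤K 0≤K n)) ⟩
      (K * K) * (nat 4 * half n) + (K * K) * (nat 4 * half n)
        ≡⟨ solve 2 (λ K h → K :* (con (nat 4) :* h) :+ K :* (con (nat 4) :* h) := (K :* con (nat 4) :+ K :* con (nat 4)) :* h) refl (K * K) (half n) ⟩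
      addition-error * half n ∎
      where
      ca cb sa sb : ℕ → ℚ
      ca k = c k * T k a
      cb k = c k * T k b
      sa k = s k * T k a
      sb k = s k * T k b
      CC SS : ℕ → ℚ
      CC = diag (λ j l → ca j * cb l)
      SS = diag (λ j l → sa j * sb l)
      ec = excess ca cb n
      es = excess sa sb n
      triangle : ∀ m → CC m + - SS m ≡ c m * T m (a + b)
      triangle m = trans (cong (CC m +_) (trans (solve 1 (λ x → :- x := con (- 1ℚ) :* x) refl (SS m)) (sym (diag-* (- 1ℚ) (λ j l → sa j * sb l) m))))
        (trans (sym (diag-+ (λ j l → ca j * cb l) (λ j l → - 1ℚ * (sa j * sb l)) m))
        (trans (diag-cong (λ j l → trans
          (solve 6 (λ cj cl sj sl x y → cj :* x :* (cl :* y) :+ con (- 1ℚ) :* (sj :* x :* (sl :* y)) := (cj :* cl :- sj :* sl) :* (x :* y))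
            refl (c j) (c l) (s j) (s l) (T j a) (T l b))
          (cong (_* (T j a * T l b)) (sym (c-+ j l)))) m)
        (trans (diag-weight c (λ j l → T j a * T l b) m) (cong (c m *_) (binomial m a b)))))

    ∣sin-+∣≤ : ∀ a b → ∣ a ∣ ≤ B → ∣ b ∣ ≤ B → ∀ n →
      ∣ (wsum s a n * wsum c b n + wsum c a n * wsum s b n) - wsum s (a + b) n ∣ ≤ addition-error * half n
    ∣sin-+∣≤ a b a≤B b≤B n = let open ≤-Reasoning in begin
      ∣ (wsum s a n * wsum c b n + wsum c a n * wsum s b n) - wsum s (a + b) n ∣
        ≡⟨ cong (λ x → ∣ x - wsum s (a + b) n ∣) (cong₂ _+_ (square sa cb n) (square ca sb n)) ⟩
      ∣ ((sum SC n + ec) + (sum CS n + es)) - wsum s (a + b) n ∣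
        ≡⟨ cong ∣_∣ (solve 5 (λ C ec S es W → ((C :+ ec) :+ (S :+ es)) :- W := ((C :+ S) :- W) :+ (ec :+ es)) refl (sum SC n) ec (sum CS n) es (wsum s (a + b) n)) ⟩
      ∣ ((sum SC n + sum CS n) - wsum s (a + b) n) + (ec + es) ∣
        ≡⟨ cong (λ x → ∣ (x - wsum s (a + b) n) + (ec + es) ∣)
             (trans (sym (sum-+ SC CS n)) (sum-cong triangle n)) ⟩
      ∣ (wsum s (a + b) n - wsum s (a + b) n) + (ec + es) ∣
        ≡⟨ cong ∣_∣ (solve 2 (λ x y → (x :- x) :+ y := y) refl (wsum s (a + b) n) (ec + es)) ⟩
      ∣ ec + es ∣
        ≤⟨ ∣p+q∣≤ {ec} {es} (∣excess∣≤ sa cb K K (∣wT∣≤ {s} ∣s∣≤1 a≤B) (∣wT∣≤ {c} ∣c∣≤1 b≤B) 0≤K 0≤K n)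
                 (∣excess∣≤ ca sb K K (∣wT∣≤ {c} ∣c∣≤1 a≤B) (∣wT∣≤ {s} ∣s∣≤1 b≤B) 0≤K 0≤K n) ⟩
      (K * K) * (nat 4 * half n) + (K * K) * (nat 4 * half n)
        ≡⟨ solve 2 (λ K h → K :* (con (nat 4) :* h) :+ K :* (con (nat 4) :* h) := (K :* con (nat 4) :+ K :* con (nat 4)) :* h) refl (K * K) (half n) ⟩
      addition-error * half n ∎
      where
      ca cb sa sb : ℕ → ℚ
      ca k = c k * T k a
      cb k = c k * T k b
      sa k = s k * T k a
      sb k = s k * T k b
      SC CS : ℕ → ℚ
      SC = diag (λ j l → sa j * cb l)
      CS = diag (λ j l → ca j * sb l)
      ec = excess sa cb n
      es = excess ca sb n
      triangle : ∀ m → SC m + CS m ≡ s m * T m (a + b)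
      triangle m =
        trans (sym (diag-+ (λ j l → sa j * cb l) (λ j l → ca j * sb l) m))
        (trans (diag-cong (λ j l → trans
          (solve 6 (λ cj cl sj sl x y → sj :* x :* (cl :* y) :+ cj :* x :* (sl :* y) := (sj :* cl :+ cj :* sl) :* (x :* y))
            refl (c j) (c l) (s j) (s l) (T j a) (T l b))
          (cong (_* (T j a * T l b)) (sym (s-+ j l)))) m)
        (trans (diag-weight s (λ j l → T j a * T l b) m) (cong (s m *_) (binomial m a b))))

  wsum-c-neg : ∀ q n → wsum c (- q) n ≡ wsum c q n
  wsum-c-neg q = sum-cong (λ k → c*T-neg k q)

  wsum-s-neg : ∀ q n → wsum s (- q) n ≡ - wsum s q n
  wsum-s-neg q n = trans (sum-cong (λ k → s*T-neg k q) n) (sum-neg (λ k → s k * T k q) n)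

  -- The terms of degree 0 and 2 vanish and that of degree 1 is q. From degree 3 on the terms are at
  -- most (q/4) 2⁻ᵏ, so the tail is at most q/2.
  sin-small : ∀ q → 0ℚ ≤ q → q ≤ 1ℚ → ∀ n → ½ * q ≤ wsum s q (3 ℕ.+ n)
  sin-small q 0≤q q≤1 n = let open ≤-Reasoning in begin
    ½ * q
      ≡⟨ solve 1 (λ q → con ½ :* q := con 0ℚ :* con 1ℚ :+ (con 1ℚ :* (q :* con 1ℚ :* con (recip 0)) :- con ½ :* q)) refl q ⟩
    f 0 + (f 1 - ½ * q)
      ≤⟨ +-monoʳ-≤ (f 0) (+-monoʳ-≤ (f 1) (≤-trans (neg-antimono-≤ {x = - sum h n} {½ * q} (≤-trans (-p≤∣p∣ (sum h n)) bound))
           (≤-reflexive (solve 3 (λ x q t → :- (:- x) := con (s 2) :* (q :* t :* con (recip 1)) :+ x) refl (sum h n) q (T 1 q))))) ⟩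
    f 0 + (f 1 + (f 2 + sum h n))
      ≡⟨ sym (trans (sum-shift f (suc (suc n))) (cong (f 0 +_)
           (trans (sum-shift (f ∘ suc) (suc n)) (cong (f 1 +_) (sum-shift (λ k → f (2 ℕ.+ k)) n))))) ⟩
    sum f (3 ℕ.+ n) ∎
    where
    f h : ℕ → ℚ
    f k = s k * T k q
    h k = f (3 ℕ.+ k)
    h≤ : ∀ k → ∣ h k ∣ ≤ q * (½ * ½) * half k
    h≤ k = ∣w*p∣≤ {s} ∣s∣≤1 (3 ℕ.+ k) (≤-trans (≤-reflexive (0≤p⇒∣p∣≡p (0≤T (3 ℕ.+ k) 0≤q)))
      (≤-trans (T≤q*half (2 ℕ.+ k) 0≤q q≤1) (≤-reflexive
        (solve 2 (λ q h → q :* (con ½ :* (con ½ :* h)) := q :* con (½ * ½) :* h) refl q (half k)))))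
    bound : ∣ sum h n ∣ ≤ ½ * q
    bound = ≤-trans (∣sum∣≤2K h (q * (½ * ½)) h≤ n)
      (≤-reflexive (solve 1 (λ q → q :* con (½ * ½) :+ q :* con (½ * ½) := con ½ :* q) refl q))

  -- After the leading 1 and the vanishing linear term, the terms are at most (q/2) 2⁻ᵏ, so the tail
  -- is at most q ≤ 1.
  cos-small : ∀ q → 0ℚ ≤ q → q ≤ 1ℚ → ∀ n → 0ℚ ≤ wsum c q (2 ℕ.+ n)
  cos-small q 0≤q q≤1 n = let open ≤-Reasoning in begin
    0ℚ
      ≤⟨ 0≤q-p q≤1 ⟩
    1ℚ - q
      ≤⟨ +-monoʳ-≤ 1ℚ (≤-trans (neg-antimono-≤ {x = - sum h n} {q} (≤-trans (-p≤∣p∣ (sum h n)) bound))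
           (≤-reflexive (solve 2 (λ x q → :- (:- x) := con (c 1) :* (q :* con 1ℚ :* con (recip 0)) :+ x) refl (sum h n) q))) ⟩
    f 0 + (f 1 + sum h n)
      ≡⟨ sym (trans (sum-shift f (suc n)) (cong (f 0 +_) (sum-shift (f ∘ suc) n))) ⟩
    sum f (2 ℕ.+ n) ∎
    where
    f h : ℕ → ℚ
    f k = c k * T k q
    h k = f (2 ℕ.+ k)
    h≤ : ∀ k → ∣ h k ∣ ≤ q * ½ * half k
    h≤ k = ∣w*p∣≤ {c} ∣c∣≤1 (2 ℕ.+ k) (≤-trans (≤-reflexive (0≤p⇒∣p∣≡p (0≤T (2 ℕ.+ k) 0≤q)))
      (≤-trans (T≤q*half (1 ℕ.+ k) 0≤q q≤1) (≤-reflexive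
        (solve 2 (λ q h → q :* (con ½ :* h) := q :* con ½ :* h) refl q (half k)))))
    bound : ∣ sum h n ∣ ≤ q
    bound = ≤-trans (∣sum∣≤2K h (q * ½) h≤ n)
      (≤-reflexive (solve 1 (λ q → q :* con ½ :+ q :* con ½ := q) refl q))

open RationalSeries
open import Defs hiding (_+_; _*_; -_; _-_; _^_)
import Defs as D

private module QS = ℚ.+-*-Solver
open QS using (_:+_; _:*_; _:-_; :-_; _:=_; con)

-- The ring of real numbers

Eventually : (ℕ → Set) → Set
Eventually P = ∃[ N ] (∀ i → N ℕ.≤ i → P i)

always : ∀ {P : ℕ → Set} → (∀ i → P i) → Eventually P
always p = 0 , λ i _ → p i

ev-map : ∀ {P Q : ℕ → Set} → (∀ i → P i → Q i) → Eventually P → Eventually Q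
ev-map f (N , p) = N , λ i N≤i → f i (p i N≤i)

ev-zip : ∀ {P Q R : ℕ → Set} → (∀ i → P i → Q i → R i) → Eventually P → Eventually Q → Eventually R
ev-zip f (M , p) (N , q) = M ⊔ N , λ i M⊔N≤i →
  f i (p i (ℕ.m⊔n≤o⇒m≤o M N M⊔N≤i)) (q i (ℕ.m⊔n≤o⇒n≤o M N M⊔N≤i))

ev-witness : ∀ {P : ℕ → Set} → Eventually P → ∃[ i ] P i
ev-witness (N , p) = N , p N ℕ.≤-refl

-- A record around _≈_, from which Agda can infer x and y.
infix 4 _≃_
record _≃_ (x y : ℝ) : Set where
  constructor mk
  field un : x ≈ y

open _≃_ public


pointwise : ∀ {x y} → (∀ i → seq x i ≡ seq y i) → x ≃ y
pointwise {x} {y} eq = mk λ ε 0<ε → always λ i →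
  subst (λ d → ∣ d ∣ ℚ.≤ ε) (sym (trans (cong (ℚ._- seq y i) (eq i)) (ℚ.+-inverseʳ (seq y i)))) (ℚ.<⇒≤ 0<ε)

≃-refl : ∀ {x} → x ≃ x
≃-refl = pointwise λ _ → refl

≃-sym : ∀ {x y} → x ≃ y → y ≃ x
≃-sym {x} {y} (mk x≈y) = mk λ ε 0<ε → ev-map
  (λ i → subst (ℚ._≤ ε) (∣p-q∣≡∣q-p∣ (seq x i) (seq y i))) (x≈y ε 0<ε)

-- Lets estimates be proved up to a constant factor. Since a may be 0, δ is chosen with (a + 1) δ =
-- ε.
≃-by : ∀ {x y} a → 0ℚ ℚ.≤ a →
  (∀ δ → 0ℚ ℚ.< δ → Eventually (λ i → ∣ seq x i ℚ.- seq y i ∣ ℚ.≤ a ℚ.* δ)) → x ≃ y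
≃-by a 0≤a close = mk λ ε 0<ε →
  let δ , 0<δ , eq = split ε a 1ℚ 0<ε (ℚ.+-mono-≤-< 0≤a (ℚ.positive⁻¹ 1ℚ))
  in ev-map (λ i d≤ → ℚ.≤-trans d≤ (≤-by (1ℚ ℚ.* δ) (0≤* 0≤1 (ℚ.<⇒≤ 0<δ)) eq)) (close δ 0<δ)

2ℚ : ℚ
2ℚ = nat 2

≃-trans : ∀ {x y z} → x ≃ y → y ≃ z → x ≃ z
≃-trans {x} {y} {z} (mk x≈y) (mk y≈z) = ≃-by 2ℚ (0≤nat 2) λ δ 0<δ →
  ev-zip (λ i p q → ℚ.≤-trans (ℚ.≤-reflexive (cong ∣_∣
      (QS.solve 3 (λ a b c → a :- c := (a :- b) :+ (b :- c)) refl (seq x i) (seq y i) (seq z i))))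
    (ℚ.≤-trans (∣p+q∣≤ {p = seq x i ℚ.- seq y i} {seq y i ℚ.- seq z i} p q)
      (ℚ.≤-reflexive (QS.solve 1 (λ d → d :+ d := con 2ℚ :* d) refl δ))))
    (x≈y δ 0<δ) (y≈z δ 0<δ)

private module Concrete where
  open D using (_+_; _*_; -_; _-_)

  +-cong : ∀ {x x′ y y′} → x ≃ x′ → y ≃ y′ → x + y ≃ x′ + y′
  +-cong {x} {x′} {y} {y′} (mk p) (mk q) = ≃-by 2ℚ (0≤nat 2) λ δ 0<δ →
    ev-zip (λ i p q → ℚ.≤-trans (ℚ.≤-reflexive (cong ∣_∣
        (QS.solve 4 (λ a a′ b b′ → (a :+ b) :- (a′ :+ b′) := (a :- a′) :+ (b :- b′)) refl (seq x i) (seq x′ i) (seq y i) (seq y′ i))))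
      (ℚ.≤-trans (∣p+q∣≤ {p = seq x i ℚ.- seq x′ i} {seq y i ℚ.- seq y′ i} p q)
        (ℚ.≤-reflexive (QS.solve 1 (λ d → d :+ d := con 2ℚ :* d) refl δ))))
      (p δ 0<δ) (q δ 0<δ)

  -‿cong : ∀ {x y} → x ≃ y → - x ≃ - y
  -‿cong {x} {y} (mk p) = mk λ ε 0<ε → ev-map (λ i → subst (ℚ._≤ ε) (trans (∣p-q∣≡∣q-p∣ (seq x i) (seq y i))
    (cong ∣_∣ (QS.solve 2 (λ a b → b :- a := (:- a) :- (:- b)) refl (seq x i) (seq y i))))) (p ε 0<ε)

  *-cong : ∀ {x x′ y y′} → x ≃ x′ → y ≃ y′ → x * y ≃ x′ * y′
  *-cong {x} {x′} {y} {y′} (mk p) (mk q) =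
    let A , 0<A , x≤A  = eventuallyBounded (seq x) (cauchy x)
        B , 0<B , y′≤B = eventuallyBounded (seq y′) (cauchy y′)
    in ≃-by (A ℚ.+ B) (0≤+ (ℚ.<⇒≤ 0<A) (ℚ.<⇒≤ 0<B)) λ δ 0<δ →
    ev-zip (λ i (a , b) (p , q) → ℚ.≤-trans (ℚ.≤-reflexive (cong ∣_∣
        (QS.solve 4 (λ a a′ b b′ → a :* b :- a′ :* b′ := a :* (b :- b′) :+ b′ :* (a :- a′)) refl (seq x i) (seq x′ i) (seq y i) (seq y′ i))))
      (ℚ.≤-trans (∣p+q∣≤ {p = seq x i ℚ.* (seq y i ℚ.- seq y′ i)} {seq y′ i ℚ.* (seq x i ℚ.- seq x′ i)}
                   (∣p*q∣≤ {p = seq x i} {seq y i ℚ.- seq y′ i} a q) (∣p*q∣≤ {p = seq y′ i} {seq x i ℚ.- seq x′ i} b p))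
        (ℚ.≤-reflexive (sym (ℚ.*-distribʳ-+ δ A B)))))
      (ev-zip (λ i → _,_) x≤A y′≤B) (ev-zip (λ i → _,_) (p δ 0<δ) (q δ 0<δ))

infix  8 -_
infixl 7 _*_
infixl 6 _+_ _-_

-- Opaque copies of the operations: unfolding the originals, which carry
-- Cauchy moduli, makes conversion checking intractable.
opaque
  _+_ _*_ : ℝ → ℝ → ℝ
  x + y = x D.+ y
  x * y = x D.* y

  -_ : ℝ → ℝ
  - x = D.- x

_-_ : ℝ → ℝ → ℝ
x - y = x + - y

opaque
  unfolding _+_

  seq-+ : ∀ x y i → seq (x + y) i ≡ seq x i ℚ.+ seq y i
  seq-+ x y i = refl

  seq-* : ∀ x y i → seq (x * y) i ≡ seq x i ℚ.* seq y i
  seq-* x y i = refl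

  seq-neg : ∀ x i → seq (- x) i ≡ ℚ.- seq x i
  seq-neg x i = refl

  D+≡+ : ∀ x y → x D.+ y ≡ x + y
  D+≡+ x y = refl

  D*≡* : ∀ x y → x D.* y ≡ x * y
  D*≡* x y = refl

  Dneg≡neg : ∀ x → D.- x ≡ - x
  Dneg≡neg x = refl

D-≡- : ∀ x y → x D.- y ≡ x - y
D-≡- x y = trans (D+≡+ x (D.- y)) (cong (x +_) (Dneg≡neg y))

opaque
  unfolding _+_

  +-cong : ∀ {x x′ y y′} → x ≃ x′ → y ≃ y′ → x + y ≃ x′ + y′
  +-cong = Concrete.+-cong

  -‿cong : ∀ {x y} → x ≃ y → - x ≃ - y
  -‿cong = Concrete.-‿cong

  *-cong : ∀ {x x′ y y′} → x ≃ x′ → y ≃ y′ → x * y ≃ x′ * y′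
  *-cong = Concrete.*-cong

+-assoc : ∀ x y z → (x + y) + z ≃ x + (y + z)
+-assoc x y z = pointwise eq
  where
  eq : ∀ i → seq ((x + y) + z) i ≡ seq (x + (y + z)) i
  eq i rewrite seq-+ (x + y) z i | seq-+ x y i | seq-+ x (y + z) i | seq-+ y z i =
    ℚ.+-assoc (seq x i) (seq y i) (seq z i)

+-comm : ∀ x y → x + y ≃ y + x
+-comm x y = pointwise eq
  where
  eq : ∀ i → seq (x + y) i ≡ seq (y + x) i
  eq i rewrite seq-+ x y i | seq-+ y x i = ℚ.+-comm (seq x i) (seq y i)

+-identityˡ : ∀ x → 0ℝ + x ≃ x
+-identityˡ x = pointwise λ i → trans (seq-+ 0ℝ x i) (ℚ.+-identityˡ (seq x i))

+-inverseˡ : ∀ x → - x + x ≃ 0ℝ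
+-inverseˡ x = pointwise eq
  where
  eq : ∀ i → seq (- x + x) i ≡ 0ℚ
  eq i rewrite seq-+ (- x) x i | seq-neg x i = ℚ.+-inverseˡ (seq x i)

*-assoc : ∀ x y z → (x * y) * z ≃ x * (y * z)
*-assoc x y z = pointwise eq
  where
  eq : ∀ i → seq ((x * y) * z) i ≡ seq (x * (y * z)) i
  eq i rewrite seq-* (x * y) z i | seq-* x y i | seq-* x (y * z) i | seq-* y z i =
    ℚ.*-assoc (seq x i) (seq y i) (seq z i)

*-comm : ∀ x y → x * y ≃ y * x
*-comm x y = pointwise eq
  where
  eq : ∀ i → seq (x * y) i ≡ seq (y * x) i
  eq i rewrite seq-* x y i | seq-* y x i = ℚ.*-comm (seq x i) (seq y i)

*-identityˡ : ∀ x → 1ℝ * x ≃ x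
*-identityˡ x = pointwise λ i → trans (seq-* 1ℝ x i) (ℚ.*-identityˡ (seq x i))

*-distribˡ-+ : ∀ x y z → x * (y + z) ≃ x * y + x * z
*-distribˡ-+ x y z = pointwise eq
  where
  eq : ∀ i → seq (x * (y + z)) i ≡ seq (x * y + x * z) i
  eq i rewrite seq-* x (y + z) i | seq-+ y z i | seq-+ (x * y) (x * z) i | seq-* x y i | seq-* x z i =
    ℚ.*-distribˡ-+ (seq x i) (seq y i) (seq z i)

fromℚ-+ : ∀ p q → fromℚ (p ℚ.+ q) ≃ fromℚ p + fromℚ q
fromℚ-+ p q = pointwise λ i → sym (seq-+ (fromℚ p) (fromℚ q) i)

fromℚ-* : ∀ p q → fromℚ (p ℚ.* q) ≃ fromℚ p * fromℚ q
fromℚ-* p q = pointwise λ i → sym (seq-* (fromℚ p) (fromℚ q) i)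

fromℚ-neg : ∀ p → fromℚ (ℚ.- p) ≃ - fromℚ p
fromℚ-neg p = pointwise λ i → sym (seq-neg (fromℚ p) i)

≃-isEquivalence : IsEquivalence _≃_
≃-isEquivalence = record { refl = ≃-refl ; sym = ≃-sym ; trans = ≃-trans }

≃-setoid : Setoid 0ℓ 0ℓ
≃-setoid = record { isEquivalence = ≃-isEquivalence }

private module Consequences = Algebra.Consequences.Setoid ≃-setoid

ℝ-commutativeRing : CommutativeRing 0ℓ 0ℓ
ℝ-commutativeRing = record
  { Carrier = ℝ ; _≈_ = _≃_ ; _+_ = _+_ ; _*_ = _*_ ; -_ = -_ ; 0# = 0ℝ ; 1# = 1ℝ
  ; isCommutativeRing = record
    { isRing = record
      { +-isAbelianGroup = record
        { isGroup = record
          { isMonoid = record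
            { isSemigroup = record
              { isMagma = record { isEquivalence = ≃-isEquivalence ; ∙-cong = +-cong }
              ; assoc = +-assoc }
            ; identity = Consequences.comm∧idˡ⇒id +-comm +-identityˡ }
          ; inverse = Consequences.comm∧invˡ⇒inv +-comm +-inverseˡ
          ; ⁻¹-cong = -‿cong }
        ; comm = +-comm }
      ; *-cong = *-cong
      ; *-assoc = *-assoc
      ; *-identity = Consequences.comm∧idˡ⇒id *-comm *-identityˡ
      ; distrib = Consequences.comm∧distrˡ⇒distr +-cong *-comm *-distribˡ-+ }
    ; *-comm = *-comm } }

private
  ℚ-rawRing : RawRing 0ℓ 0ℓ
  ℚ-rawRing = CommutativeRing.rawRing ℚ.+-*-commutativeRing

  fromℚ-morphism : ℚ-rawRing -Raw-AlmostCommutative⟶ fromCommutativeRing ℝ-commutativeRing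
  fromℚ-morphism = record
    { ⟦_⟧    = fromℚ
    ; +-homo = fromℚ-+
    ; *-homo = fromℚ-*
    ; -‿homo = fromℚ-neg
    ; 0-homo = ≃-refl
    ; 1-homo = ≃-refl
    }

-- Coefficients are rational because their equality is decidable, which lets the normaliser cancel
-- terms.
module RealSolver = Algebra.Solver.Ring ℚ-rawRing (fromCommutativeRing ℝ-commutativeRing) fromℚ-morphism
  (λ p q → Maybe.map (λ eq → pointwise λ _ → eq) (dec⇒maybe (p ℚ.≟ q)))

module ≃-Reasoning = Relation.Binary.Reasoning.Setoid ≃-setoid

private module R = RealSolver

-- Apartness and order

-- Apartness from zero. Its negation is equality with zero, by `¬Away⇒≃0`, so classical reasoning is
-- available wherever the goal is an equation.
record Away (x : ℝ) : Set where
  constructor away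
  field
    {ε}   : ℚ
    0<ε   : 0ℚ ℚ.< ε
    bound : Eventually (λ i → ε ℚ.≤ ∣ seq x i ∣)

record Pos (x : ℝ) : Set where
  constructor pos
  field
    {ε}   : ℚ
    0<ε   : 0ℚ ℚ.< ε
    bound : Eventually (λ i → ε ℚ.≤ seq x i)

-- A condition on the approximants, not on the limit: it is stronger than `0ℝ ≤ x` and not invariant
-- under `_≃_`. The explicit numbers of the construction satisfy it.
record NonNeg (x : ℝ) : Set where
  constructor nonNeg
  field
    bound : Eventually (λ i → 0ℚ ℚ.≤ seq x i)

-- Half of a lower bound survives a perturbation by the other half.
δ≤-perturbed : ∀ ε δ p q → δ ℚ.+ δ ≡ ε → ε ℚ.≤ p → ∣ p ℚ.- q ∣ ℚ.≤ δ → δ ℚ.≤ q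
δ≤-perturbed ε δ p q eq ε≤p d≤δ = let open ℚ.≤-Reasoning in begin
  δ                              ≡⟨ QS.solve 1 (λ d → d := (d :+ d) :- d) refl δ ⟩
  δ ℚ.+ δ ℚ.- δ                  ≡⟨ cong (ℚ._- δ) eq ⟩
  ε ℚ.- δ                        ≤⟨ ℚ.+-mono-≤ ε≤p (ℚ.neg-antimono-≤ {∣ p ℚ.- q ∣} {δ} d≤δ) ⟩
  p ℚ.- ∣ p ℚ.- q ∣              ≤⟨ ℚ.+-monoʳ-≤ p (ℚ.neg-antimono-≤ {p ℚ.- q} {∣ p ℚ.- q ∣} (p≤∣p∣ (p ℚ.- q))) ⟩
  p ℚ.- (p ℚ.- q)                ≡⟨ QS.solve 2 (λ p q → p :- (p :- q) := q) refl p q ⟩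
  q                              ∎

∣∣p∣-∣q∣∣≤ : ∀ p q δ → ∣ p ℚ.- q ∣ ℚ.≤ δ → ∣ ∣ p ∣ ℚ.- ∣ q ∣ ∣ ℚ.≤ δ
∣∣p∣-∣q∣∣≤ p q δ d≤δ = ∣p∣≤ {∣ p ∣ ℚ.- ∣ q ∣} {δ} (one p q d≤δ)
  (subst (ℚ._≤ δ) (QS.solve 2 (λ a b → b :- a := :- (a :- b)) refl ∣ p ∣ ∣ q ∣)
    (one q p (subst (ℚ._≤ δ) (∣p-q∣≡∣q-p∣ p q) d≤δ)))
  where
  one : ∀ p q → ∣ p ℚ.- q ∣ ℚ.≤ δ → ∣ p ∣ ℚ.- ∣ q ∣ ℚ.≤ δ
  one p q d≤δ = let open ℚ.≤-Reasoning in begin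
    ∣ p ∣ ℚ.- ∣ q ∣
      ≡⟨ cong (λ z → ∣ z ∣ ℚ.- ∣ q ∣) (QS.solve 2 (λ p q → p := (p :- q) :+ q) refl p q) ⟩
    ∣ (p ℚ.- q) ℚ.+ q ∣ ℚ.- ∣ q ∣
      ≤⟨ ℚ.+-monoˡ-≤ (ℚ.- ∣ q ∣) (ℚ.∣p+q∣≤∣p∣+∣q∣ (p ℚ.- q) q) ⟩
    ∣ p ℚ.- q ∣ ℚ.+ ∣ q ∣ ℚ.- ∣ q ∣
      ≡⟨ QS.solve 2 (λ d q → d :+ q :- q := d) refl ∣ p ℚ.- q ∣ ∣ q ∣ ⟩
    ∣ p ℚ.- q ∣
      ≤⟨ d≤δ ⟩
    δ ∎

∣p-0∣≤ : ∀ p q δ → ∣ p ℚ.- q ∣ ℚ.≤ δ → ∣ q ∣ ℚ.≤ 2ℚ ℚ.* δ → ∣ p ℚ.- 0ℚ ∣ ℚ.≤ nat 3 ℚ.* δ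
∣p-0∣≤ p q δ d≤δ q≤2δ = let open ℚ.≤-Reasoning in begin
  ∣ p ℚ.- 0ℚ ∣           ≡⟨ cong ∣_∣ (QS.solve 2 (λ a b → a :- con 0ℚ := (a :- b) :+ b) refl p q) ⟩
  ∣ (p ℚ.- q) ℚ.+ q ∣    ≤⟨ ∣p+q∣≤ {p ℚ.- q} {q} d≤δ q≤2δ ⟩
  δ ℚ.+ 2ℚ ℚ.* δ         ≡⟨ QS.solve 1 (λ d → d :+ con 2ℚ :* d := con (nat 3) :* d) refl δ ⟩
  nat 3 ℚ.* δ            ∎

Away-cong : ∀ {x y} → x ≃ y → Away x → Away y
Away-cong {x} {y} (mk x≈y) (away {ε} 0<ε ε≤) =
  let δ , 0<δ , eq = halve ε 0<ε in away 0<δ (ev-zip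
  (λ i p d → δ≤-perturbed ε δ ∣ seq x i ∣ ∣ seq y i ∣ eq p (∣∣p∣-∣q∣∣≤ (seq x i) (seq y i) δ d))
  ε≤ (x≈y δ 0<δ))

Pos-cong : ∀ {x y} → x ≃ y → Pos x → Pos y
Pos-cong {x} {y} (mk x≈y) (pos {ε} 0<ε ε≤) =
  let δ , 0<δ , eq = halve ε 0<ε in pos 0<δ (ev-zip (λ i → δ≤-perturbed ε δ (seq x i) (seq y i) eq) ε≤ (x≈y δ 0<δ))

¬Pos-0 : ∀ {x} → x ≃ 0ℝ → ¬ Pos x
¬Pos-0 x≃0 p = ¬Pos0 (Pos-cong x≃0 p)
  where
  ¬Pos0 : ¬ Pos 0ℝ
  ¬Pos0 (pos 0<ε ε≤) = ℚ.<-irrefl refl (ℚ.<-≤-trans 0<ε (proj₂ (ev-witness ε≤)))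

¬Away-0 : ∀ {x} → x ≃ 0ℝ → ¬ Away x
¬Away-0 x≃0 a = ¬Away0 (Away-cong x≃0 a)
  where
  ¬Away0 : ¬ Away 0ℝ
  ¬Away0 (away 0<ε ε≤) = ℚ.<-irrefl refl (ℚ.<-≤-trans 0<ε (proj₂ (ev-witness ε≤)))

Pos⇒NonNeg : ∀ {x} → Pos x → NonNeg x
Pos⇒NonNeg (pos 0<ε ε≤) = nonNeg (ev-map (λ i p → ℚ.≤-trans (ℚ.<⇒≤ 0<ε) p) ε≤)

-- Compare one late approximant with 2δ, which is decidable in ℚ. If it exceeds 2δ in absolute
-- value, all later ones exceed δ and x is apart from zero. Otherwise all later ones are within 3δ
-- of zero.
¬Away⇒≃0 : ∀ {x} → ¬ Away x → x ≃ 0ℝ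
¬Away⇒≃0 {x} ¬a = ≃-by (nat 3) (0≤nat 3) close
  where
  close : ∀ δ → 0ℚ ℚ.< δ → Eventually (λ i → ∣ seq x i ℚ.- 0ℚ ∣ ℚ.≤ nat 3 ℚ.* δ)
  close δ 0<δ =
    let N , c = cauchy x δ 0<δ in case ∣ seq x N ∣ ℚ.≤? 2ℚ ℚ.* δ of λ where
    (yes small) → N , λ i N≤i → ∣p-0∣≤ (seq x i) (seq x N) δ (c i N N≤i ℕ.≤-refl) small
    (no large) → ⊥-elim (¬a (away 0<δ (N , λ i N≤i → δ≤-perturbed (2ℚ ℚ.* δ) δ ∣ seq x N ∣ ∣ seq x i ∣
      (QS.solve 1 (λ d → d :+ d := con 2ℚ :* d) refl δ) (ℚ.<⇒≤ (ℚ.≰⇒> large))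
      (∣∣p∣-∣q∣∣≤ (seq x N) (seq x i) δ (c N i ℕ.≤-refl N≤i)))))

-- At an index past both thresholds the approximant has absolute value at least ε, and later ones
-- move by at most ε/2. Its sign is therefore final.
Away-sign : ∀ {x} → Away x → Pos x ⊎ Pos (- x)
Away-sign {x} (away {ε} 0<ε (N , ε≤)) =
  let δ , 0<δ , eq = halve ε 0<ε
      M , c = cauchy x δ 0<δ
  in case ℚ.∣p∣≡p∨∣p∣≡-p (seq x (M ⊔ N)) of λ where
  (inj₁ p) → inj₁ (pos 0<δ (M , λ i M≤i → δ≤-perturbed ε δ (seq x (M ⊔ N)) (seq x i) eq
    (subst (ε ℚ.≤_) p (ε≤ (M ⊔ N) (ℕ.m≤n⊔m M N))) (c (M ⊔ N) i (ℕ.m≤m⊔n M N) M≤i)))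
  (inj₂ p) → inj₂ (pos 0<δ (M , λ i M≤i → subst (δ ℚ.≤_) (sym (seq-neg x i))
    (δ≤-perturbed ε δ (ℚ.- seq x (M ⊔ N)) (ℚ.- seq x i) eq
      (subst (ε ℚ.≤_) p (ε≤ (M ⊔ N) (ℕ.m≤n⊔m M N)))
      (subst (ℚ._≤ δ) (cong ∣_∣ (QS.solve 2 (λ a b → b :- a := (:- a) :- (:- b)) refl (seq x (M ⊔ N)) (seq x i)))
        (c i (M ⊔ N) M≤i (ℕ.m≤m⊔n M N))))))

Away-* : ∀ {x y} → Away x → Away y → Away (x * y)
Away-* {x} {y} (away {ε} 0<ε ε≤) (away {δ} 0<δ δ≤) = away (0<* 0<ε 0<δ)
  (ev-zip (λ i p q → subst (ε ℚ.* δ ℚ.≤_)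
      (trans (sym (ℚ.∣p*q∣≡∣p∣*∣q∣ (seq x i) (seq y i))) (cong ∣_∣ (sym (seq-* x y i))))
      (*-mono (ℚ.<⇒≤ 0<δ) (ℚ.0≤∣p∣ (seq x i)) p q))
    ε≤ δ≤)

-- As the conclusion amounts to the absence of apartness, both factors may be assumed apart from
-- zero. This is why a bare `¬ (x ≃ 0ℝ)`, the form in which `IsPi` speaks about sine, suffices for
-- cancellation.
*-cancel-0 : ∀ {x y} → ¬ (x ≃ 0ℝ) → x * y ≃ 0ℝ → y ≃ 0ℝ
*-cancel-0 x≄0 xy≃0 = ¬Away⇒≃0 λ ay → x≄0 (¬Away⇒≃0 λ ax → ¬Away-0 xy≃0 (Away-* ax ay))

Pos-* : ∀ {x y} → Pos x → Pos y → Pos (x * y)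
Pos-* {x} {y} (pos {ε} 0<ε ε≤) (pos {δ} 0<δ δ≤) = pos (0<* 0<ε 0<δ)
  (ev-zip (λ i p q → subst (ε ℚ.* δ ℚ.≤_) (sym (seq-* x y i))
      (*-mono (ℚ.<⇒≤ 0<δ) (ℚ.≤-trans (ℚ.<⇒≤ 0<ε) p) p q))
    ε≤ δ≤)

NonNeg-* : ∀ {x y} → NonNeg x → NonNeg y → NonNeg (x * y)
NonNeg-* {x} {y} (nonNeg p) (nonNeg q) = nonNeg (ev-zip (λ i p q → subst (0ℚ ℚ.≤_) (sym (seq-* x y i)) (0≤* p q)) p q)

Pos-+ : ∀ {x y} → Pos x → NonNeg y → Pos (x + y)
Pos-+ {x} {y} (pos {ε} 0<ε ε≤) (nonNeg q) = pos 0<ε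
  (ev-zip (λ i p q → ℚ.≤-trans p (≤-by (seq y i) q (sym (seq-+ x y i)))) ε≤ q)

Pos-fromℚ : ∀ {q} → 0ℚ ℚ.< q → Pos (fromℚ q)
Pos-fromℚ 0<q = pos 0<q (always λ _ → ℚ.≤-refl)

<⇒Pos : ∀ {x y} → x < y → Pos (y - x)
<⇒Pos {x} {y} (ε , 0<ε , p) = pos 0<ε (ev-map (λ i x+ε≤y → subst (ε ℚ.≤_) (sym (eq i))
  (≤-by _ (0≤q-p x+ε≤y) (QS.solve 3 (λ e x y → e :+ (y :- (x :+ e)) := y :+ (:- x)) refl ε (seq x i) (seq y i)))) p)
  where
  eq : ∀ i → seq (y - x) i ≡ seq y i ℚ.+ ℚ.- seq x i
  eq i = trans (seq-+ y (- x) i) (cong (seq y i ℚ.+_) (seq-neg x i))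

Pos⇒< : ∀ {x y} → Pos (y - x) → x < y
Pos⇒< {x} {y} (pos {ε} 0<ε p) = ε , 0<ε , ev-map (λ i ε≤ → ≤-by _ (0≤q-p (subst (ε ℚ.≤_) (eq i) ε≤))
  (QS.solve 3 (λ e x y → (x :+ e) :+ ((y :+ (:- x)) :- e) := y) refl ε (seq x i) (seq y i))) p
  where
  eq : ∀ i → seq (y - x) i ≡ seq y i ℚ.+ ℚ.- seq x i
  eq i = trans (seq-+ y (- x) i) (cong (seq y i ℚ.+_) (seq-neg x i))

x-0≃x : ∀ x → x - 0ℝ ≃ x
x-0≃x = R.solve 1 (λ x → x R.:- R.con 0ℚ R.:= x) ≃-refl

0<⇒Pos : ∀ {x} → 0ℝ < x → Pos x
0<⇒Pos {x} 0<x = Pos-cong (x-0≃x x) (<⇒Pos 0<x)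

Pos⇒0< : ∀ {x} → Pos x → 0ℝ < x
Pos⇒0< {x} p = Pos⇒< (Pos-cong (≃-sym (x-0≃x x)) p)

NonNeg⇒0≤ : ∀ {x} → NonNeg x → 0ℝ ≤ x
NonNeg⇒0≤ {x} (nonNeg p) x<0 = ¬neg (ev-witness (ev-zip (λ i → _,_) p (proj₂ (proj₂ x<0))))
  where
  ¬neg : ∃[ i ] (0ℚ ℚ.≤ seq x i × seq x i ℚ.+ proj₁ x<0 ℚ.≤ 0ℚ) → ⊥
  ¬neg (i , 0≤x , x+ε≤0) = ℚ.<-irrefl refl (ℚ.<-≤-trans (ℚ.+-mono-≤-< 0≤x (proj₁ (proj₂ x<0))) x+ε≤0)

0≤⇒¬Pos- : ∀ {x} → 0ℝ ≤ x → ¬ Pos (- x)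
0≤⇒¬Pos- {x} 0≤x p = 0≤x (Pos⇒< (Pos-cong (R.solve 1 (λ x → R.:- x R.:= R.con 0ℚ R.:- x) ≃-refl x) p))

≤⇒¬Pos : ∀ {x y} → x ≤ y → ¬ Pos (x - y)
≤⇒¬Pos x≤y p = x≤y (Pos⇒< p)

Pos-sum : ∀ {x y} → Pos x → Pos y → Pos (x + y)
Pos-sum p q = Pos-+ p (Pos⇒NonNeg q)

-- Trichotomy in the form that holds constructively: a difference apart from zero has a sign, and
-- both signs are excluded.
≃-stable : ∀ {x y} → ¬ Pos (x - y) → ¬ Pos (y - x) → x ≃ y
≃-stable {x} {y} ¬p ¬q = begin
  x             ≈⟨ R.solve 2 (λ x y → x R.:= (x R.:- y) R.:+ y) ≃-refl x y ⟩
  (x - y) + y   ≈⟨ +-cong (¬Away⇒≃0 λ a → contra (Away-sign a)) ≃-refl ⟩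
  0ℝ + y        ≈⟨ +-identityˡ y ⟩
  y             ∎
  where
  open ≃-Reasoning
  contra : Pos (x - y) ⊎ Pos (- (x - y)) → ⊥
  contra (inj₁ p) = ¬p p
  contra (inj₂ q) = ¬q (Pos-cong (R.solve 2 (λ x y → R.:- (x R.:- y) R.:= y R.:- x) ≃-refl x y) q)

-‿≃0⇒≃ : ∀ {x y} → x - y ≃ 0ℝ → x ≃ y
-‿≃0⇒≃ {x} {y} x-y≃0 = begin
  x             ≈⟨ R.solve 2 (λ x y → x R.:= (x R.:- y) R.:+ y) ≃-refl x y ⟩
  (x - y) + y   ≈⟨ +-cong x-y≃0 ≃-refl ⟩
  0ℝ + y        ≈⟨ +-identityˡ y ⟩
  y             ∎
  where open ≃-Reasoning

≃⇒-‿≃0 : ∀ {x y} → x ≃ y → x - y ≃ 0ℝ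
≃⇒-‿≃0 {x} {y} x≃y = begin
  x - y   ≈⟨ +-cong x≃y ≃-refl ⟩
  y - y   ≈⟨ R.solve 1 (λ y → y R.:- y R.:= R.con 0ℚ) ≃-refl y ⟩
  0ℝ      ∎
  where open ≃-Reasoning

*-cancel : ∀ {a x y} → ¬ (a ≃ 0ℝ) → a * x ≃ a * y → x ≃ y
*-cancel {a} {x} {y} a≄0 ax≃ay = -‿≃0⇒≃ (*-cancel-0 a≄0 (begin
  a * (x - y)     ≈⟨ R.solve 3 (λ a x y → a R.:* (x R.:- y) R.:= a R.:* x R.:- a R.:* y) ≃-refl a x y ⟩
  a * x - a * y   ≈⟨ ≃⇒-‿≃0 ax≃ay ⟩
  0ℝ              ∎))
  where open ≃-Reasoning

-- Identifies the norms in `IsAngle`, given only through their squares, with explicit distances. The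
-- factor r + t of r² - t² cannot vanish, since t = -r would make -r positive.
sqrt-unique : ∀ {r t} → 0ℝ ≤ r → Pos t → r * r ≃ t * t → r ≃ t
sqrt-unique {r} {t} 0≤r 0<t r²≃t² = -‿≃0⇒≃ (*-cancel-0 r+t≄0 (begin
  (r + t) * (r - t)   ≈⟨ R.solve 2 (λ r t → (r R.:+ t) R.:* (r R.:- t) R.:= r R.:* r R.:- t R.:* t) ≃-refl r t ⟩
  r * r - t * t       ≈⟨ ≃⇒-‿≃0 r²≃t² ⟩
  0ℝ                  ∎))
  where
  open ≃-Reasoning
  r+t≄0 : ¬ (r + t ≃ 0ℝ)
  r+t≄0 eq = 0≤⇒¬Pos- 0≤r (Pos-cong (begin
    t               ≈⟨ R.solve 2 (λ r t → t R.:= (r R.:+ t) R.:- r) ≃-refl r t ⟩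
    (r + t) - r     ≈⟨ +-cong eq ≃-refl ⟩
    0ℝ - r          ≈⟨ +-identityˡ (- r) ⟩
    - r             ∎) 0<t)

-- Reciprocals of positive reals

private
  construct-inverse : ∀ {x} → Pos x → ∃[ w ] (x * w ≃ 1ℝ × Pos w)
  construct-inverse {x} (pos {ε} 0<ε (N , ε≤)) = w , x*w≃1 , 0<w
    where
    -- Raising every approximant to at least ε makes all of them invertible. From N on nothing
    -- changes.
    y : ℕ → ℚ
    y i = ε ℚ.⊔ seq x i
    0<y : ∀ i → 0ℚ ℚ.< y i
    0<y i = ℚ.<-≤-trans 0<ε (ℚ.p≤p⊔q ε (seq x i))
    y≡x : ∀ i → N ℕ.≤ i → y i ≡ seq x i
    y≡x i N≤i = ℚ.p≤q⇒p⊔q≡q (ε≤ i N≤i)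
    inv : (p : ℚ) → 0ℚ ℚ.< p → ∃[ u ] (p ℚ.* u ≡ 1ℚ × 0ℚ ℚ.< u)
    inv p 0<p = (ℚ.1/ p) {{nz}} , ℚ.*-inverseʳ p {{nz}} ,
      ℚ.positive⁻¹ ((ℚ.1/ p) {{nz}}) {{ℚ.1/pos⇒pos p {{ℚ.positive 0<p}}}}
      where nz = ℚ.pos⇒nonZero p {{ℚ.positive 0<p}}
    u : ℕ → ℚ
    u i = proj₁ (inv (y i) (0<y i))
    0<u : ∀ i → 0ℚ ℚ.< u i
    0<u i = proj₂ (proj₂ (inv (y i) (0<y i)))
    x*u : ∀ i → N ℕ.≤ i → seq x i ℚ.* u i ≡ 1ℚ
    x*u i N≤i = subst (λ z → z ℚ.* u i ≡ 1ℚ) (y≡x i N≤i) (proj₁ (proj₂ (inv (y i) (0<y i))))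
    R = proj₁ (inv ε 0<ε)
    ε*R = proj₁ (proj₂ (inv ε 0<ε))
    0<R = proj₂ (proj₂ (inv ε 0<ε))
    u≤R : ∀ i → N ℕ.≤ i → u i ℚ.≤ R
    u≤R i N≤i = let open ℚ.≤-Reasoning in begin
      u i                ≡⟨ sym (ℚ.*-identityʳ (u i)) ⟩
      u i ℚ.* 1ℚ         ≡⟨ cong (u i ℚ.*_) (sym ε*R) ⟩
      u i ℚ.* (ε ℚ.* R)  ≡⟨ QS.solve 3 (λ u e r → u :* (e :* r) := (e :* u) :* r) refl (u i) ε R ⟩
      (ε ℚ.* u i) ℚ.* R  ≤⟨ *-monoʳ (ℚ.<⇒≤ 0<R) (*-monoʳ (ℚ.<⇒≤ (0<u i)) (ε≤ i N≤i)) ⟩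
      (seq x i ℚ.* u i) ℚ.* R ≡⟨ cong (ℚ._* R) (x*u i N≤i) ⟩
      1ℚ ℚ.* R           ≡⟨ ℚ.*-identityˡ R ⟩
      R                  ∎
    ∣u∣≤R : ∀ i → N ℕ.≤ i → ∣ u i ∣ ℚ.≤ R
    ∣u∣≤R i N≤i = ℚ.≤-trans (ℚ.≤-reflexive (ℚ.0≤p⇒∣p∣≡p (ℚ.<⇒≤ (0<u i)))) (u≤R i N≤i)
    u-cauchy : Cauchy u
    u-cauchy η 0<η =
      let δ , 0<δ , eq = split η (R ℚ.* R) 1ℚ 0<η (ℚ.+-mono-≤-< (0≤* (ℚ.<⇒≤ 0<R) (ℚ.<⇒≤ 0<R)) (ℚ.positive⁻¹ 1ℚ))
          M , c = cauchy x δ 0<δ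
      in M ⊔ N , λ i j le-i le-j →
      let M≤i = ℕ.m⊔n≤o⇒m≤o M N le-i
          N≤i = ℕ.m⊔n≤o⇒n≤o M N le-i
          M≤j = ℕ.m⊔n≤o⇒m≤o M N le-j
          N≤j = ℕ.m⊔n≤o⇒n≤o M N le-j
          open ℚ.≤-Reasoning
      in begin
      ∣ u i ℚ.- u j ∣
        ≡⟨ cong ∣_∣ (cong₂ ℚ._-_ (sym (ℚ.*-identityʳ (u i))) (sym (ℚ.*-identityʳ (u j)))) ⟩
      ∣ u i ℚ.* 1ℚ ℚ.- u j ℚ.* 1ℚ ∣
        ≡⟨ cong ∣_∣ (cong₂ (λ a b → u i ℚ.* a ℚ.- u j ℚ.* b) (sym (x*u j N≤j)) (sym (x*u i N≤i))) ⟩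
      ∣ u i ℚ.* (seq x j ℚ.* u j) ℚ.- u j ℚ.* (seq x i ℚ.* u i) ∣
        ≡⟨ cong ∣_∣ (QS.solve 4 (λ u v a b → u :* (b :* v) :- v :* (a :* u) := u :* v :* (b :- a)) refl (u i) (u j) (seq x i) (seq x j)) ⟩
      ∣ u i ℚ.* u j ℚ.* (seq x j ℚ.- seq x i) ∣
        ≤⟨ ∣p*q∣≤ {u i ℚ.* u j} {seq x j ℚ.- seq x i} (∣p*q∣≤ {u i} {u j} (∣u∣≤R i N≤i) (∣u∣≤R j N≤j)) (c j i M≤j M≤i) ⟩
      R ℚ.* R ℚ.* δ
        ≤⟨ ≤-by (1ℚ ℚ.* δ) (0≤* 0≤1 (ℚ.<⇒≤ 0<δ)) eq ⟩
      η ∎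
    w : ℝ
    w = mkℝ u u-cauchy
    x*w≃1 : x * w ≃ 1ℝ
    x*w≃1 = mk λ η 0<η → N , λ i N≤i → subst (λ d → ∣ d ∣ ℚ.≤ η)
      (trans (sym (ℚ.+-inverseʳ 1ℚ)) (cong (ℚ._- 1ℚ) (sym (trans (seq-* x w i) (x*u i N≤i))))) (ℚ.<⇒≤ 0<η)
    0<w : Pos w
    0<w =
      -- An upper bound B of x gives the lower bound 1/B for its reciprocal.
      let B , 0<B , bounded = eventuallyBounded (seq x) (cauchy x)
          V , B*V , 0<V = inv B 0<B
      in pos 0<V (ev-zip (λ i x≤B N≤i → let open ℚ.≤-Reasoning in begin
      V                        ≡⟨ sym (ℚ.*-identityˡ V) ⟩
      1ℚ ℚ.* V                 ≡⟨ cong (ℚ._* V) (sym (x*u i N≤i)) ⟩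
      (seq x i ℚ.* u i) ℚ.* V  ≤⟨ *-monoʳ (ℚ.<⇒≤ 0<V) (*-monoʳ (ℚ.<⇒≤ (0<u i)) (ℚ.≤-trans (p≤∣p∣ (seq x i)) x≤B)) ⟩
      (B ℚ.* u i) ℚ.* V        ≡⟨ QS.solve 3 (λ b u v → b :* u :* v := (b :* v) :* u) refl B (u i) V ⟩
      (B ℚ.* V) ℚ.* u i        ≡⟨ cong (ℚ._* u i) B*V ⟩
      1ℚ ℚ.* u i               ≡⟨ ℚ.*-identityˡ (u i) ⟩
      u i                      ∎) bounded (N , λ i N≤i → N≤i))

opaque
  inverse : ∀ {x} → Pos x → ∃[ w ] (x * w ≃ 1ℝ × Pos w)
  inverse = construct-inverse

-- Sine and cosine

∣p-r∣≤ : ∀ p q r {a b} → ∣ p ℚ.- q ∣ ℚ.≤ a → ∣ q ℚ.- r ∣ ℚ.≤ b → ∣ p ℚ.- r ∣ ℚ.≤ a ℚ.+ b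
∣p-r∣≤ p q r {a} {b} pq qr = subst (λ z → ∣ z ∣ ℚ.≤ a ℚ.+ b)
  (QS.solve 3 (λ p q r → (p :- q) :+ (q :- r) := p :- r) refl p q r)
  (∣p+q∣≤ {p ℚ.- q} {q ℚ.- r} pq qr)

record Scale (x : ℝ) : Set where
  field
    {B K}    : ℚ
    x≤B      : Eventually (λ i → ∣ seq x i ∣ ℚ.≤ B)
    T≤ : ∀ k → T k B ℚ.≤ K ℚ.* (half k ℚ.* half k)
    0≤K      : 0ℚ ℚ.≤ K

  4K : ℚ
  4K = K ℚ.+ K ℚ.+ (K ℚ.+ K)

scaleFrom : ∀ x B → 0ℚ ℚ.≤ B → Eventually (λ i → ∣ seq x i ∣ ℚ.≤ B) → Scale x
scaleFrom x B 0≤B x≤B =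
  let K , 0≤K , T≤ = T-majorant B 0≤B
  in record { x≤B = x≤B ; T≤ = T≤ ; 0≤K = 0≤K }

scale : ∀ x → Scale x
scale x =
  let B , 0<B , x≤B = eventuallyBounded (seq x) (cauchy x)
  in scaleFrom x B (ℚ.<⇒≤ 0<B) x≤B

commonBound : ∀ x y → ∃[ B ] (0ℚ ℚ.≤ B × Eventually (λ i → ∣ seq x i ∣ ℚ.≤ B × ∣ seq y i ∣ ℚ.≤ B))
commonBound x y =
  let A , 0<A , x≤A = eventuallyBounded (seq x) (cauchy x)
      B , 0<B , y≤B = eventuallyBounded (seq y) (cauchy y)
  in A ℚ.+ B , 0≤+ (ℚ.<⇒≤ 0<A) (ℚ.<⇒≤ 0<B) ,
     ev-zip (λ i p q → ℚ.≤-trans p (≤-by B (ℚ.<⇒≤ 0<B) refl) , ℚ.≤-trans q (≤-by A (ℚ.<⇒≤ 0<A) (ℚ.+-comm B A))) x≤A y≤B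

module _ (w : ℕ → ℚ) (w≤1 : Bounded w) where

  private
    W : ℚ → ℕ → ℚ
    W = wsum w

  -- The tail bound depends on x only through `B` and `K`, so a single N serves for all later
  -- approximants of x.
  ∣partial-diff∣≤ : ∀ {x} → Scale x → ∀ η → 0ℚ ℚ.< η →
    ∃[ N ] (∀ i m n → N ℕ.≤ i → N ℕ.≤ m → N ℕ.≤ n → ∣ W (seq x i) m ℚ.- W (seq x i) n ∣ ℚ.≤ η)
  ∣partial-diff∣≤ {x} σ η 0<η =
    let open Scale σ
        N , small   = K*half-small 4K η 0<η
        M , bounded = x≤B
    in N ⊔ M , λ i m n le-i le-m le-n → ℚ.≤-trans
      (∣wsum-diff∣≤ B K T≤ 0≤K {w} w≤1 {seq x i} (bounded i (ℕ.m⊔n≤o⇒n≤o N M le-i)) N {m} {n}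
        (ℕ.m⊔n≤o⇒m≤o N M le-m) (ℕ.m⊔n≤o⇒m≤o N M le-n))
      (small N ℕ.≤-refl)

  -- Length and argument vary together. First the length changes from i to j at a fixed argument, by
  -- the tail bound. Then the argument changes at a fixed length, by the Lipschitz bound.
  series-cauchy : ∀ x → Cauchy (λ i → W (seq x i) i)
  series-cauchy x ε 0<ε =
    let σ = scale x
        open Scale σ
        η , 0<η , η+η≡ε = halve ε 0<ε
        L , close = ∣partial-diff∣≤ σ η 0<η
        M , bounded = x≤B
        δ , 0<δ , split-η = split η (K ℚ.+ K) 1ℚ 0<η (ℚ.+-mono-≤-< (0≤+ 0≤K 0≤K) (ℚ.positive⁻¹ 1ℚ))
        N , x-close = cauchy x δ 0<δ
        L≤ = λ {k} (p : (L ⊔ M) ⊔ N ℕ.≤ k) → ℕ.m⊔n≤o⇒m≤o L M (ℕ.m⊔n≤o⇒m≤o (L ⊔ M) N p)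
        M≤ = λ {k} (p : (L ⊔ M) ⊔ N ℕ.≤ k) → ℕ.m⊔n≤o⇒n≤o L M (ℕ.m⊔n≤o⇒m≤o (L ⊔ M) N p)
        N≤ = λ {k} (p : (L ⊔ M) ⊔ N ℕ.≤ k) → ℕ.m⊔n≤o⇒n≤o (L ⊔ M) N p
        2Kδ≤η = ≤-by {(K ℚ.+ K) ℚ.* δ} {η} (1ℚ ℚ.* δ) (0≤* 0≤1 (ℚ.<⇒≤ 0<δ)) split-η
    in (L ⊔ M) ⊔ N , λ i j le-i le-j → ℚ.≤-trans
      (∣p-r∣≤ (W (seq x i) i) (W (seq x i) j) (W (seq x j) j) {η} {η}
        (close i i j (L≤ le-i) (L≤ le-i) (L≤ le-j))
        (ℚ.≤-trans (∣wsum-lip∣≤ B K T≤ 0≤K {w} w≤1 {seq x i} {seq x j} (bounded i (M≤ le-i)) (bounded j (M≤ le-j)) j)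
          (ℚ.≤-trans (*-monoʳ (0≤+ 0≤K 0≤K) (x-close i j (N≤ le-i) (N≤ le-j)))
            (ℚ.≤-trans (ℚ.≤-reflexive (ℚ.*-comm δ (K ℚ.+ K))) 2Kδ≤η))))
      (ℚ.≤-reflexive η+η≡ε)

  series : ℝ → ℝ
  series x = mkℝ (λ i → W (seq x i) i) (series-cauchy x)

  series-cong : ∀ {x y} → x ≃ y → series x ≃ series y
  series-cong {x} {y} (mk x≈y) =
    let B , 0≤B , bounded = commonBound x y
        K , 0≤K , T≤ = T-majorant B 0≤B
    in ≃-by (K ℚ.+ K) (0≤+ 0≤K 0≤K) λ δ 0<δ → ev-zip
      (λ i (x≤ , y≤) d → ℚ.≤-trans (∣wsum-lip∣≤ B K T≤ 0≤K {w} w≤1 {seq x i} {seq y i} x≤ y≤ i)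
        (ℚ.≤-trans (*-monoʳ (0≤+ 0≤K 0≤K) d) (ℚ.≤-reflexive (ℚ.*-comm δ (K ℚ.+ K)))))
      bounded (x≈y δ 0<δ)

  -- The length is 2n because `cosTerm` and `sinTerm` list one parity of exponents and `wsum` lists
  -- both. With ε = 2η, closeness within η leaves the margin η that the strict inequalities of
  -- `HasSum` require.
  series-hasSum : ∀ x (f : ℕ → ℝ) →
    (∀ n i → seq (partialSum f n) i ≡ W (seq x i) (2 ℕ.* n)) → HasSum f (series x)
  series-hasSum x f eq ε 0<ε =
    let η , 0<η , η+η≡ε = halve ε 0<ε
        N , close = ∣partial-diff∣≤ (scale x) η 0<η
        n≤2n = λ n → ℕ.m≤m+n n (n ℕ.+ 0)
        lower = λ p q (d : ∣ p ℚ.- q ∣ ℚ.≤ η) → ≤-by {p ℚ.- ε ℚ.+ η} {q} (η ℚ.- (p ℚ.- q))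
                  (0≤q-p (ℚ.≤-trans (p≤∣p∣ (p ℚ.- q)) d))
                  (trans (cong (λ e → p ℚ.- e ℚ.+ η ℚ.+ (η ℚ.- (p ℚ.- q))) (sym η+η≡ε))
                    (QS.solve 3 (λ p q n → (p :- (n :+ n)) :+ n :+ (n :- (p :- q)) := q) refl p q η))
        upper = λ p q (d : ∣ p ℚ.- q ∣ ℚ.≤ η) → ≤-by {q ℚ.+ η} {p ℚ.+ ε} (η ℚ.- (ℚ.- (p ℚ.- q)))
                  (0≤q-p (ℚ.≤-trans (-p≤∣p∣ (p ℚ.- q)) d))
                  (trans (QS.solve 3 (λ p q n → q :+ n :+ (n :- (:- (p :- q))) := p :+ (n :+ n)) refl p q η)
                    (cong (p ℚ.+_) η+η≡ε))
    in N , λ n N≤n →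
      let N≤2n = ℕ.≤-trans N≤n (n≤2n n) in
      (η , 0<η , N , λ i N≤i → subst (λ z → W (seq x i) i ℚ.- ε ℚ.+ η ℚ.≤ z) (sym (eq n i))
        (lower (W (seq x i) i) (W (seq x i) (2 ℕ.* n)) (close i i (2 ℕ.* n) N≤i N≤i N≤2n))) ,
      (η , 0<η , N , λ i N≤i → subst (λ z → z ℚ.+ η ℚ.≤ W (seq x i) i ℚ.+ ε) (sym (eq n i))
        (upper (W (seq x i) i) (W (seq x i) (2 ℕ.* n)) (close i i (2 ℕ.* n) N≤i N≤i N≤2n)))

HasSum-cong : ∀ {f s t} → s ≃ t → HasSum f s → HasSum f t
HasSum-cong {f} {s} {t} (mk s≈t) sum ε 0<ε =
  let η , 0<η , η+η≡ε = halve ε 0<ε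
      N , bounds = sum η 0<η
      near = s≈t η 0<η
      lower = λ δ s t p (d : ∣ s ℚ.- t ∣ ℚ.≤ η) (q : s ℚ.- η ℚ.+ δ ℚ.≤ p) → ℚ.≤-trans
        (≤-by {t ℚ.- ε ℚ.+ δ} {s ℚ.- η ℚ.+ δ} (η ℚ.- ℚ.- (s ℚ.- t)) (0≤q-p (ℚ.≤-trans (-p≤∣p∣ (s ℚ.- t)) d))
          (trans (cong (λ e → t ℚ.- e ℚ.+ δ ℚ.+ (η ℚ.- ℚ.- (s ℚ.- t))) (sym η+η≡ε))
            (QS.solve 4 (λ s t n d → (t :- (n :+ n)) :+ d :+ (n :- (:- (s :- t))) := s :- n :+ d) refl s t η δ))) q
      upper = λ δ s t p (d : ∣ s ℚ.- t ∣ ℚ.≤ η) (q : p ℚ.+ δ ℚ.≤ s ℚ.+ η) → ℚ.≤-trans q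
        (≤-by {s ℚ.+ η} {t ℚ.+ ε} (η ℚ.- (s ℚ.- t)) (0≤q-p (ℚ.≤-trans (p≤∣p∣ (s ℚ.- t)) d))
          (trans (QS.solve 3 (λ s t n → s :+ n :+ (n :- (s :- t)) := t :+ (n :+ n)) refl s t η)
            (cong (t ℚ.+_) η+η≡ε)))
  in N , λ n N≤n →
    let (δ , 0<δ , low) , (δ′ , 0<δ′ , up) = bounds n N≤n
    in (δ , 0<δ , ev-zip (λ i → lower δ (seq s i) (seq t i) (seq (partialSum f n) i)) near low) ,
       (δ′ , 0<δ′ , ev-zip (λ i → upper δ′ (seq s i) (seq t i) (seq (partialSum f n) i)) near up)

HasSum-unique : ∀ {f s t} → HasSum f s → HasSum f t → s ≃ t
HasSum-unique {f} {s} {t} sum-s sum-t = ≃-by 2ℚ (0≤nat 2) λ δ 0<δ →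
  let M , bound-s = sum-s δ 0<δ
      N , bound-t = sum-t δ 0<δ
      (ε₁ , 0<ε₁ , low-s) , (ε₂ , 0<ε₂ , up-s) = bound-s (M ⊔ N) (ℕ.m≤m⊔n M N)
      (ε₃ , 0<ε₃ , low-t) , (ε₄ , 0<ε₄ , up-t) = bound-t (M ⊔ N) (ℕ.m≤n⊔m M N)
      step = λ ε ε′ s t p → λ (0<ε : 0ℚ ℚ.< ε) (0<ε′ : 0ℚ ℚ.< ε′) (a : s ℚ.- δ ℚ.+ ε ℚ.≤ p) (b : p ℚ.+ ε′ ℚ.≤ t ℚ.+ δ) →
        ≤-by {s ℚ.- t} {2ℚ ℚ.* δ} ((p ℚ.- (s ℚ.- δ ℚ.+ ε) ℚ.+ ε) ℚ.+ ((t ℚ.+ δ) ℚ.- (p ℚ.+ ε′) ℚ.+ ε′))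
          (0≤+ (0≤+ (0≤q-p a) (ℚ.<⇒≤ 0<ε)) (0≤+ (0≤q-p b) (ℚ.<⇒≤ 0<ε′)))
          (QS.solve 6 (λ s t p d e e′ → (s :- t) :+ ((p :- (s :- d :+ e) :+ e) :+ ((t :+ d) :- (p :+ e′) :+ e′)) := con 2ℚ :* d)
            refl s t p δ ε ε′)
  in ev-zip (λ i (a , b) (a′ , b′) → ∣p∣≤ {seq s i ℚ.- seq t i} {2ℚ ℚ.* δ}
       (step ε₁ ε₄ (seq s i) (seq t i) (seq (partialSum f (M ⊔ N)) i) 0<ε₁ 0<ε₄ a b)
       (subst (ℚ._≤ 2ℚ ℚ.* δ) (QS.solve 2 (λ s t → t :- s := :- (s :- t)) refl (seq s i) (seq t i))
         (step ε₃ ε₂ (seq t i) (seq s i) (seq (partialSum f (M ⊔ N)) i) 0<ε₃ 0<ε₂ a′ b′)))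
     (ev-zip (λ i → _,_) low-s up-t) (ev-zip (λ i → _,_) low-t up-s)

-- Agreement with the defining series of cosine and sine

nat-* : ∀ m n → nat (m ℕ.* n) ≡ nat m ℚ.* nat n
nat-* zero    n = sym (ℚ.*-zeroˡ (nat n))
nat-* (suc m) n = begin
  nat (n ℕ.+ m ℕ.* n)          ≡⟨ nat-+ n (m ℕ.* n) ⟩
  nat n ℚ.+ nat (m ℕ.* n)      ≡⟨ cong (nat n ℚ.+_) (nat-* m n) ⟩
  nat n ℚ.+ nat m ℚ.* nat n    ≡⟨ QS.solve 2 (λ m n → n :+ m :* n := (con 1ℚ :+ m) :* n) refl (nat m) (nat n) ⟩
  (1ℚ ℚ.+ nat m) ℚ.* nat n     ∎
  where open ≡-Reasoning

seq-^ : ∀ x d i → seq (x D.^ d) i ≡ nat (d !) ℚ.* T d (seq x i)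
seq-^ x zero    i = refl
seq-^ x (suc d) i = begin
  q ℚ.* seq (x D.^ d) i                                ≡⟨ cong (q ℚ.*_) (seq-^ x d i) ⟩
  q ℚ.* (nat (d !) ℚ.* T d q)                          ≡⟨ QS.solve 3 (λ q f t → q :* (f :* t) := f :* (q :* t)) refl q (nat (d !)) (T d q) ⟩
  nat (d !) ℚ.* (q ℚ.* T d q)                          ≡⟨ cong (nat (d !) ℚ.*_) (sym (nat*T d q)) ⟩
  nat (d !) ℚ.* (nat (suc d) ℚ.* T (suc d) q)          ≡⟨ QS.solve 3 (λ f n t → f :* (n :* t) := n :* f :* t) refl (nat (d !)) (nat (suc d)) (T (suc d) q) ⟩
  nat (suc d) ℚ.* nat (d !) ℚ.* T (suc d) q            ≡⟨ cong (ℚ._* T (suc d) q) (sym (nat-* (suc d) (d !))) ⟩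
  nat (suc d ℕ.* d !) ℚ.* T (suc d) q                  ∎
  where
  open ≡-Reasoning
  q = seq x i

/-*-nat′ : ∀ i n .{{_ : ℕ.NonZero n}} → i ℚ./ n ℚ.* nat n ≡ i ℚ./ 1
/-*-nat′ i (suc n) = /-*-nat i n

neg-/1 : ∀ i → (ℤ.- i) ℚ./ 1 ≡ ℚ.- (i ℚ./ 1)
neg-/1 (ℤ.+ zero)  = refl
neg-/1 (ℤ.+ suc n) = refl
neg-/1 ℤ.-[1+ n ]  = sym (neg-involutive (ℤ.+ suc n ℚ./ 1))
  where
  neg-involutive : ∀ p → ℚ.- (ℚ.- p) ≡ p
  neg-involutive = QS.solve 1 (λ p → :- (:- p) := p) refl

c-even : ∀ k → c (2 ℕ.* k) ≡ (ℤ.-1ℤ ℤ.^ k) ℚ./ 1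
c-even zero    = refl
c-even (suc k) = trans (cong c (ℕ.*-suc 2 k)) (trans (cong ℚ.-_ (c-even k))
  (trans (sym (neg-/1 (ℤ.-1ℤ ℤ.^ k))) (cong (ℚ._/ 1) (sym (ℤ.-1*i≡-i (ℤ.-1ℤ ℤ.^ k))))))

s-even : ∀ k → s (2 ℕ.* k) ≡ 0ℚ
s-even zero    = refl
s-even (suc k) = trans (cong s (ℕ.*-suc 2 k)) (cong ℚ.-_ (s-even k))

-- Serves both series: d is 2k for cosine and 2k + 1 for sine, whose coefficient `s (suc (2 * k))`
-- is `c (2 * k)` by definition.
signedTerm : ∀ k d x i → signedInverseFactorial k d ℚ.* seq (x D.^ d) i ≡ c (2 ℕ.* k) ℚ.* T d (seq x i)
signedTerm k d x i = begin
  r ℚ.* seq (x D.^ d) i                          ≡⟨ cong (r ℚ.*_) (seq-^ x d i) ⟩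
  r ℚ.* (nat (d !) ℚ.* T d (seq x i))            ≡⟨ sym (ℚ.*-assoc r (nat (d !)) (T d (seq x i))) ⟩
  r ℚ.* nat (d !) ℚ.* T d (seq x i)              ≡⟨ cong (ℚ._* T d (seq x i)) (/-*-nat′ (ℤ.-1ℤ ℤ.^ k) (d !) {{d ℕ.!≢0}}) ⟩
  (ℤ.-1ℤ ℤ.^ k) ℚ./ 1 ℚ.* T d (seq x i)          ≡⟨ cong (ℚ._* T d (seq x i)) (sym (c-even k)) ⟩
  c (2 ℕ.* k) ℚ.* T d (seq x i)                  ∎
  where
  open ≡-Reasoning
  r = signedInverseFactorial k d

partialSum-pairs : ∀ (f : ℕ → ℝ) (g : ℕ → ℚ) i →
  (∀ k → seq (f k) i ≡ g (2 ℕ.* k) ℚ.+ g (suc (2 ℕ.* k))) →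
  ∀ n → seq (partialSum f n) i ≡ sum g (2 ℕ.* n)
partialSum-pairs f g i eq zero    = refl
partialSum-pairs f g i eq (suc n) = begin
  seq (partialSum f n) i ℚ.+ seq (f n) i
    ≡⟨ cong₂ ℚ._+_ (partialSum-pairs f g i eq n) (eq n) ⟩
  sum g (2 ℕ.* n) ℚ.+ (g (2 ℕ.* n) ℚ.+ g (suc (2 ℕ.* n)))
    ≡⟨ sym (ℚ.+-assoc (sum g (2 ℕ.* n)) (g (2 ℕ.* n)) (g (suc (2 ℕ.* n)))) ⟩
  sum g (suc (suc (2 ℕ.* n)))
    ≡⟨ cong (sum g) (sym (ℕ.*-suc 2 n)) ⟩
  sum g (2 ℕ.* suc n) ∎
  where open ≡-Reasoning

cosTerm-pairs : ∀ x i k → seq (cosTerm x k) i ≡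
  c (2 ℕ.* k) ℚ.* T (2 ℕ.* k) (seq x i) ℚ.+ c (suc (2 ℕ.* k)) ℚ.* T (suc (2 ℕ.* k)) (seq x i)
cosTerm-pairs x i k = trans (signedTerm k (2 ℕ.* k) x i) (sym (begin
  u ℚ.+ ℚ.- s (2 ℕ.* k) ℚ.* t     ≡⟨ cong (λ z → u ℚ.+ ℚ.- z ℚ.* t) (s-even k) ⟩
  u ℚ.+ ℚ.- 0ℚ ℚ.* t              ≡⟨ QS.solve 2 (λ u t → u :+ (:- con 0ℚ) :* t := u) refl u t ⟩
  u                               ∎))
  where
  open ≡-Reasoning
  u = c (2 ℕ.* k) ℚ.* T (2 ℕ.* k) (seq x i)
  t = T (suc (2 ℕ.* k)) (seq x i)

sinTerm-pairs : ∀ x i k → seq (sinTerm x k) i ≡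
  s (2 ℕ.* k) ℚ.* T (2 ℕ.* k) (seq x i) ℚ.+ s (suc (2 ℕ.* k)) ℚ.* T (suc (2 ℕ.* k)) (seq x i)
sinTerm-pairs x i k = trans (signedTerm k (suc (2 ℕ.* k)) x i) (sym (begin
  s (2 ℕ.* k) ℚ.* t ℚ.+ u         ≡⟨ cong (λ z → z ℚ.* t ℚ.+ u) (s-even k) ⟩
  0ℚ ℚ.* t ℚ.+ u                  ≡⟨ QS.solve 2 (λ u t → con 0ℚ :* t :+ u := u) refl u t ⟩
  u                               ∎))
  where
  open ≡-Reasoning
  u = c (2 ℕ.* k) ℚ.* T (suc (2 ℕ.* k)) (seq x i)
  t = T (2 ℕ.* k) (seq x i)

opaque
  cosine sine : ℝ → ℝ
  cosine = series c ∣c∣≤1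
  sine   = series s ∣s∣≤1

  seq-cosine : ∀ x i → seq (cosine x) i ≡ wsum c (seq x i) i
  seq-cosine x i = refl

  seq-sine : ∀ x i → seq (sine x) i ≡ wsum s (seq x i) i
  seq-sine x i = refl

  cosine-cong : ∀ {x y} → x ≃ y → cosine x ≃ cosine y
  cosine-cong = series-cong c ∣c∣≤1

  sine-cong : ∀ {x y} → x ≃ y → sine x ≃ sine y
  sine-cong = series-cong s ∣s∣≤1

  Cos-cosine : ∀ x → Cos x (cosine x)
  Cos-cosine x = series-hasSum c ∣c∣≤1 x (cosTerm x)
    (λ n i → partialSum-pairs (cosTerm x) (λ k → c k ℚ.* T k (seq x i)) i (cosTerm-pairs x i) n)

  Sin-sine : ∀ x → Sin x (sine x)
  Sin-sine x = series-hasSum s ∣s∣≤1 x (sinTerm x)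
    (λ n i → partialSum-pairs (sinTerm x) (λ k → s k ℚ.* T k (seq x i)) i (sinTerm-pairs x i) n)

Cos⇒≃ : ∀ {x u} → Cos x u → cosine x ≃ u
Cos⇒≃ {x} = HasSum-unique {cosTerm x} (Cos-cosine x)

≃⇒Cos : ∀ {x u} → cosine x ≃ u → Cos x u
≃⇒Cos {x} eq = HasSum-cong {cosTerm x} eq (Cos-cosine x)

Sin⇒≃ : ∀ {x u} → Sin x u → sine x ≃ u
Sin⇒≃ {x} = HasSum-unique {sinTerm x} (Sin-sine x)

≃⇒Sin : ∀ {x u} → sine x ≃ u → Sin x u
≃⇒Sin {x} eq = HasSum-cong {sinTerm x} eq (Sin-sine x)

-- Addition formulas and their consequences

cosine-+ : ∀ x y → cosine (x + y) ≃ cosine x * cosine y - sine x * sine y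
cosine-+ x y =
  let B , 0≤B , bounded = commonBound x y
      K , 0≤K , T≤ = T-majorant B 0≤B
  in ≃-sym (mk λ ε 0<ε →
    -- At index i all the series are cut after i terms, so the discrepancy is at most
    -- `addition-error` times 2⁻ⁱ.
    let N , small = K*half-small (addition-error B K T≤ 0≤K) ε 0<ε
    in ev-zip (λ i (x≤ , y≤) N≤i → subst (λ z → ∣ z ∣ ℚ.≤ ε) (sym (eq i))
         (ℚ.≤-trans (∣cos-+∣≤ B K T≤ 0≤K (seq x i) (seq y i) x≤ y≤ i) (small i N≤i)))
       bounded (N , λ i N≤i → N≤i))
  where
  eq : ∀ i → seq (cosine x * cosine y - sine x * sine y) i ℚ.- seq (cosine (x + y)) i ≡
    (wsum c (seq x i) i ℚ.* wsum c (seq y i) i ℚ.- wsum s (seq x i) i ℚ.* wsum s (seq y i) i) ℚ.- wsum c (seq x i ℚ.+ seq y i) i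
  eq i rewrite seq-+ (cosine x * cosine y) (- (sine x * sine y)) i | seq-neg (sine x * sine y) i
    | seq-* (cosine x) (cosine y) i | seq-* (sine x) (sine y) i
    | seq-cosine (x + y) i | seq-+ x y i | seq-cosine x i | seq-cosine y i | seq-sine x i | seq-sine y i = refl

sine-+ : ∀ x y → sine (x + y) ≃ sine x * cosine y + cosine x * sine y
sine-+ x y =
  let B , 0≤B , bounded = commonBound x y
      K , 0≤K , T≤ = T-majorant B 0≤B
  in ≃-sym (mk λ ε 0<ε →
    let N , small = K*half-small (addition-error B K T≤ 0≤K) ε 0<ε
    in ev-zip (λ i (x≤ , y≤) N≤i → subst (λ z → ∣ z ∣ ℚ.≤ ε) (sym (eq i))
         (ℚ.≤-trans (∣sin-+∣≤ B K T≤ 0≤K (seq x i) (seq y i) x≤ y≤ i) (small i N≤i)))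
       bounded (N , λ i N≤i → N≤i))
  where
  eq : ∀ i → seq (sine x * cosine y + cosine x * sine y) i ℚ.- seq (sine (x + y)) i ≡
    (wsum s (seq x i) i ℚ.* wsum c (seq y i) i ℚ.+ wsum c (seq x i) i ℚ.* wsum s (seq y i) i) ℚ.- wsum s (seq x i ℚ.+ seq y i) i
  eq i rewrite seq-+ (sine x * cosine y) (cosine x * sine y) i
    | seq-* (sine x) (cosine y) i | seq-* (cosine x) (sine y) i
    | seq-sine (x + y) i | seq-+ x y i | seq-cosine x i | seq-cosine y i | seq-sine x i | seq-sine y i = refl

cosine-neg : ∀ x → cosine (- x) ≃ cosine x
cosine-neg x = pointwise λ i → trans (seq-cosine (- x) i) (trans (cong (λ q → wsum c q i) (seq-neg x i))
  (trans (wsum-c-neg (seq x i) i) (sym (seq-cosine x i))))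

sine-neg : ∀ x → sine (- x) ≃ - sine x
sine-neg x = pointwise λ i → trans (seq-sine (- x) i) (trans (cong (λ q → wsum s q i) (seq-neg x i))
  (trans (wsum-s-neg (seq x i) i) (trans (cong ℚ.-_ (sym (seq-sine x i))) (sym (seq-neg (sine x) i)))))

cosine-0 : cosine 0ℝ ≃ 1ℝ
cosine-0 = mk λ ε 0<ε → 1 , λ where
    -- At index 0 the truncated sum is empty, hence the threshold 1.
    (suc i) _ → subst (λ z → ∣ z ∣ ℚ.≤ ε)
      (trans (sym (ℚ.+-inverseʳ 1ℚ)) (cong (ℚ._- 1ℚ) (sym (trans (seq-cosine 0ℝ (suc i)) (wsum-c-0 i))))) (ℚ.<⇒≤ 0<ε)
  where
  wsum-c-0 : ∀ n → wsum c 0ℚ (suc n) ≡ 1ℚ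
  wsum-c-0 zero    = refl
  wsum-c-0 (suc n) = begin
    wsum c 0ℚ (suc n) ℚ.+ c (suc n) ℚ.* (0ℚ ℚ.* T n 0ℚ ℚ.* recip n)
      ≡⟨ cong₂ ℚ._+_ (wsum-c-0 n) (QS.solve 3 (λ c t r → c :* (con 0ℚ :* t :* r) := con 0ℚ) refl (c (suc n)) (T n 0ℚ) (recip n)) ⟩
    1ℚ ℚ.+ 0ℚ
      ≡⟨⟩
    1ℚ ∎
    where open ≡-Reasoning

-- The addition formula for x + (-x), together with the parities of cosine and sine.
cos²+sin²≃1 : ∀ x → cosine x * cosine x + sine x * sine x ≃ 1ℝ
cos²+sin²≃1 x = begin
  cosine x * cosine x + sine x * sine x
    ≈⟨ R.solve 2 (λ c s → c R.:* c R.:+ s R.:* s R.:= c R.:* c R.:- s R.:* (R.:- s)) ≃-refl (cosine x) (sine x) ⟩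
  cosine x * cosine x - sine x * - sine x
    ≈⟨ +-cong (*-cong ≃-refl (≃-sym (cosine-neg x))) (-‿cong (*-cong ≃-refl (≃-sym (sine-neg x)))) ⟩
  cosine x * cosine (- x) - sine x * sine (- x)
    ≈⟨ cosine-+ x (- x) ⟨
  cosine (x + - x)
    ≈⟨ cosine-cong (R.solve 1 (λ x → x R.:+ (R.:- x) R.:= R.con 0ℚ) ≃-refl x) ⟩
  cosine 0ℝ
    ≈⟨ cosine-0 ⟩
  1ℝ ∎
  where open ≃-Reasoning

cosine-difference : ∀ x y → cosine (x - y) ≃ cosine x * cosine y + sine x * sine y
cosine-difference x y = begin
  cosine (x - y)
    ≈⟨ cosine-+ x (- y) ⟩
  cosine x * cosine (- y) - sine x * sine (- y)
    ≈⟨ +-cong (*-cong ≃-refl (cosine-neg y)) (-‿cong (*-cong ≃-refl (sine-neg y))) ⟩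
  cosine x * cosine y - sine x * - sine y
    ≈⟨ R.solve 4 (λ a b s t → a R.:* b R.:- s R.:* (R.:- t) R.:= a R.:* b R.:+ s R.:* t) ≃-refl (cosine x) (cosine y) (sine x) (sine y) ⟩
  cosine x * cosine y + sine x * sine y ∎
  where open ≃-Reasoning

sine-difference : ∀ x y → sine (x - y) ≃ sine x * cosine y - cosine x * sine y
sine-difference x y = begin
  sine (x - y)
    ≈⟨ sine-+ x (- y) ⟩
  sine x * cosine (- y) + cosine x * sine (- y)
    ≈⟨ +-cong (*-cong ≃-refl (cosine-neg y)) (*-cong ≃-refl (sine-neg y)) ⟩
  sine x * cosine y + cosine x * - sine y
    ≈⟨ R.solve 4 (λ a b s t → s R.:* b R.:+ a R.:* (R.:- t) R.:= s R.:* b R.:- a R.:* t) ≃-refl (cosine x) (cosine y) (sine x) (sine y) ⟩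
  sine x * cosine y - cosine x * sine y ∎
  where open ≃-Reasoning

-- From index 3 on, `sin-small` bounds the truncated sum below by half its argument, hence by ε/2.
-- The upper bound is put on the approximants so that the lemma also applies to π, in `1≤π`.
sine-small : ∀ {x} → Pos x → Eventually (λ i → seq x i ℚ.≤ 1ℚ) → Pos (sine x)
sine-small {x} (pos {ε} 0<ε ε≤) x≤1 = pos (0<* (ℚ.positive⁻¹ ½) 0<ε)
  (ev-zip bound (3 , λ i 3≤i → 3≤i) (ev-zip (λ i → _,_) ε≤ x≤1))
  where
  bound : ∀ i → 3 ℕ.≤ i → ε ℚ.≤ seq x i × seq x i ℚ.≤ 1ℚ → ½ ℚ.* ε ℚ.≤ seq (sine x) i
  bound (suc (suc (suc i))) _ (ε≤x , x≤1) = subst (½ ℚ.* ε ℚ.≤_) (sym (seq-sine x (3 ℕ.+ i)))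
    (ℚ.≤-trans (*-monoˡ 0≤½ ε≤x) (sin-small (seq x (3 ℕ.+ i)) (ℚ.≤-trans (ℚ.<⇒≤ 0<ε) ε≤x) x≤1 i))
  bound (suc zero)       (ℕ.s≤s ())
  bound (suc (suc zero)) (ℕ.s≤s (ℕ.s≤s ()))

cosine-small : ∀ {q} → 0ℚ ℚ.≤ q → q ℚ.≤ 1ℚ → NonNeg (cosine (fromℚ q))
cosine-small {q} 0≤q q≤1 = nonNeg (2 , bound)
  where
  bound : ∀ i → 2 ℕ.≤ i → 0ℚ ℚ.≤ seq (cosine (fromℚ q)) i
  bound (suc (suc i)) _ = subst (0ℚ ℚ.≤_) (sym (seq-cosine (fromℚ q) (2 ℕ.+ i))) (cos-small q 0≤q q≤1 i)
  bound (suc zero) (ℕ.s≤s ())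

-- Injectivity of cosine on [0, π]

δ≤-sum : ∀ δ p q y ε → ε ≡ (δ ℚ.+ δ) ℚ.+ (δ ℚ.+ δ) → ℚ.- (2ℚ ℚ.* δ) ℚ.≤ p → ∣ p ℚ.- q ∣ ℚ.≤ δ → ε ℚ.≤ y → δ ℚ.≤ q ℚ.+ y
δ≤-sum δ p q y ε eq -2δ≤p d≤δ ε≤y = let open ℚ.≤-Reasoning in begin
  δ
    ≡⟨ QS.solve 1 (λ d → d := :- (con 2ℚ :* d) :- d :+ ((d :+ d) :+ (d :+ d))) refl δ ⟩
  ℚ.- (2ℚ ℚ.* δ) ℚ.- δ ℚ.+ ((δ ℚ.+ δ) ℚ.+ (δ ℚ.+ δ))
    ≡⟨ cong (ℚ.- (2ℚ ℚ.* δ) ℚ.- δ ℚ.+_) (sym eq) ⟩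
  ℚ.- (2ℚ ℚ.* δ) ℚ.- δ ℚ.+ ε
    ≤⟨ ℚ.+-mono-≤ (ℚ.+-mono-≤ -2δ≤p (ℚ.neg-antimono-≤ {p ℚ.- q} {δ} (ℚ.≤-trans (p≤∣p∣ (p ℚ.- q)) d≤δ))) ε≤y ⟩
  p ℚ.- (p ℚ.- q) ℚ.+ y
    ≡⟨ QS.solve 3 (λ p q y → p :- (p :- q) :+ y := q :+ y) refl p q y ⟩
  q ℚ.+ y ∎

-- That x is not negative is known only as a negation. With 4δ = ε, compare one late approximant of
-- x with -2δ. If it is smaller, -x is positive. Otherwise later approximants are at least -3δ, and
-- adding y ≥ 4δ leaves δ.
¬Pos-+ : ∀ {x y} → ¬ Pos (- x) → Pos y → Pos (x + y)
¬Pos-+ {x} {y} ¬x<0 (pos {ε} 0<ε ε≤) =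
  let η , 0<η , η+η≡ε = halve ε 0<ε
      δ , 0<δ , δ+δ≡η = halve η 0<η
      N , c = cauchy x δ 0<δ
      4δ≡ε : ε ≡ (δ ℚ.+ δ) ℚ.+ (δ ℚ.+ δ)
      4δ≡ε = trans (sym η+η≡ε) (cong (λ z → z ℚ.+ z) (sym δ+δ≡η))
  in case ℚ.- (2ℚ ℚ.* δ) ℚ.≤? seq x N of λ where
  (yes large) → pos 0<δ (ev-zip
    (λ i N≤i ε≤y → subst (δ ℚ.≤_) (sym (seq-+ x y i))
      (δ≤-sum δ (seq x N) (seq x i) (seq y i) ε 4δ≡ε large (c N i ℕ.≤-refl N≤i) ε≤y))
    (N , λ i N≤i → N≤i) ε≤)
  (no small) → ⊥-elim (¬x<0 (pos 0<δ (N , λ i N≤i → subst (δ ℚ.≤_) (sym (seq-neg x i))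
    (δ≤-perturbed (2ℚ ℚ.* δ) δ (ℚ.- seq x N) (ℚ.- seq x i)
      (QS.solve 1 (λ d → d :+ d := con 2ℚ :* d) refl δ)
      (ℚ.≤-trans (ℚ.≤-reflexive (QS.solve 1 (λ d → d := :- (:- d)) refl (2ℚ ℚ.* δ)))
        (ℚ.neg-antimono-≤ {seq x N} {ℚ.- (2ℚ ℚ.* δ)} (ℚ.<⇒≤ (ℚ.≰⇒> small))))
      (subst (ℚ._≤ δ) (cong ∣_∣ (QS.solve 2 (λ a b → b :- a := (:- a) :- (:- b)) refl (seq x N) (seq x i)))
        (c i N N≤i ℕ.≤-refl))))))

½ℝ : ℝ
½ℝ = fromℚ ½

Pos-½* : ∀ {x} → Pos x → Pos (½ℝ * x)
Pos-½* = Pos-* (Pos-fromℚ (ℚ.positive⁻¹ ½))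

cosine-prosthaphaeresis : ∀ p d → cosine (p - d) - cosine (p + d) ≃ fromℚ 2ℚ * (sine p * sine d)
cosine-prosthaphaeresis p d = begin
  cosine (p - d) - cosine (p + d)
    ≈⟨ +-cong (cosine-difference p d) (-‿cong (cosine-+ p d)) ⟩
  (cosine p * cosine d + sine p * sine d) - (cosine p * cosine d - sine p * sine d)
    ≈⟨ R.solve 2 (λ c s → (c R.:+ s) R.:- (c R.:- s) R.:= R.con 2ℚ R.:* s) ≃-refl (cosine p * cosine d) (sine p * sine d) ⟩
  fromℚ 2ℚ * (sine p * sine d) ∎
  where open ≃-Reasoning

module _ (π : ℝ) (isPi : IsPi π) where

  0<π : Pos π
  0<π = 0<⇒Pos (proj₁ isPi)

  sine-π : sine π ≃ 0ℝ
  sine-π = Sin⇒≃ {π} (proj₁ (proj₂ isPi))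

  sine≄0 : ∀ {x} → Pos x → Pos (π - x) → ¬ (sine x ≃ 0ℝ)
  sine≄0 {x} 0<x x<π sx≃0 = proj₂ (proj₂ isPi) x (Pos⇒0< 0<x) (Pos⇒< x<π) (≃⇒Sin {x} sx≃0)

  cosine-distinct : ∀ {u v} → ¬ Pos (- u) → Pos (v - u) → ¬ Pos (- (π - v)) → ¬ (cosine u ≃ cosine v)
  cosine-distinct {u} {v} 0≤u u<v v≤π cu≃cv = sine≄0 0<d d<π (*-cancel-0 (sine≄0 0<p p<π)
    (*-cancel-0 2≄0 (begin
      fromℚ 2ℚ * (sine p * sine d)       ≈⟨ cosine-prosthaphaeresis p d ⟨
      cosine (p - d) - cosine (p + d)    ≈⟨ +-cong (cosine-cong p-d≃u) (-‿cong (cosine-cong p+d≃v)) ⟩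
      cosine u - cosine v                ≈⟨ ≃⇒-‿≃0 cu≃cv ⟩
      0ℝ                                 ∎)))
    where
    open ≃-Reasoning
    p d : ℝ
    p = ½ℝ * (u + v)
    d = ½ℝ * (v - u)
    p-d≃u : p - d ≃ u
    p-d≃u = R.solve 2 (λ u v → R.con ½ R.:* (u R.:+ v) R.:- R.con ½ R.:* (v R.:- u) R.:= u) ≃-refl u v
    p+d≃v : p + d ≃ v
    p+d≃v = R.solve 2 (λ u v → R.con ½ R.:* (u R.:+ v) R.:+ R.con ½ R.:* (v R.:- u) R.:= v) ≃-refl u v
    2≄0 : ¬ (fromℚ 2ℚ ≃ 0ℝ)
    2≄0 eq = ¬Pos-0 eq (Pos-fromℚ (0<nat 1))
    -- Twice each margin below is a positive number, v - u or π, plus copies of u and π - v, which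
    -- are known only not to be negative. So p and d lie strictly inside (0, π) even if u = 0 or v =
    -- π.
    0<d : Pos d
    0<d = Pos-½* u<v
    d<π : Pos (π - d)
    d<π = Pos-cong (R.solve 3 (λ u v π → R.con ½ R.:* (u R.:+ ((π R.:- v) R.:+ π)) R.:= π R.:- R.con ½ R.:* (v R.:- u)) ≃-refl u v π)
      (Pos-½* (¬Pos-+ 0≤u (¬Pos-+ v≤π 0<π)))
    0<p : Pos p
    0<p = Pos-cong (R.solve 2 (λ u v → R.con ½ R.:* (u R.:+ (u R.:+ (v R.:- u))) R.:= R.con ½ R.:* (u R.:+ v)) ≃-refl u v)
      (Pos-½* (¬Pos-+ 0≤u (¬Pos-+ 0≤u u<v)))
    p<π : Pos (π - p)
    p<π = Pos-cong (R.solve 3 (λ u v π → R.con ½ R.:* ((π R.:- v) R.:+ ((π R.:- v) R.:+ (v R.:- u))) R.:= π R.:- R.con ½ R.:* (u R.:+ v)) ≃-refl u v π)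
      (Pos-½* (¬Pos-+ v≤π (¬Pos-+ v≤π u<v)))

  cosine-injective : ∀ {u v} → 0ℝ ≤ u → u ≤ π → 0ℝ ≤ v → v ≤ π → cosine u ≃ cosine v → u ≃ v
  cosine-injective {u} {v} 0≤u u≤π 0≤v v≤π cu≃cv = ≃-stable
    (λ v<u → cosine-distinct (0≤⇒¬Pos- 0≤v) v<u (below u≤π) (≃-sym cu≃cv))
    (λ u<v → cosine-distinct (0≤⇒¬Pos- 0≤u) u<v (below v≤π) cu≃cv)
    where
    below : ∀ {x} → x ≤ π → ¬ Pos (- (π - x))
    below {x} x≤π p = ≤⇒¬Pos x≤π (Pos-cong (R.solve 2 (λ x π → R.:- (π R.:- x) R.:= x R.:- π) ≃-refl x π) p)

  1≤π : ¬ Pos (- (π - 1ℝ))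
  1≤π p = ¬Pos-0 sine-π (sine-small 0<π (π≤1 (Pos⇒< (Pos-cong (R.solve 1 (λ π → R.:- (π R.:- R.con 1ℚ) R.:= R.con 1ℚ R.:- π) ≃-refl π) p))))
    where
    π≤1 : π < 1ℝ → Eventually (λ i → seq π i ℚ.≤ 1ℚ)
    π≤1 (ε , 0<ε , le) = ev-map (λ i → ℚ.≤-trans (≤-by ε (ℚ.<⇒≤ 0<ε) refl)) le

  fromℚ<π : ∀ {q} → q ℚ.< 1ℚ → Pos (π - fromℚ q)
  fromℚ<π {q} q<1 = Pos-cong
    (begin
      (π - 1ℝ) + fromℚ (1ℚ ℚ.- q)       ≈⟨ +-cong ≃-refl (≃-trans (fromℚ-+ 1ℚ (ℚ.- q)) (+-cong ≃-refl (fromℚ-neg q))) ⟩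
      (π - 1ℝ) + (1ℝ - fromℚ q)         ≈⟨ R.solve 2 (λ π q → (π R.:- R.con 1ℚ) R.:+ (R.con 1ℚ R.:- q) R.:= π R.:- q) ≃-refl π (fromℚ q) ⟩
      π - fromℚ q                       ∎)
    (¬Pos-+ 1≤π (Pos-fromℚ (0<q-p q<1)))
    where open ≃-Reasoning

-- The configuration

·≡ : ∀ a b c d → (a , b) · (c , d) ≡ a * c + b * d
·≡ a b c d = trans (D+≡+ (a D.* c) (b D.* d)) (cong₂ _+_ (D*≡* a c) (D*≡* b d))

sub≡ : ∀ a v → a -ₚ v ≡ ((proj₁ a - proj₁ v) , (proj₂ a - proj₂ v))
sub≡ (a₁ , a₂) (v₁ , v₂) = cong₂ _,_ (D-≡- a₁ v₁) (D-≡- a₂ v₂)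

dot : (a v b : Point) → ℝ
dot (a₁ , a₂) (v₁ , v₂) (b₁ , b₂) = (a₁ - v₁) * (b₁ - v₁) + (a₂ - v₂) * (b₂ - v₂)

·-cong : ∀ {u u′ w w′} → u ≡ u′ → w ≡ w′ → u · w ≡ proj₁ u′ * proj₁ w′ + proj₂ u′ * proj₂ w′
·-cong {u′ = a , b} {w′ = c , d} refl refl = ·≡ a b c d

·≡dot : ∀ a v b → (a -ₚ v) · (b -ₚ v) ≡ dot a v b
·≡dot a v b = ·-cong {a -ₚ v} {(proj₁ a - proj₁ v) , (proj₂ a - proj₂ v)} {b -ₚ v} {(proj₁ b - proj₁ v) , (proj₂ b - proj₂ v)} (sub≡ a v) (sub≡ b v)

-- Carries an equation from the original operations to their opaque copies.
≈⇒≃ : ∀ x x′ y y′ → x ≡ x′ → y ≡ y′ → x ≈ y → x′ ≃ y′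
≈⇒≃ x x′ y y′ refl refl = mk

≃⇒≈ : ∀ x x′ y y′ → x ≡ x′ → y ≡ y′ → x′ ≃ y′ → x ≈ y
≃⇒≈ x x′ y y′ refl refl = un

norm⇒ : ∀ {a v r} → IsNorm (a -ₚ v) r → 0ℝ ≤ r × r * r ≃ dot a v a
norm⇒ {a} {v} {r} (0≤r , eq) = 0≤r , ≈⇒≃ (r D.* r) (r * r) ((a -ₚ v) · (a -ₚ v)) (dot a v a) (D*≡* r r) (·≡dot a v a) eq

⇒norm : ∀ {a v r} → 0ℝ ≤ r → r * r ≃ dot a v a → IsNorm (a -ₚ v) r
⇒norm {a} {v} {r} 0≤r eq = 0≤r ,
  ≃⇒≈ (r D.* r) (r * r) ((a -ₚ v) · (a -ₚ v)) (dot a v a) (D*≡* r r) (·≡dot a v a) eq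

rsc≡ : ∀ r s c → (r D.* s) D.* c ≡ (r * s) * c
rsc≡ r s c = trans (D*≡* (r D.* s) c) (cong (_* c) (D*≡* r s))

-- The norms and the cosine in `IsAngle` are existential. Uniqueness of square roots replaces the
-- norms by t and u, whose positive product can be cancelled.
angle⇒cosine : ∀ {π a v b θ t u γ} → IsAngle π a v b θ →
  Pos t → t * t ≃ dot a v a → Pos u → u * u ≃ dot b v b → dot a v b ≃ (t * u) * γ → cosine θ ≃ γ
angle⇒cosine {a = a} {v} {b} {θ} {t} {u} {γ} (_ , _ , r , s , c , norm-r , norm-s , cos-θ , eq) 0<t t² 0<u u² tuγ =
  let 0≤r , r² = norm⇒ {a} {v} {r} norm-r
      0≤s , s² = norm⇒ {b} {v} {s} norm-s
      r≃t = sqrt-unique 0≤r 0<t (≃-trans r² (≃-sym t²))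
      s≃u = sqrt-unique 0≤s 0<u (≃-trans s² (≃-sym u²))
  in *-cancel (λ tu≃0 → ¬Pos-0 tu≃0 (Pos-* 0<t 0<u)) (begin
    (t * u) * cosine θ   ≈⟨ *-cong (*-cong (≃-sym r≃t) (≃-sym s≃u)) (Cos⇒≃ {θ} cos-θ) ⟩
    (r * s) * c          ≈⟨ ≈⇒≃ ((a -ₚ v) · (b -ₚ v)) (dot a v b) ((r D.* s) D.* c) ((r * s) * c) (·≡dot a v b) (rsc≡ r s c) eq ⟨
    dot a v b            ≈⟨ tuγ ⟩
    (t * u) * γ          ∎)
  where open ≃-Reasoning

cosine⇒angle : ∀ {π a v b θ t u γ} → 0ℝ ≤ θ → θ ≤ π → 
  0ℝ ≤ t → t * t ≃ dot a v a → 0ℝ ≤ u → u * u ≃ dot b v b → dot a v b ≃ (t * u) * γ → cosine θ ≃ γ →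
  IsAngle π a v b θ
cosine⇒angle {a = a} {v} {b} {θ} {t} {u} {γ} 0≤θ θ≤π 0≤t t² 0≤u u² tuγ cos-θ =
  0≤θ , θ≤π , t , u , γ , ⇒norm {a} {v} {t} 0≤t t² , ⇒norm {b} {v} {u} 0≤u u² , ≃⇒Cos {θ} cos-θ ,
  ≃⇒≈ ((a -ₚ v) · (b -ₚ v)) (dot a v b) ((t D.* u) D.* γ) ((t * u) * γ) (·≡dot a v b) (rsc≡ t u γ) tuγ

<⇒≤ : ∀ x y → x < y → x ≤ y
<⇒≤ x y x<y y<x = ¬Pos-0 (R.solve 2 (λ x y → (y R.:- x) R.:+ (x R.:- y) R.:= R.con 0ℚ) ≃-refl x y)
  (Pos-sum (<⇒Pos x<y) (<⇒Pos y<x))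

-- The vertex p = (-c w, 0), where w = 1/s, sees (0, 1) at distance w and
-- (x, 0) at distance x + c w.
module _ {c s w : ℝ} (sw : s * w ≃ 1ℝ) (cs : c * c + s * s ≃ 1ℝ) where
  open ≃-Reasoning

  apex-distance : w * w ≃ (- (c * w)) * (- (c * w)) + 1ℝ
  apex-distance = begin
    w * w                                        ≈⟨ R.solve 1 (λ w → w R.:* w R.:= R.con 1ℚ R.:* (w R.:* w)) ≃-refl w ⟩
    1ℝ * (w * w)                                 ≈⟨ *-cong cs ≃-refl ⟨
    (c * c + s * s) * (w * w)                    ≈⟨ R.solve 3 (λ c s w → (c R.:* c R.:+ s R.:* s) R.:* (w R.:* w) R.:= (R.:- (c R.:* w)) R.:* (R.:- (c R.:* w)) R.:+ (s R.:* w) R.:* (s R.:* w)) ≃-refl c s w ⟩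
    (- (c * w)) * (- (c * w)) + (s * w) * (s * w) ≈⟨ +-cong ≃-refl (*-cong sw sw) ⟩
    (- (c * w)) * (- (c * w)) + 1ℝ * 1ℝ          ≈⟨ +-cong ≃-refl (*-identityˡ 1ℝ) ⟩
    (- (c * w)) * (- (c * w)) + 1ℝ               ∎

-- Writing 1 as (s w)(s′ w′) makes w w′ a common factor. What remains is the cosine of the
-- difference of the two angles.
apex-dot : ∀ {c s w c′ s′ w′} → s * w ≃ 1ℝ → s′ * w′ ≃ 1ℝ →
  (- (c * w)) * (- (c′ * w′)) + 1ℝ ≃ (w * w′) * (c * c′ + s * s′)
apex-dot {c} {s} {w} {c′} {s′} {w′} sw s′w′ = begin
  (- (c * w)) * (- (c′ * w′)) + 1ℝ
    ≈⟨ +-cong ≃-refl (≃-trans (*-cong sw s′w′) (*-identityˡ 1ℝ)) ⟨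
  (- (c * w)) * (- (c′ * w′)) + (s * w) * (s′ * w′)
    ≈⟨ R.solve 6 (λ c s w c′ s′ w′ → (R.:- (c R.:* w)) R.:* (R.:- (c′ R.:* w′)) R.:+ (s R.:* w) R.:* (s′ R.:* w′)
                     R.:= (w R.:* w′) R.:* (c R.:* c′ R.:+ s R.:* s′)) ≃-refl c s w c′ s′ w′ ⟩
  (w * w′) * (c * c′ + s * s′) ∎
  where open ≃-Reasoning

nat-mono-< : ∀ {a b} → a ℕ.< b → nat a ℚ.< nat b
nat-mono-< {a} a<b = ℚ.<-≤-trans
  (ℚ.≤-<-trans (ℚ.≤-reflexive (sym (ℚ.+-identityˡ (nat a)))) (ℚ.+-monoˡ-< (nat a) (ℚ.positive⁻¹ 1ℚ)))
  (nat-mono a<b)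

fromℚ-distinct : ∀ {p q} → p ℚ.< q → ¬ (fromℚ p ≃ fromℚ q)
fromℚ-distinct {p} {q} p<q p≃q = ¬Pos-0 (begin
  fromℚ (q ℚ.- p)        ≈⟨ ≃-trans (fromℚ-+ q (ℚ.- p)) (+-cong ≃-refl (fromℚ-neg p)) ⟩
  fromℚ q - fromℚ p      ≈⟨ ≃⇒-‿≃0 (≃-sym p≃q) ⟩
  0ℝ                     ∎) (Pos-fromℚ (0<q-p p<q))
  where open ≃-Reasoning

fromℚ-nat-injective : ∀ {a b} → fromℚ (nat a) ≃ fromℚ (nat b) → a ≡ b
fromℚ-nat-injective {a} {b} eq = case ℕ.<-cmp a b of λ where
  (tri< a<b _ _) → ⊥-elim (fromℚ-distinct (nat-mono-< a<b) eq)
  (tri≈ _ a≡b _) → a≡b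
  (tri> _ _ b<a) → ⊥-elim (fromℚ-distinct (nat-mono-< b<a) (≃-sym eq))

-- The points, their distances and their inner products

module Construction (π : ℝ) (isPi : IsPi π) (m n : ℕ) where

  -- Both shifts count: indices from `Fin m` start at 0, and `recip m` is 1/(m + 1). The multiples
  -- are thus 1, ..., m and stay below 1.
  angle : ℕ → ℚ
  angle k = nat (suc k) ℚ.* recip m

  0<angle : ∀ k → 0ℚ ℚ.< angle k
  0<angle k = 0<* (0<nat k) (0<recip m)

  angle<1 : ∀ {k} → k ℕ.< m → angle k ℚ.< 1ℚ
  angle<1 {k} k<m = subst (angle k ℚ.<_) (nat*recip m)
    (ℚ.*-monoˡ-<-pos (recip m) {{ℚ.positive (0<recip m)}} (nat-mono-< (ℕ.s≤s k<m)))

  θ C S : Fin m → ℝ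
  θ i = fromℚ (angle (toℕ i))
  C i = cosine (θ i)
  S i = sine (θ i)

  0<θ : ∀ i → Pos (θ i)
  0<θ i = Pos-fromℚ (0<angle (toℕ i))

  θ<π : ∀ i → Pos (π - θ i)
  θ<π i = fromℚ<π π isPi (angle<1 (Fin.toℕ<n i))

  0<S : ∀ i → Pos (S i)
  0<S i = sine-small (0<θ i) (always λ _ → ℚ.<⇒≤ (angle<1 (Fin.toℕ<n i)))

  -- Keeps the points of `P` off the positive half of the axis, so that the distances `ℓ` to the
  -- axis points of `Q` are positive.
  0≤C : ∀ i → NonNeg (C i)
  0≤C i = cosine-small (ℚ.<⇒≤ (0<angle (toℕ i))) (ℚ.<⇒≤ (angle<1 (Fin.toℕ<n i)))

  w : Fin m → ℝ
  w i = proj₁ (inverse (0<S i))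

  S*w : ∀ i → S i * w i ≃ 1ℝ
  S*w i = proj₁ (proj₂ (inverse (0<S i)))

  0<w : ∀ i → Pos (w i)
  0<w i = proj₂ (proj₂ (inverse (0<S i)))

  -- If i = j + 1 + k as indices, the multiples differ by k + 1, and this is the multiple with index
  -- k.
  gap : ∀ i j → i ≢ j → ∃[ k ] ((θ i - θ j ≃ θ k) ⊎ (θ j - θ i ≃ θ k))
  gap i j i≢j = case ℕ.<-cmp (toℕ i) (toℕ j) of λ where
      (tri< i<j _ _) → let k , eq = above j i i<j in k , inj₂ eq
      (tri≈ _ i≡j _) → ⊥-elim (i≢j (Fin.toℕ-injective i≡j))
      (tri> _ _ j<i) → let k , eq = above i j j<i in k , inj₁ eq
    where
    above : ∀ i j → toℕ j ℕ.< toℕ i → ∃[ k ] (θ i - θ j ≃ θ k)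
    above i j j<i =
      let k , eq = ℕ.m≤n⇒∃[o]m+o≡n j<i
          k<m = ℕ.≤-<-trans (ℕ.≤-trans (ℕ.m≤n+m k (suc (toℕ j))) (ℕ.≤-reflexive eq)) (Fin.toℕ<n i)
      in fromℕ< k<m , difference (toℕ i) (toℕ j) k (toℕ (fromℕ< k<m)) (sym eq) (Fin.toℕ-fromℕ< k<m)
      where
      difference : ∀ a b k l → a ≡ suc b ℕ.+ k → l ≡ k → fromℚ (angle a) - fromℚ (angle b) ≃ fromℚ (angle l)
      difference a b k l a≡ l≡k = ≃-trans (≃-sym (≃-trans (fromℚ-+ (angle a) (ℚ.- angle b)) (+-cong ≃-refl (fromℚ-neg (angle b)))))
        (pointwise λ _ → trans (cong₂ (λ x y → (1ℚ ℚ.+ x) ℚ.* recip m ℚ.- y) (trans (cong nat a≡) (nat-+ (suc b) k)) refl)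
          (trans (QS.solve 3 (λ b k r → (con 1ℚ :+ (b :+ k)) :* r :- b :* r := (con 1ℚ :+ k) :* r) refl (nat (suc b)) (nat k) (recip m))
            (cong angle (sym l≡k))))

  -- The abscissa is minus the cotangent of `θ i`.
  P : Fin m → Point
  P i = - (C i * w i) , 0ℝ

  -- The size guarantees an axis point besides the apex. That point, together with the apex,
  -- realises every `θ i` and rules out a common line.
  Q : Fin (suc (suc n)) → Point
  Q zero    = 0ℝ , 1ℝ
  Q (suc j) = fromℚ (nat (suc (toℕ j))) , 0ℝ

  ℓ : Fin m → Fin (suc n) → ℝ
  ℓ i j = fromℚ (nat (suc (toℕ j))) + C i * w i

  0<ℓ : ∀ i j → Pos (ℓ i j)
  0<ℓ i j = Pos-+ (Pos-fromℚ (0<nat (toℕ j))) (NonNeg-* (0≤C i) (Pos⇒NonNeg (0<w i)))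

  P-apex : ∀ i → w i * w i ≃ dot (Q zero) (P i) (Q zero)
  P-apex i = ≃-trans (apex-distance (S*w i) (cos²+sin²≃1 (θ i)))
    (R.solve 1 (λ t → (R.:- t) R.:* (R.:- t) R.:+ R.con 1ℚ R.:= (R.con 0ℚ R.:- (R.:- t)) R.:* (R.con 0ℚ R.:- (R.:- t)) R.:+ (R.con 1ℚ R.:- R.con 0ℚ) R.:* (R.con 1ℚ R.:- R.con 0ℚ)) ≃-refl (C i * w i))

  apex-P : ∀ i → w i * w i ≃ dot (P i) (Q zero) (P i)
  apex-P i = ≃-trans (apex-distance (S*w i) (cos²+sin²≃1 (θ i)))
    (R.solve 1 (λ t → (R.:- t) R.:* (R.:- t) R.:+ R.con 1ℚ R.:= (R.:- t R.:- R.con 0ℚ) R.:* (R.:- t R.:- R.con 0ℚ) R.:+ (R.con 0ℚ R.:- R.con 1ℚ) R.:* (R.con 0ℚ R.:- R.con 1ℚ)) ≃-refl (C i * w i))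

  P-line : ∀ i j → ℓ i j * ℓ i j ≃ dot (Q (suc j)) (P i) (Q (suc j))
  P-line i j = R.solve 2 (λ x t → (x R.:+ t) R.:* (x R.:+ t) R.:= (x R.:- (R.:- t)) R.:* (x R.:- (R.:- t)) R.:+ (R.con 0ℚ R.:- R.con 0ℚ) R.:* (R.con 0ℚ R.:- R.con 0ℚ))
    ≃-refl (fromℚ (nat (suc (toℕ j)))) (C i * w i)

  line-P : ∀ i j → ℓ i j * ℓ i j ≃ dot (P i) (Q (suc j)) (P i)
  line-P i j = R.solve 2 (λ x t → (x R.:+ t) R.:* (x R.:+ t) R.:= (R.:- t R.:- x) R.:* (R.:- t R.:- x) R.:+ (R.con 0ℚ R.:- R.con 0ℚ) R.:* (R.con 0ℚ R.:- R.con 0ℚ))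
    ≃-refl (fromℚ (nat (suc (toℕ j)))) (C i * w i)

  P-dot-apex-line : ∀ i j → dot (Q zero) (P i) (Q (suc j)) ≃ (w i * ℓ i j) * C i
  P-dot-apex-line i j = R.solve 3 (λ x c w → (R.con 0ℚ R.:- (R.:- (c R.:* w))) R.:* (x R.:- (R.:- (c R.:* w))) R.:+ (R.con 1ℚ R.:- R.con 0ℚ) R.:* (R.con 0ℚ R.:- R.con 0ℚ) R.:= (w R.:* (x R.:+ c R.:* w)) R.:* c)
    ≃-refl (fromℚ (nat (suc (toℕ j)))) (C i) (w i)

  P-dot-line-apex : ∀ i j → dot (Q (suc j)) (P i) (Q zero) ≃ (ℓ i j * w i) * C i
  P-dot-line-apex i j = R.solve 3 (λ x c w → (x R.:- (R.:- (c R.:* w))) R.:* (R.con 0ℚ R.:- (R.:- (c R.:* w))) R.:+ (R.con 0ℚ R.:- R.con 0ℚ) R.:* (R.con 1ℚ R.:- R.con 0ℚ) R.:= ((x R.:+ c R.:* w) R.:* w) R.:* c)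
    ≃-refl (fromℚ (nat (suc (toℕ j)))) (C i) (w i)

  P-dot-line : ∀ i j k → dot (Q (suc j)) (P i) (Q (suc k)) ≃ (ℓ i j * ℓ i k) * 1ℝ
  P-dot-line i j k = R.solve 3 (λ x y t → (x R.:- (R.:- t)) R.:* (y R.:- (R.:- t)) R.:+ (R.con 0ℚ R.:- R.con 0ℚ) R.:* (R.con 0ℚ R.:- R.con 0ℚ) R.:= ((x R.:+ t) R.:* (y R.:+ t)) R.:* R.con 1ℚ)
    ≃-refl (fromℚ (nat (suc (toℕ j)))) (fromℚ (nat (suc (toℕ k)))) (C i * w i)

  line-dot-P : ∀ j i k → dot (P i) (Q (suc j)) (P k) ≃ (ℓ i j * ℓ k j) * 1ℝ
  line-dot-P j i k = R.solve 3 (λ x t u → (R.:- t R.:- x) R.:* (R.:- u R.:- x) R.:+ (R.con 0ℚ R.:- R.con 0ℚ) R.:* (R.con 0ℚ R.:- R.con 0ℚ) R.:= ((x R.:+ t) R.:* (x R.:+ u)) R.:* R.con 1ℚ)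
    ≃-refl (fromℚ (nat (suc (toℕ j)))) (C i * w i) (C k * w k)

  apex-dot-P : ∀ i k → dot (P i) (Q zero) (P k) ≃ (w i * w k) * cosine (θ i - θ k)
  apex-dot-P i k = ≃-trans
    (R.solve 2 (λ t u → (R.:- t R.:- R.con 0ℚ) R.:* (R.:- u R.:- R.con 0ℚ) R.:+ (R.con 0ℚ R.:- R.con 1ℚ) R.:* (R.con 0ℚ R.:- R.con 1ℚ) R.:= (R.:- t) R.:* (R.:- u) R.:+ R.con 1ℚ) ≃-refl (C i * w i) (C k * w k))
    (≃-trans (apex-dot {C i} {S i} {w i} {C k} {S k} {w k} (S*w i) (S*w k))
      (*-cong ≃-refl (≃-sym (cosine-difference (θ i) (θ k)))))

  -- Every angle value in (0, π) is a multiple of α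

  module _ {x} (0<x : 0ℝ < x) (x<π : x < π) where

    cosine≃⇒≃θ : ∀ i → cosine x ≃ C i → x ≃ θ i
    cosine≃⇒≃θ i = cosine-injective π isPi {x} {θ i} (<⇒≤ 0ℝ x 0<x) (<⇒≤ x π x<π) (NonNeg⇒0≤ (Pos⇒NonNeg (0<θ i))) (<⇒≤ (θ i) π (Pos⇒< (θ<π i)))

    -- Excludes pairs of axis points seen from an axis point: they lie on the same side of it, so
    -- the cosine is 1 = cos 0.
    ¬cosine≃1 : ¬ (cosine x ≃ 1ℝ)
    ¬cosine≃1 cx≃1 = ¬Pos-0 (cosine-injective π isPi {x} {0ℝ} (<⇒≤ 0ℝ x 0<x) (<⇒≤ x π x<π)
      (NonNeg⇒0≤ {0ℝ} (nonNeg (always λ _ → ℚ.≤-refl))) (<⇒≤ 0ℝ π (proj₁ isPi)) (≃-trans cx≃1 (≃-sym cosine-0))) (0<⇒Pos {x} 0<x)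

    at-P : ∀ v i j → i ≢ j → IsAngle π (Q i) (P v) (Q j) x → ∃[ k ] x ≃ θ k
    at-P v zero    zero    i≢j α = ⊥-elim (i≢j refl)
    at-P v zero    (suc j) i≢j α = v , cosine≃⇒≃θ v
      (angle⇒cosine {π} {a = Q zero} {P v} {Q (suc j)} {x} α (0<w v) (P-apex v) (0<ℓ v j) (P-line v j) (P-dot-apex-line v j))
    at-P v (suc i) zero    i≢j α = v , cosine≃⇒≃θ v
      (angle⇒cosine {π} {a = Q (suc i)} {P v} {Q zero} {x} α (0<ℓ v i) (P-line v i) (0<w v) (P-apex v) (P-dot-line-apex v i))
    at-P v (suc i) (suc j) i≢j α = ⊥-elim (¬cosine≃1
      (angle⇒cosine {π} {a = Q (suc i)} {P v} {Q (suc j)} {x} α (0<ℓ v i) (P-line v i) (0<ℓ v j) (P-line v j) (P-dot-line v i j)))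

    at-Q : ∀ v i j → i ≢ j → IsAngle π (P i) (Q v) (P j) x → ∃[ k ] x ≃ θ k
    at-Q zero i j i≢j α =
      let cx≃ = angle⇒cosine {π} {a = P i} {Q zero} {P j} {x} α (0<w i) (apex-P i) (0<w j) (apex-P j) (apex-dot-P i j)
          k , difference = gap i j i≢j
      -- Which of the two angles is larger is immaterial, since cosine is even.
      in k , cosine≃⇒≃θ k (≃-trans cx≃ ([ cosine-cong , (λ eq → begin
           cosine (θ i - θ j)         ≈⟨ cosine-neg (θ i - θ j) ⟨
           cosine (- (θ i - θ j))     ≈⟨ cosine-cong (R.solve 2 (λ x y → R.:- (x R.:- y) R.:= y R.:- x) ≃-refl (θ i) (θ j)) ⟩
           cosine (θ j - θ i)         ≈⟨ cosine-cong eq ⟩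
           cosine (θ k)               ∎) ]′ difference))
      where open ≃-Reasoning
    at-Q (suc v) i j i≢j α = ⊥-elim (¬cosine≃1
      (angle⇒cosine {π} {a = P i} {Q (suc v)} {P j} {x} α (0<ℓ i v) (line-P i v) (0<ℓ j v) (line-P j v) (line-dot-P v i j)))

  -- Distinctness, disjointness and noncollinearity

  θ-distinct : ∀ {i j} → θ i ≃ θ j → i ≡ j
  θ-distinct {i} {j} eq = decidable-stable (i Fin.≟ j) λ i≢j →
    let k , difference = gap i j i≢j
    in ¬Pos-0 ([ (λ d → ≃-trans (≃-sym d) (≃⇒-‿≃0 eq)) , (λ d → ≃-trans (≃-sym d) (≃⇒-‿≃0 (≃-sym eq))) ]′ difference) (0<θ k)

  -- The difference of the two abscissae, multiplied by both sines, is sin (θᵢ - θⱼ). For i ≠ j one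
  -- of θᵢ - θⱼ and θⱼ - θᵢ is some θₖ, whose sine is positive.
  P-distinct : ∀ i j → P i ≈ₚ P j → i ≡ j
  P-distinct i j (eq , _) = decidable-stable (i Fin.≟ j) λ i≢j →
    let k , difference = gap i j i≢j
    in ¬Pos-0 ([ (λ d → ≃-trans (sine-cong (≃-sym d)) (vanish i j (mk eq)))
               , (λ d → ≃-trans (sine-cong (≃-sym d)) (vanish j i (≃-sym (mk eq)))) ]′ difference) (0<S k)
    where
    open ≃-Reasoning
    vanish : ∀ i j → - (C i * w i) ≃ - (C j * w j) → sine (θ i - θ j) ≃ 0ℝ
    vanish i j eq = begin
      sine (θ i - θ j)
        ≈⟨ sine-difference (θ i) (θ j) ⟩
      S i * C j - C i * S j
        ≈⟨ R.solve 4 (λ s c c′ s′ → s R.:* c R.:- c′ R.:* s′ R.:= (s R.:* c) R.:* R.con 1ℚ R.:- (c′ R.:* s′) R.:* R.con 1ℚ) ≃-refl (S i) (C j) (C i) (S j) ⟩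
      (S i * C j) * 1ℝ - (C i * S j) * 1ℝ
        ≈⟨ +-cong (*-cong ≃-refl (S*w j)) (-‿cong (*-cong ≃-refl (S*w i))) ⟨
      (S i * C j) * (S j * w j) - (C i * S j) * (S i * w i)
        ≈⟨ R.solve 6 (λ s c w s′ c′ w′ → (s R.:* c′) R.:* (s′ R.:* w′) R.:- (c R.:* s′) R.:* (s R.:* w)
                          R.:= (s R.:* s′) R.:* ((R.:- (c R.:* w)) R.:- (R.:- (c′ R.:* w′)))) ≃-refl (S i) (C i) (w i) (S j) (C j) (w j) ⟩
      (S i * S j) * (- (C i * w i) - - (C j * w j))
        ≈⟨ *-cong ≃-refl (≃⇒-‿≃0 eq) ⟩
      (S i * S j) * 0ℝ
        ≈⟨ R.solve 1 (λ x → x R.:* R.con 0ℚ R.:= R.con 0ℚ) ≃-refl (S i * S j) ⟩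
      0ℝ ∎

  0≄1 : ¬ (0ℝ ≃ 1ℝ)
  0≄1 = fromℚ-distinct (ℚ.positive⁻¹ 1ℚ)

  Q-distinct : ∀ i j → Q i ≈ₚ Q j → i ≡ j
  Q-distinct zero    zero    _        = refl
  Q-distinct zero    (suc j) (_ , eq) = ⊥-elim (0≄1 (≃-sym (mk eq)))
  Q-distinct (suc i) zero    (_ , eq) = ⊥-elim (0≄1 (mk eq))
  Q-distinct (suc i) (suc j) (eq , _) = cong suc (Fin.toℕ-injective (ℕ.suc-injective
    (fromℚ-nat-injective {suc (toℕ i)} {suc (toℕ j)} (mk eq))))

  P-Q-disjoint : ∀ i j → ¬ (P i ≈ₚ Q j)
  P-Q-disjoint i zero    (_ , eq) = 0≄1 (mk eq)
  P-Q-disjoint i (suc j) (eq , _) = ¬Pos-0 (begin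
    x + C i * w i                  ≈⟨ +-cong (mk {y = x} eq) ≃-refl ⟨
    - (C i * w i) + C i * w i      ≈⟨ +-inverseˡ (C i * w i) ⟩
    0ℝ                             ∎) (0<ℓ i j)
    where
    open ≃-Reasoning
    x = fromℚ (nat (suc (toℕ j)))

  onLine : ∀ {a b c x y} → OnLine a b c (x , y) → a * x + b * y ≃ c
  onLine {a} {b} {c} {x} {y} eq = mk (subst (_≈ c)
    (trans (D+≡+ (a D.* x) (b D.* y)) (cong₂ _+_ (D*≡* a x) (D*≡* b y))) eq)

  -- Subtracting the equations at `P i` and at the first axis point of `Q` gives ℓ a = 0 with ℓ > 0.
  -- Then c = 0 by the axis point, and b = c by the apex. The index i is where m ≥ 1 enters.
  P-Q-noncollinear : (i : Fin m) → ¬ (∃[ a ] ∃[ b ] ∃[ c ]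
    (¬ (a ≈ 0ℝ × b ≈ 0ℝ) × (∀ i → OnLine a b c (P i)) × (∀ j → OnLine a b c (Q j))))
  P-Q-noncollinear i (a , b , c , ¬0 , on-P , on-Q) = ¬0 (un a≃0 , un b≃0)
    where
    open ≃-Reasoning
    t x : ℝ
    t = C i * w i
    x = fromℚ (nat 1)
    at-p : a * - t + b * 0ℝ ≃ c
    at-p = onLine {a} {b} {c} {(- t)} {0ℝ} (on-P i)
    at-q : a * x + b * 0ℝ ≃ c
    at-q = onLine {a} {b} {c} {x} {0ℝ} (on-Q (suc zero))
    at-apex : a * 0ℝ + b * 1ℝ ≃ c
    at-apex = onLine {a} {b} {c} {0ℝ} {1ℝ} (on-Q zero)
    a≃0 : a ≃ 0ℝ
    a≃0 = *-cancel-0 (λ ℓ≃0 → ¬Pos-0 ℓ≃0 (0<ℓ i zero)) (begin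
      (x + t) * a
        ≈⟨ R.solve 4 (λ a b x t → (x R.:+ t) R.:* a R.:= (a R.:* x R.:+ b R.:* R.con 0ℚ) R.:- (a R.:* (R.:- t) R.:+ b R.:* R.con 0ℚ)) ≃-refl a b x t ⟩
      (a * x + b * 0ℝ) - (a * - t + b * 0ℝ)
        ≈⟨ ≃⇒-‿≃0 (≃-trans at-q (≃-sym at-p)) ⟩
      0ℝ ∎)
    b≃0 : b ≃ 0ℝ
    b≃0 = begin
      b
        ≈⟨ R.solve 2 (λ a b → b R.:= (a R.:* R.con 0ℚ R.:+ b R.:* R.con 1ℚ)) ≃-refl a b ⟩
      a * 0ℝ + b * 1ℝ
        ≈⟨ ≃-trans at-apex (≃-sym at-q) ⟩
      a * x + b * 0ℝ
        ≈⟨ +-cong (*-cong a≃0 ≃-refl) ≃-refl ⟩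
      0ℝ * x + b * 0ℝ
        ≈⟨ R.solve 2 (λ b x → R.con 0ℚ R.:* x R.:+ b R.:* R.con 0ℚ R.:= R.con 0ℚ) ≃-refl b x ⟩
      0ℝ ∎

  configuration : Fin m → Configuration m (suc (suc n))
  configuration i = record
    { P            = P
    ; Q            = Q
    ; P-injective  = P-distinct
    ; Q-injective  = Q-distinct
    ; disjoint     = P-Q-disjoint
    ; noncollinear = P-Q-noncollinear i
    }

  attained : ∀ i → AngleFrom π P Q (θ i)
  attained i = Pos⇒0< (0<θ i) , Pos⇒< (θ<π i) , i , zero , suc zero , (λ ()) ,
    cosine⇒angle {π} {Q zero} {P i} {Q (suc zero)} {θ i} (NonNeg⇒0≤ (Pos⇒NonNeg (0<θ i))) (<⇒≤ (θ i) π (Pos⇒< (θ<π i)))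
      (NonNeg⇒0≤ (Pos⇒NonNeg (0<w i))) (P-apex i) (NonNeg⇒0≤ (Pos⇒NonNeg (0<ℓ i zero))) (P-line i zero) (P-dot-apex-line i zero) ≃-refl

  fromP : ∀ x → AngleFrom π P Q x → ∃[ k ] x ≈ θ k
  fromP x (0<x , x<π , v , i , j , i≢j , α) =
    let k , eq = at-P {x} 0<x x<π v i j i≢j α in k , un eq

  fromQ : ∀ x → AngleFrom π Q P x → ∃[ k ] x ≈ θ k
  fromQ x (0<x , x<π , v , i , j , i≢j , α) =
    let k , eq = at-Q {x} 0<x x<π v i j i≢j α in k , un eq

  angleCount : Fin m → AngleCount π m (suc (suc n)) m
  angleCount i = configuration i , θ ,
    (λ k → inj₁ (attained k)) ,
    (λ j k eq → θ-distinct {j} {k} (mk eq)) ,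
    (λ x → λ { (inj₁ α) → fromP x α ; (inj₂ α) → fromQ x α })

lemma5p2 : (π : ℝ) → IsPi π →
    (m n : ℕ) → 1 ℕ.≤ m → m ℕ.≤ n → 3 ℕ.≤ m ℕ.+ n →
    A≤ π m n m
-- The hypotheses m ≤ n and m + n ≥ 3 force n ≥ 2: room for the apex and one axis point.
lemma5p2 π isPi (suc m) (suc (suc n)) _ _ _ =
  (suc m , count , ℕ.≤-refl) , λ a (_ , minimal) → minimal (suc m) count
  where
  count : AngleCount π (suc m) (suc (suc n)) (suc m)
  count = Construction.angleCount π isPi (suc m) n zero
lemma5p2 π isPi (suc zero) (suc zero) _ _ (ℕ.s≤s (ℕ.s≤s ()))
lemma5p2 π isPi (suc (suc m)) (suc zero) _ (ℕ.s≤s ()) _
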